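{- (a) There is a constant $c>0$ such that for every $k\in\mathbb{N}$, every unsatisfiable $k$-CNF formula $F$ satisfies $e(F)\geq c\cdot 2.69^k$. (b) There is a constant $C>0$ such that for every $k\in\mathbb{N}$ there exists an unsatisfiable $k$-CNF formula $F$ with $e(F)\leq C\cdot 3.51^k$.
   Context: A literal is a boolean variable $x$ or its negation $\bar{x}$. A clause is a finite set of literals (a disjunction) containing no variable together with its negation; a CNF formula is a finite set of clauses (their conjunction). A $k$-CNF formula is a CNF formula in which every clause contains exactly $k$ literals. Two clauses conflict if there is a variable appearing positively in one of them and negatively in the other. $e(F)$ denotes the number of unordered pairs of clauses of $F$ that conflict (the number of edges of the conflict graph of $F$). -}

module Defs where

open import Data.Nat using (ℕ; zero; suc)
open import Data.Bool using (Bool; true; false; not)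
open import Data.Product using (_×_; _,_; proj₁; proj₂)
open import Data.List using (List; []; _∷_; length; filter)
open import Data.List.Relation.Unary.All using (All)
open import Data.List.Relation.Unary.Any using (Any; any?)
open import Data.List.Relation.Unary.AllPairs using (AllPairs)
open import Data.List.Relation.Unary.Unique.Propositional using (Unique)
open import Data.List.Membership.Propositional using (_∈_)
open import Data.List.Membership.DecPropositional using (_∈?_)
open import Data.List.Relation.Binary.Permutation.Propositional using (_↭_)
open import Data.Product.Properties using (≡-dec)
open import Data.Nat.Properties using () renaming (_≟_ to _≟ℕ_)
open import Data.Bool.Properties using () renaming (_≟_ to _≟B_)
open import Relation.Nullary using (¬_; Dec)
open import Relation.Binary.PropositionalEquality using (_≡_)
open import Data.Rational using (ℚ; 1ℚ; _*_)

-- Variables are natural numbers; a literal (x , true) is x, (x , false) is x̄.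
Literal : Set
Literal = ℕ × Bool

neg : Literal → Literal
neg (x , b) = (x , not b)

_≟L_ : (l m : Literal) → Dec (l ≡ m)
_≟L_ = ≡-dec _≟ℕ_ _≟B_

-- A clause: a finite set of literals (list without repetitions),
-- containing no variable together with its negation.
Clause : Set
Clause = List Literal

IsClause : Clause → Set
IsClause C = Unique C × All (λ l → ¬ (neg l ∈ C)) C

-- A CNF formula: a finite set of clauses (list of clauses, no two of
-- which are equal as sets, i.e. permutations of each other).
CNF : Set
CNF = List Clause

IsCNF : CNF → Set
IsCNF F = All IsClause F × AllPairs (λ C D → ¬ (C ↭ D)) F

Is-k-CNF : ℕ → CNF → Set
Is-k-CNF k F = IsCNF F × All (λ C → length C ≡ k) F

Assignment : Set
Assignment = ℕ → Bool

SatLit : Assignment → Literal → Set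
SatLit α (x , b) = α x ≡ b

SatClause : Assignment → Clause → Set
SatClause α C = Any (SatLit α) C

Satisfiable : CNF → Set
Satisfiable F = Σ' 
  where open import Data.Product using (Σ)
        Σ' = Σ Assignment (λ α → All (SatClause α) F)

Unsatisfiable : CNF → Set
Unsatisfiable F = ¬ Satisfiable F

Conflict : Clause → Clause → Set
Conflict C D = Any (λ l → neg l ∈ D) C

conflict? : (C D : Clause) → Dec (Conflict C D)
conflict? C D = any? (λ l → _∈?_ _≟L_ (neg l) D) C

e : CNF → ℕ
e [] = 0
e (C ∷ F) = length (filter (conflict? C) F) + e F
  where open import Data.Nat using (_+_)

_^ℚ_ : ℚ → ℕ → ℚ
q ^ℚ zero = 1ℚ
q ^ℚ suc n = q * (q ^ℚ n)

{-# OPTIONS --safe #-}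
module Submission where

-- (a) Lopsided local lemma with a product measure: if the violation probabilities of
-- the clauses conflicting with C sum to at most 1/4, for every C, the formula is
-- satisfiable.  Suppose e(F) is less than about bᴬᵏ / k, where bᴬ > 2.69, and let a literal
-- have level i if it occurs about bⁱᵏ times.  If the larger level i of the two literals of
-- a variable satisfies b^(i−A) ≥ 1/2, the literal of that level is made true with
-- probability b^(i−A); otherwise the variable is unbiased.
-- A clause C containing a literal whose negation has such a large level is violated with
-- probability at most deg(C) / (16 e(F)), so all these clauses together are negligible.
-- The other clauses are truncated to their literals of level at most t, with t chosen
-- such that the violation probability is below b^(−(t+1)k), which beats the number of
-- occurrences of each remaining literal.  Such a t exists by summation by parts, because
-- log₂ 2.69 − 1 + ∫ dy / (−y ln(1−y)) over [1/2, 1] is less than 1.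
--
-- (b) On n variables, let G be positive (k/3)-clauses hitting every assignment with
-- 0.37 n false variables, and N negative k-clauses hitting every assignment with 0.63 n
-- true ones, both greedily chosen with about 0.37^(−k/3) and 0.63^(−k) members.  Extend
-- each clause of G by the complete formula on 2k/3 private variables.  Conflicts only
-- occur within these extensions or between G and N, which gives O(3.51ᵏ) of them.

open import Defs
open import Data.Nat using (ℕ) renaming (_≤_ to _≤ℕ_)
open import Data.Product using (Σ; ∃; _×_; _,_; proj₁; proj₂)
open import Relation.Binary.PropositionalEquality using (_≡_; _≢_; refl; sym; trans; cong; cong₂; subst; subst₂; module ≡-Reasoning)

-- With unbiased variables every k-clause fails with probability 2^-k, and the local lemma yields
-- only about 2^k conflicts. Favouring the frequent literals goes further, but a clause mixing rare
-- literals with a frequent one may still fail too often for its many neighbours through the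
-- frequent one. Truncation drops the frequent literals, and with them those conflicts, at the price
-- of a shorter clause. The origin of the integral: put A = log_b 2.69 and y = b^-r with r = A - i.
-- A favoured literal of level i fails with probability 1 - y, so it adds log_b(1/(1-y)) to the
-- exponent of the clause. The reciprocals of these gains, summed over r up to log_b 2, approximate
-- the integral; the unbiased levels gain log_b 2 each and contribute log₂ 2.69 - 1. In (b) the
-- exponent k/3 and the density 0.37 balance two counts. A block has at most 4^(2k/3) internal
-- conflicts and at most 2^(2k/3) 0.63^-k with the negative clauses, up to polynomial factors, and
-- 4^(2/3) is almost 2^(2/3)/0.63. The resulting rate is the cube root of 16/0.37, just below 3.51.

module Naturals where

  open import Data.Bool using (Bool; true; false; not; _∧_) renaming (T to True)
  open import Data.Bool.Properties using (not-involutive; not-¬; T-∧) renaming (_≟_ to _≟B_)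
  open import Data.List using (List; []; _∷_; _++_; length; filter; map; concatMap; downFrom)
  open import Data.List.Membership.DecPropositional using (_∈?_)
  open import Data.List.Membership.Propositional using (_∈_; find; lose)
  open import Data.List.Membership.Propositional.Properties using (∈-filter⁺; ∈-filter⁻; ∈-map⁺; ∈-map⁻; ∈-++⁺ˡ; ∈-++⁺ʳ; ∈-++⁻; ∈-concatMap⁻; ∈-downFrom⁻)
  open import Data.List.Properties using (filter-notAll; length-filter; length-++; length-map; length-downFrom)
  open import Data.List.Relation.Binary.Permutation.Propositional using (_↭_; ↭-sym)
  open import Data.List.Relation.Binary.Permutation.Propositional.Properties using (∈-resp-↭)
  open import Data.List.Relation.Unary.All using (All; []; _∷_; all?)
  import Data.List.Relation.Unary.All as All
  import Data.List.Relation.Unary.All.Properties as All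
  open import Data.List.Relation.Unary.AllPairs using (AllPairs; []; _∷_)
  import Data.List.Relation.Unary.AllPairs.Properties as AllPairs
  open import Data.List.Relation.Unary.Any using (Any; here; there; any?)
  import Data.List.Relation.Unary.Any as Any
  import Data.List.Relation.Unary.Any.Properties as Any
  open import Data.List.Relation.Unary.Unique.Propositional using (Unique)
  open import Data.Maybe using (Maybe; just; nothing; fromMaybe)
  open import Data.Nat
  open import Data.Nat.DivMod using (_/_; _%_; m≡m%n+[m/n]*n; m%n<n; m/n*n≤m; /-monoʳ-≤)
  open import Data.Nat.Properties
  open import Data.Nat.Tactic.RingSolver using (solve-∀)
  open import Data.Sum using (_⊎_; inj₁; inj₂)
  open import Data.Unit using (tt)
  open import Data.Vec using (Vec; []; _∷_)
  open import Function using (_∘_; const; Equivalence)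
  open import Relation.Nullary using (¬_; Dec; yes; no; contradiction)
  open import Relation.Nullary.Decidable using (¬?; _×-dec_)

  -- Powers of natural numbers

  -- Bernoulli's inequality (1 + b/a)^n ≥ 1 + n b/a, cleared of denominators. It absorbs polynomial
  -- factors into a slightly larger base and bounds the number of greedy rounds.
  bernoulli : ∀ a b n → (a + n * b) * a ^ n ≤ a * (a + b) ^ n
  bernoulli a b zero    = ≤-reflexive (alg a)
    where
    alg : ∀ a → (a + 0) * 1 ≡ a * 1
    alg = solve-∀
  bernoulli a b (suc n) = begin
    (a + (b + n * b)) * (a * a ^ n)           ≤⟨ m≤m+n _ (n * b * b * a ^ n) ⟩
    (a + (b + n * b)) * (a * a ^ n) + n * b * b * a ^ n
                                              ≡⟨ alg₁ a b n (a ^ n) ⟩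
    (a + b) * ((a + n * b) * a ^ n)           ≤⟨ *-monoʳ-≤ (a + b) (bernoulli a b n) ⟩
    (a + b) * (a * (a + b) ^ n)               ≡⟨ alg₂ (a + b) a _ ⟩
    a * ((a + b) * (a + b) ^ n)               ∎
    where
    open ≤-Reasoning
    alg₁ : ∀ a b n x → (a + (b + n * b)) * (a * x) + n * b * b * x ≡ (a + b) * ((a + n * b) * x)
    alg₁ = solve-∀
    alg₂ : ∀ x y z → x * (y * z) ≡ y * (x * z)
    alg₂ = solve-∀

  ^-distrib-* : ∀ x y n → (x * y) ^ n ≡ x ^ n * y ^ n
  ^-distrib-* x y zero    = refl
  ^-distrib-* x y (suc n) = trans (cong (x * y *_) (^-distrib-* x y n)) (alg x y (x ^ n) (y ^ n))
    where
    alg : ∀ a b c d → a * b * (c * d) ≡ a * c * (b * d)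
    alg = solve-∀

  -- Finite sums

  ∑ : {A : Set} → (A → ℕ) → List A → ℕ
  ∑ f []       = 0
  ∑ f (x ∷ xs) = f x + ∑ f xs

  ⟦_⟧ : {P : Set} → Dec P → ℕ
  ⟦ yes _ ⟧ = 1
  ⟦ no _ ⟧  = 0

  ⟦⟧≤1 : {P : Set} (P? : Dec P) → ⟦ P? ⟧ ≤ 1
  ⟦⟧≤1 (yes _) = ≤-refl
  ⟦⟧≤1 (no _)  = z≤n

  ⟦⟧-yes : {P : Set} (P? : Dec P) → P → ⟦ P? ⟧ ≡ 1
  ⟦⟧-yes (yes _) p = refl
  ⟦⟧-yes (no ¬p) p = contradiction p ¬p

  ⟦⟧-no : {P : Set} (P? : Dec P) → ¬ P → ⟦ P? ⟧ ≡ 0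
  ⟦⟧-no (yes p) ¬p = contradiction p ¬p
  ⟦⟧-no (no _)  ¬p = refl

  ⟦⟧-mono : {P Q : Set} (P? : Dec P) (Q? : Dec Q) → (P → Q) → ⟦ P? ⟧ ≤ ⟦ Q? ⟧
  ⟦⟧-mono (yes p) Q? f = ≤-reflexive (sym (⟦⟧-yes Q? (f p)))
  ⟦⟧-mono (no _)  Q? f = z≤n

  ⟦⟧*-≤ : {P : Set} (P? : Dec P) {x y : ℕ} → (P → x ≤ y) → ⟦ P? ⟧ * x ≤ y
  ⟦⟧*-≤ (yes p) {x} x≤y = subst (_≤ _) (sym (*-identityˡ x)) (x≤y p)
  ⟦⟧*-≤ (no _)      x≤y = z≤n

  module _ {A : Set} where

    ∑-mono : {f g : A → ℕ} (xs : List A) → (∀ {x} → x ∈ xs → f x ≤ g x) → ∑ f xs ≤ ∑ g xs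
    ∑-mono []       f≤g = z≤n
    ∑-mono (x ∷ xs) f≤g = +-mono-≤ (f≤g (here refl)) (∑-mono xs (f≤g ∘ there))

    ∑-cong : {f g : A → ℕ} (xs : List A) → (∀ x → f x ≡ g x) → ∑ f xs ≡ ∑ g xs
    ∑-cong []       f≡g = refl
    ∑-cong (x ∷ xs) f≡g = cong₂ _+_ (f≡g x) (∑-cong xs f≡g)

    ∑-+ : (f g : A → ℕ) (xs : List A) → ∑ (λ x → f x + g x) xs ≡ ∑ f xs + ∑ g xs
    ∑-+ f g []       = refl
    ∑-+ f g (x ∷ xs) = trans (cong (f x + g x +_) (∑-+ f g xs)) (lem (f x) (g x) (∑ f xs) (∑ g xs))
      where
      lem : ∀ a b c d → a + b + (c + d) ≡ a + c + (b + d)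
      lem = solve-∀

    ∑-*ˡ : (a : ℕ) (f : A → ℕ) (xs : List A) → ∑ (λ x → a * f x) xs ≡ a * ∑ f xs
    ∑-*ˡ a f []       = sym (*-zeroʳ a)
    ∑-*ˡ a f (x ∷ xs) = trans (cong (a * f x +_) (∑-*ˡ a f xs)) (sym (*-distribˡ-+ a (f x) (∑ f xs)))

    ∑-const : (a : ℕ) (xs : List A) → ∑ (const a) xs ≡ length xs * a
    ∑-const a []       = refl
    ∑-const a (x ∷ xs) = cong (a +_) (∑-const a xs)

    ∑-member : (f : A → ℕ) {x : A} {xs : List A} → x ∈ xs → f x ≤ ∑ f xs
    ∑-member f {xs = _ ∷ xs} (here refl) = m≤m+n (f _) (∑ f xs)
    ∑-member f {xs = y ∷ xs} (there x∈)  = ≤-trans (∑-member f x∈) (m≤n+m (∑ f xs) (f y))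

    ∑-filter : {P : A → Set} (P? : ∀ x → Dec (P x)) (f : A → ℕ) (xs : List A) →
               ∑ f (filter P? xs) ≡ ∑ (λ x → ⟦ P? x ⟧ * f x) xs
    ∑-filter P? f []       = refl
    ∑-filter P? f (x ∷ xs) with P? x
    ... | yes _ = cong₂ _+_ (sym (+-identityʳ (f x))) (∑-filter P? f xs)
    ... | no _  = ∑-filter P? f xs

    length-filter≡∑ : {P : A → Set} (P? : ∀ x → Dec (P x)) (xs : List A) →
                      length (filter P? xs) ≡ ∑ (λ x → ⟦ P? x ⟧) xs
    length-filter≡∑ P? []       = refl
    length-filter≡∑ P? (x ∷ xs) with P? x
    ... | yes _ = cong suc (length-filter≡∑ P? xs)
    ... | no _  = length-filter≡∑ P? xs

  ∑-swap : {A B : Set} (f : A → B → ℕ) (xs : List A) (ys : List B) →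
           ∑ (λ x → ∑ (f x) ys) xs ≡ ∑ (λ y → ∑ (λ x → f x y) xs) ys
  ∑-swap f []       ys = sym (trans (∑-const 0 ys) (*-zeroʳ (length ys)))
  ∑-swap f (x ∷ xs) ys = trans (cong (∑ (f x) ys +_) (∑-swap f xs ys))
                               (sym (∑-+ (f x) (λ y → ∑ (λ x → f x y) xs) ys))

  ∑-map : ∀ {X Y : Set} (f : Y → ℕ) (g : X → Y) xs → ∑ f (map g xs) ≡ ∑ (f ∘ g) xs
  ∑-map f g []       = refl
  ∑-map f g (x ∷ xs) = cong (f (g x) +_) (∑-map f g xs)

  ∑-++ : ∀ {X : Set} (f : X → ℕ) xs ys → ∑ f (xs ++ ys) ≡ ∑ f xs + ∑ f ys
  ∑-++ f []       ys = refl
  ∑-++ f (x ∷ xs) ys = trans (cong (f x +_) (∑-++ f xs ys)) (sym (+-assoc (f x) _ _))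

  ∑-concatMap : ∀ {X Y : Set} (f : Y → ℕ) (g : X → List Y) xs → ∑ f (concatMap g xs) ≡ ∑ (λ x → ∑ f (g x)) xs
  ∑-concatMap f g []       = refl
  ∑-concatMap f g (x ∷ xs) = trans (∑-++ f (g x) (concatMap g xs)) (cong (∑ f (g x) +_) (∑-concatMap f g xs))

  length≡∑ : ∀ {X : Set} (xs : List X) → length xs ≡ ∑ (const 1) xs
  length≡∑ xs = sym (trans (∑-const 1 xs) (*-identityʳ (length xs)))

  -- Product measures on {0,1}ⁿ with natural weights

  Weight : Set
  Weight = ℕ → Bool → ℕ

  -- Unnormalised: the expectation is `E n w g / Total n w`, so statements about probabilities below
  -- are multiplied by powers of `Total`.
  E : ∀ n → Weight → (Vec Bool n → ℕ) → ℕ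
  E zero    w g = g []
  E (suc n) w g = w 0 true  * E n (w ∘ suc) (g ∘ (true ∷_))
                + w 0 false * E n (w ∘ suc) (g ∘ (false ∷_))

  Total : ℕ → Weight → ℕ
  Total n w = E n w (const 1)

  E-mono : ∀ n w {f g : Vec Bool n → ℕ} → (∀ v → f v ≤ g v) → E n w f ≤ E n w g
  E-mono zero    w f≤g = f≤g []
  E-mono (suc n) w f≤g = +-mono-≤ (*-monoʳ-≤ (w 0 true)  (E-mono n (w ∘ suc) (f≤g ∘ (true ∷_))))
                                  (*-monoʳ-≤ (w 0 false) (E-mono n (w ∘ suc) (f≤g ∘ (false ∷_))))

  E-cong : ∀ n w {f g : Vec Bool n → ℕ} → (∀ v → f v ≡ g v) → E n w f ≡ E n w g
  E-cong n w f≡g = ≤-antisym (E-mono n w (≤-reflexive ∘ f≡g)) (E-mono n w (≤-reflexive ∘ sym ∘ f≡g))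

  E-+ : ∀ n w (f g : Vec Bool n → ℕ) → E n w (λ v → f v + g v) ≡ E n w f + E n w g
  E-+ zero    w f g = refl
  E-+ (suc n) w f g
    rewrite E-+ n (w ∘ suc) (f ∘ (true ∷_)) (g ∘ (true ∷_))
          | E-+ n (w ∘ suc) (f ∘ (false ∷_)) (g ∘ (false ∷_)) = lem (w 0 true) _ _ (w 0 false) _ _
    where
    lem : ∀ a x y b z t → a * (x + y) + b * (z + t) ≡ a * x + b * z + (a * y + b * t)
    lem = solve-∀

  E-*ˡ : ∀ n w a (f : Vec Bool n → ℕ) → E n w (λ v → a * f v) ≡ a * E n w f
  E-*ˡ zero    w a f = refl
  E-*ˡ (suc n) w a f
    rewrite E-*ˡ n (w ∘ suc) a (f ∘ (true ∷_))
          | E-*ˡ n (w ∘ suc) a (f ∘ (false ∷_)) = lem (w 0 true) (w 0 false) a _ _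
    where
    lem : ∀ b c a x y → b * (a * x) + c * (a * y) ≡ a * (b * x + c * y)
    lem = solve-∀

  E-∑ : ∀ {A : Set} n w (f : A → Vec Bool n → ℕ) (xs : List A) →
        E n w (λ v → ∑ (λ x → f x v) xs) ≡ ∑ (λ x → E n w (f x)) xs
  E-∑ n w f []       = E-*ˡ n w 0 (const 0)
  E-∑ n w f (x ∷ xs) = trans (E-+ n w (f x) (λ v → ∑ (λ x → f x v) xs))
                             (cong (E n w (f x) +_) (E-∑ n w f xs))

  E-positive : ∀ n w (g : Vec Bool n → ℕ) → 0 < E n w g → Σ (Vec Bool n) (λ v → 0 < g v)
  E-positive zero    w g 0<E = [] , 0<E
  E-positive (suc n) w g 0<E with E n (w ∘ suc) (g ∘ (true ∷_)) in eq₁ | E n (w ∘ suc) (g ∘ (false ∷_)) in eq₂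
  ... | suc _ | _ with v , p ← E-positive n (w ∘ suc) (g ∘ (true ∷_)) (subst (0 <_) (sym eq₁) z<s) = true ∷ v , p
  ... | zero | suc _ with v , p ← E-positive n (w ∘ suc) (g ∘ (false ∷_)) (subst (0 <_) (sym eq₂) z<s) = false ∷ v , p
  ... | zero | zero rewrite *-zeroʳ (w 0 true) | *-zeroʳ (w 0 false) = contradiction 0<E (<-irrefl refl)

  Total-positive : ∀ n w → (∀ x → 0 < w x true + w x false) → 0 < Total n w
  Total-positive zero    w pos = z<s
  Total-positive (suc n) w pos =
    subst (0 <_) (*-distribʳ-+ (Total n (w ∘ suc)) (w 0 true) (w 0 false))
      (*-mono-< (pos 0) (Total-positive n (w ∘ suc) (pos ∘ suc)))

  -- Subcubes, given by the prescribed values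

  Cube : Set
  Cube = ℕ → Maybe Bool

  agrees : Maybe Bool → Bool → ℕ
  agrees nothing      _     = 1
  agrees (just true)  true  = 1
  agrees (just true)  false = 0
  agrees (just false) true  = 0
  agrees (just false) false = 1

  inside : ∀ {n} → Cube → Vec Bool n → ℕ
  inside c []      = 1
  inside c (b ∷ v) = agrees (c 0) b * inside (c ∘ suc) v

  overwrite : ∀ {n} → Cube → Vec Bool n → Vec Bool n
  overwrite c []      = []
  overwrite c (b ∷ v) = fromMaybe b (c 0) ∷ overwrite (c ∘ suc) v

  get : ∀ {n} → Vec Bool n → ℕ → Bool
  get []      _       = false
  get (b ∷ v) zero    = b
  get (b ∷ v) (suc x) = get v x

  set : ℕ → Bool → Cube → Cube
  set zero    b c zero    = just b
  set zero    b c (suc y) = c (suc y)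
  set (suc x) b c zero    = c zero
  set (suc x) b c (suc y) = set x b (c ∘ suc) y

  set-just : ∀ x b c y {d} → set x b c y ≡ just d → (y ≡ x × d ≡ b) ⊎ (c y ≡ just d)
  set-just zero    b c zero    refl = inj₁ (refl , refl)
  set-just zero    b c (suc y) eq   = inj₂ eq
  set-just (suc x) b c zero    eq   = inj₂ eq
  set-just (suc x) b c (suc y) eq with set-just x b (c ∘ suc) y eq
  ... | inj₁ (refl , refl) = inj₁ (refl , refl)
  ... | inj₂ eq′           = inj₂ eq′

  get-overwrite : ∀ {n} (c : Cube) (v : Vec Bool n) x {b} → get (overwrite c v) x ≡ b →
                  (c x ≡ just b) ⊎ (get v x ≡ b)
  get-overwrite c []      x       eq = inj₂ eq
  get-overwrite c (a ∷ v) (suc x) eq = get-overwrite (c ∘ suc) v x eq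
  get-overwrite c (a ∷ v) zero    eq with c 0
  ... | nothing = inj₂ eq
  ... | just _  = inj₁ (cong just eq)

  inside-agree : ∀ {n} (c : Cube) (v : Vec Bool n) → (∀ x {b} → c x ≡ just b → get v x ≡ b) → inside c v ≡ 1
  inside-agree c []      agree = refl
  inside-agree c (a ∷ v) agree
    rewrite inside-agree (c ∘ suc) v (agree ∘ suc) with c 0 | agree 0
  ... | nothing    | _  = refl
  ... | just true  | eq rewrite eq refl = refl
  ... | just false | eq rewrite eq refl = refl

  E-inside-suc : ∀ n w c → E (suc n) w (inside c) ≡
                 (w 0 true * agrees (c 0) true + w 0 false * agrees (c 0) false) * E n (w ∘ suc) (inside (c ∘ suc))
  E-inside-suc n w c
    rewrite E-*ˡ n (w ∘ suc) (agrees (c 0) true)  (inside (c ∘ suc))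
          | E-*ˡ n (w ∘ suc) (agrees (c 0) false) (inside (c ∘ suc))
    = lem (w 0 true) (w 0 false) (agrees (c 0) true) (agrees (c 0) false) _
    where
    lem : ∀ a b x y i → a * (x * i) + b * (y * i) ≡ (a * x + b * y) * i
    lem = solve-∀

  -- Conditioning a product measure on a subcube amounts to drawing a point freely and then
  -- overwriting the prescribed coordinates.
  E-inside-* : ∀ n w c (g : Vec Bool n → ℕ) →
               E n w (λ v → inside c v * g v) * Total n w ≡ E n w (inside c) * E n w (g ∘ overwrite c)
  E-inside-* zero    w c g = *-identityʳ (1 * g [])
  E-inside-* (suc n) w c g = begin
    (a * E n w′ (λ v → x * inside c′ v * g (true ∷ v)) + b * E n w′ (λ v → y * inside c′ v * g (false ∷ v)))
      * (a * t + b * t)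
      ≡⟨ cong (_* (a * t + b * t)) (cong₂ (λ p q → a * p + b * q) (scale x true) (scale y false)) ⟩
    (a * (x * E n w′ (λ v → inside c′ v * g (true ∷ v))) + b * (y * E n w′ (λ v → inside c′ v * g (false ∷ v))))
      * (a * t + b * t)
      ≡⟨ lem a b x y _ _ t ⟩
    (a + b) * (a * x * (E n w′ (λ v → inside c′ v * g (true ∷ v)) * t)
             + b * y * (E n w′ (λ v → inside c′ v * g (false ∷ v)) * t))
      ≡⟨ cong₂ (λ p q → (a + b) * (a * x * p + b * y * q)) (E-inside-* n w′ c′ (g ∘ (true ∷_)))
                                                           (E-inside-* n w′ c′ (g ∘ (false ∷_))) ⟩
    (a + b) * (a * x * (i * restricted true) + b * y * (i * restricted false))
      ≡⟨ finish (c 0) a b i restricted ⟩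
    (a * x + b * y) * i * (a * restricted (fromMaybe true (c 0)) + b * restricted (fromMaybe false (c 0)))
      ≡⟨ cong (_* (a * restricted (fromMaybe true (c 0)) + b * restricted (fromMaybe false (c 0)))) (E-inside-suc n w c) ⟨
    E (suc n) w (inside c) * E (suc n) w (g ∘ overwrite c) ∎
    where
    open ≡-Reasoning
    w′ = w ∘ suc
    c′ = c ∘ suc
    a = w 0 true
    b = w 0 false
    x = agrees (c 0) true
    y = agrees (c 0) false
    t = Total n w′
    i = E n w′ (inside c′)
    restricted : Bool → ℕ
    restricted d = E n w′ ((g ∘ (d ∷_)) ∘ overwrite c′)
    scale : ∀ z d → E n w′ (λ v → z * inside c′ v * g (d ∷ v)) ≡ z * E n w′ (λ v → inside c′ v * g (d ∷ v))
    scale z d = trans (E-cong n w′ (λ v → *-assoc z (inside c′ v) (g (d ∷ v)))) (E-*ˡ n w′ z _)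
    lem : ∀ a b x y p q t → (a * (x * p) + b * (y * q)) * (a * t + b * t) ≡
                            (a + b) * (a * x * (p * t) + b * y * (q * t))
    lem = solve-∀
    finish : ∀ m a b i (r : Bool → ℕ) →
      (a + b) * (a * agrees m true * (i * r true) + b * agrees m false * (i * r false)) ≡
      (a * agrees m true + b * agrees m false) * i * (a * r (fromMaybe true m) + b * r (fromMaybe false m))
    finish nothing a b i r = alg a b i (r true) (r false)
      where
      alg : ∀ a b i p q → (a + b) * (a * 1 * (i * p) + b * 1 * (i * q)) ≡ (a * 1 + b * 1) * i * (a * p + b * q)
      alg = solve-∀
    finish (just true) a b i r = alg a b i (r true) (r false)
      where
      alg : ∀ a b i p q → (a + b) * (a * 1 * (i * p) + b * 0 * (i * q)) ≡ (a * 1 + b * 0) * i * (a * p + b * p)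
      alg = solve-∀
    finish (just false) a b i r = alg a b i (r true) (r false)
      where
      alg : ∀ a b i p q → (a + b) * (a * 0 * (i * p) + b * 1 * (i * q)) ≡ (a * 0 + b * 1) * i * (a * q + b * q)
      alg = solve-∀

  E-inside-set : ∀ n w x b c → x < n → c x ≡ nothing →
                 E n w (inside (set x b c)) * (w x true + w x false) ≡ w x b * E n w (inside c)
  E-inside-set (suc n) w zero b c x<n eq
    rewrite E-inside-suc n w (set zero b c) | E-inside-suc n w c | eq = alg b (w 0) (E n (w ∘ suc) (inside (c ∘ suc)))
    where
    algₜ : ∀ p q i → (p * 1 + q * 0) * i * (p + q) ≡ p * ((p * 1 + q * 1) * i)
    algₜ = solve-∀
    algₑ : ∀ p q i → (p * 0 + q * 1) * i * (p + q) ≡ q * ((p * 1 + q * 1) * i)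
    algₑ = solve-∀
    alg : ∀ b (u : Bool → ℕ) i → (u true * agrees (just b) true + u false * agrees (just b) false) * i * (u true + u false)
                               ≡ u b * ((u true * 1 + u false * 1) * i)
    alg true  u i = algₜ (u true) (u false) i
    alg false u i = algₑ (u true) (u false) i
  E-inside-set (suc n) w (suc x) b c (s≤s x<n) eq
    rewrite E-inside-suc n w (set (suc x) b c) | E-inside-suc n w c = begin
    s * E n w′ (inside (set x b c′)) * z    ≡⟨ *-assoc s _ z ⟩
    s * (E n w′ (inside (set x b c′)) * z)  ≡⟨ cong (s *_) (E-inside-set n w′ x b c′ x<n eq) ⟩
    s * (w′ x b * E n w′ (inside c′))       ≡⟨ alg s (w′ x b) _ ⟩
    w′ x b * (s * E n w′ (inside c′))       ∎
    where
    open ≡-Reasoning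
    w′ = w ∘ suc
    c′ = c ∘ suc
    s = w 0 true * agrees (c 0) true + w 0 false * agrees (c 0) false
    z = w′ x true + w′ x false
    alg : ∀ a b c → a * (b * c) ≡ b * (a * c)
    alg = solve-∀

  -- The lopsided local lemma

  falsifier : Clause → Cube
  falsifier []            = const nothing
  falsifier ((x , b) ∷ C) = set x (not b) (falsifier C)

  falsifier-just : ∀ C x {b} → falsifier C x ≡ just b → (x , not b) ∈ C
  falsifier-just ((y , d) ∷ C) x eq with set-just y (not d) (falsifier C) x eq
  ... | inj₁ (refl , refl) = here (cong (y ,_) (not-involutive d))
  ... | inj₂ eq′           = there (falsifier-just C x eq′)

  falsifier-nothing : ∀ C x → (∀ b → ¬ (x , b) ∈ C) → falsifier C x ≡ nothing
  falsifier-nothing C x x∉C with falsifier C x in eq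
  ... | nothing = refl
  ... | just b  = contradiction (falsifier-just C x eq) (x∉C (not b))

  satClause? : ∀ α C → Dec (SatClause α C)
  satClause? α = any? (λ l → α (proj₁ l) ≟B proj₂ l)

  satisfies : ∀ {n} → CNF → Vec Bool n → ℕ
  satisfies S v = ⟦ all? (satClause? (get v)) S ⟧

  SatClause-∈ : ∀ {α x b C} → (x , b) ∈ C → α x ≡ b → SatClause α C
  SatClause-∈ (here refl) eq = here eq
  SatClause-∈ (there l∈)  eq = there (SatClause-∈ l∈ eq)

  SatClause-witness : ∀ {α C} → SatClause α C → Σ Literal (λ l → l ∈ C × SatLit α l)
  SatClause-witness (here eq) = _ , here refl , eq
  SatClause-witness (there s) with l , l∈ , eq ← SatClause-witness s = l , there l∈ , eq

  inside-unsat : ∀ {n} C (v : Vec Bool n) → ¬ SatClause (get v) C → inside (falsifier C) v ≡ 1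
  inside-unsat C v ¬sat = inside-agree (falsifier C) v agree
    where
    agree : ∀ x {b} → falsifier C x ≡ just b → get v x ≡ b
    agree x {b} eq with get v x in eqv | b | falsifier-just C x eq
    ... | true  | true  | _  = refl
    ... | false | false | _  = refl
    ... | true  | false | l∈ = contradiction (SatClause-∈ l∈ eqv) ¬sat
    ... | false | true  | l∈ = contradiction (SatClause-∈ l∈ eqv) ¬sat

  conflict-∈ : ∀ {C D : Clause} {l} → l ∈ C → neg l ∈ D → Conflict C D
  conflict-∈ (here refl) nl∈ = here nl∈
  conflict-∈ (there l∈)  nl∈ = there (conflict-∈ l∈ nl∈)

  -- Overwriting changes values only to make literals of C false. If this made a literal of D true,
  -- the negation of that literal would lie in C, which is a conflict.
  sat-overwrite : ∀ {n} C D (v : Vec Bool n) → ¬ Conflict C D →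
                  SatClause (get (overwrite (falsifier C) v)) D → SatClause (get v) D
  sat-overwrite C D v ¬conf sat with (x , b) , l∈ , eq ← SatClause-witness sat
    with get-overwrite (falsifier C) v x eq
  ... | inj₂ eq′ = SatClause-∈ l∈ eq′
  ... | inj₁ eq′ = contradiction
        (conflict-∈ (falsifier-just C x eq′) (subst (λ d → (x , d) ∈ D) (sym (not-involutive b)) l∈)) ¬conf

  -- This is where the bound 1/4 on neighbour sums is spent: the first premise reads x ≤ y +
  -- 2x(s/T), and 2s/T is at most 1/2.
  halve : ∀ T .{{_ : NonZero T}} x y s → T * x ≤ T * y + 2 * x * s → 4 * s ≤ T → x ≤ 2 * y
  halve T x y s step small = *-cancelˡ-≤ T (+-cancelʳ-≤ (T * x) _ _ (begin
    T * x + T * x                ≡⟨ alg₁ T x ⟩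
    2 * (T * x)                  ≤⟨ *-monoʳ-≤ 2 step ⟩
    2 * (T * y + 2 * x * s)      ≡⟨ alg₂ T x y s ⟩
    T * (2 * y) + 4 * s * x      ≤⟨ +-monoʳ-≤ (T * (2 * y)) (*-monoˡ-≤ x small) ⟩
    T * (2 * y) + T * x          ∎))
    where
    open ≤-Reasoning
    alg₁ : ∀ T x → T * x + T * x ≡ 2 * (T * x)
    alg₁ = solve-∀
    alg₂ : ∀ T x y s → 2 * (T * y + 2 * x * s) ≡ T * (2 * y) + 4 * s * x
    alg₂ = solve-∀

  module LocalLemma (n : ℕ) (w : Weight) (positive : ∀ x → 0 < w x true + w x false) where

    T : ℕ
    T = Total n w

    p : Clause → ℕ
    p C = E n w (inside (falsifier C))

    violates : Clause → CNF → Vec Bool n → ℕ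
    violates C S v = inside (falsifier C) v * satisfies S v

    instance
      T-nonZero : NonZero T
      T-nonZero = >-nonZero (Total-positive n w positive)

    -- The lopsided ingredient: a clause not conflicting with C may share variables with it, but
    -- only with equal signs, so violating C can only hurt that clause. Conditioning on the
    -- violation therefore does not make S more likely.
    correlation : ∀ C S → (∀ {D} → D ∈ S → ¬ Conflict C D) → E n w (violates C S) * T ≤ p C * E n w (satisfies S)
    correlation C S ¬conf = begin
      E n w (violates C S) * T                             ≡⟨ E-inside-* n w (falsifier C) (satisfies S) ⟩
      p C * E n w (satisfies S ∘ overwrite (falsifier C))  ≤⟨ *-monoʳ-≤ (p C) (E-mono n w λ v →
           ⟦⟧-mono (all? _ S) (all? _ S) λ sats → All.tabulate λ D∈ →
             sat-overwrite C _ v (¬conf D∈) (All.lookup sats D∈)) ⟩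
      p C * E n w (satisfies S) ∎
      where open ≤-Reasoning

    module _ (F : CNF)
             (p< : ∀ {C} → C ∈ F → 2 * p C < T)
             (neighbours≤ : ∀ {C} → C ∈ F → 4 * ∑ (λ D → ⟦ conflict? C D ⟧ * p D) F ≤ T) where

      -- The induction passes to sublists S of F. Only the range of the neighbour sum shrinks; C
      -- still ranges over all of F.
      Sub : CNF → Set
      Sub S = (∀ {C} → C ∈ S → C ∈ F) × (∀ {C} → C ∈ F → 4 * ∑ (λ D → ⟦ conflict? C D ⟧ * p D) S ≤ T)

      Sub-filter : ∀ {P : Clause → Set} (P? : ∀ D → Dec (P D)) {S} → Sub S → Sub (filter P? S)
      Sub-filter P? {S} (S⊆F , small) = (λ C∈ → S⊆F (proj₁ (∈-filter⁻ P? C∈))) , λ {C} C∈F → ≤-trans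
        (*-monoʳ-≤ 4 (≤-trans (≤-reflexive (∑-filter P? _ S))
          (∑-mono S (λ {D} _ → ≤-trans (*-monoˡ-≤ (⟦ conflict? C D ⟧ * p D) (⟦⟧≤1 (P? D)))
                                       (≤-reflexive (*-identityˡ _))))))
        (small C∈F)

      -- An assignment satisfying the clauses that do not conflict with C, but not all of S,
      -- violates some D in S, and this D must conflict with C.
      weaken : ∀ C S v → satisfies (filter (¬? ∘ conflict? C) S) v ≤
               satisfies S v + ∑ (λ D → ⟦ conflict? C D ⟧ * violates D (filter (¬? ∘ conflict? C) S) v) S
      weaken C S v with all? (satClause? (get v)) (filter (¬? ∘ conflict? C) S)
      ... | no _ = z≤n
      ... | yes sats with all? (satClause? (get v)) S
      ...   | yes _ = s≤s z≤n
      ...   | no ¬sats with D , D∈ , ¬sat ← find (All.¬All⇒Any¬ (satClause? (get v)) S ¬sats)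
            with conflict? C D | ∑-member (λ D → ⟦ conflict? C D ⟧ * (inside (falsifier D) v * 1)) D∈
      ...     | no ¬conf | _   = contradiction (All.lookup sats (∈-filter⁺ (¬? ∘ conflict? C) D∈ ¬conf)) ¬sat
      ...     | yes conf | bnd rewrite inside-unsat D v ¬sat = bnd

      -- Dropping the clauses that conflict with C leaves S₂, to which `correlation` applies with
      -- factor `p C`. A union bound over the dropped clauses, using the induction hypothesis for
      -- the shorter S₂, shows that S₂ is at most twice as likely as S. Hence C fails with
      -- probability at most twice `p C`, given S. The number `m` makes the recursion structural.
      violates≤ : ∀ m S → length S ≤ m → Sub S → ∀ {C} → C ∈ F → E n w (violates C S) * T ≤ 2 * p C * E n w (satisfies S)
      violates≤ m S S≤m sub {C} C∈F with any? (conflict? C) S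
      ... | no ¬any = ≤-trans (correlation C S (λ D∈ conf → ¬any (lose D∈ conf)))
                              (*-monoˡ-≤ (E n w (satisfies S)) (m≤m+n (p C) (p C + 0)))
      violates≤ zero    [] S≤m sub C∈F | yes ()
      violates≤ (suc m) S  S≤m sub {C} C∈F | yes any = begin
        E n w (violates C S) * T        ≤⟨ *-monoˡ-≤ T (E-mono n w λ v → *-monoʳ-≤ (inside (falsifier C) v)
                                            (⟦⟧-mono (all? _ S) (all? _ S₂) (λ sats → All.tabulate λ D∈ →
                                               All.lookup sats (proj₁ (∈-filter⁻ (¬? ∘ conflict? C) D∈))))) ⟩
        E n w (violates C S₂) * T       ≤⟨ correlation C S₂ (λ D∈ → proj₂ (∈-filter⁻ (¬? ∘ conflict? C) {xs = S} D∈)) ⟩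
        p C * E n w (satisfies S₂)      ≤⟨ *-monoʳ-≤ (p C) (halve T _ _ _ step (proj₂ sub C∈F)) ⟩
        p C * (2 * E n w (satisfies S)) ≡⟨ alg (p C) (E n w (satisfies S)) ⟩
        2 * p C * E n w (satisfies S)   ∎
        where
        open ≤-Reasoning
        S₂ = filter (¬? ∘ conflict? C) S
        e₂ = E n w (satisfies S₂)
        alg : ∀ a b → a * (2 * b) ≡ 2 * a * b
        alg = solve-∀
        alg₂ : ∀ c e T → c * e * T ≡ c * (e * T)
        alg₂ = solve-∀
        alg₃ : ∀ c p e → c * (2 * p * e) ≡ 2 * e * (c * p)
        alg₃ = solve-∀
        S₂≤m : length S₂ ≤ m
        S₂≤m = s≤s⁻¹ (≤-trans (filter-notAll (¬? ∘ conflict? C) S (Any.map (λ conf ¬conf → ¬conf conf) any)) S≤m)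
        step : T * e₂ ≤ T * E n w (satisfies S) + 2 * e₂ * ∑ (λ D → ⟦ conflict? C D ⟧ * p D) S
        step = begin
          T * e₂
            ≤⟨ *-monoʳ-≤ T (E-mono n w (weaken C S)) ⟩
          T * E n w (λ v → satisfies S v + ∑ (λ D → ⟦ conflict? C D ⟧ * violates D S₂ v) S)
            ≡⟨ cong (T *_) (trans (E-+ n w _ _) (cong (E n w (satisfies S) +_) (E-∑ n w _ S))) ⟩
          T * (E n w (satisfies S) + ∑ (λ D → E n w (λ v → ⟦ conflict? C D ⟧ * violates D S₂ v)) S)
            ≡⟨ trans (*-distribˡ-+ T _ _) (cong (T * E n w (satisfies S) +_) (sym (∑-*ˡ T _ S))) ⟩
          T * E n w (satisfies S) + ∑ (λ D → T * E n w (λ v → ⟦ conflict? C D ⟧ * violates D S₂ v)) S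
            ≤⟨ +-monoʳ-≤ (T * E n w (satisfies S)) (∑-mono S λ {D} D∈ → begin
                T * E n w (λ v → ⟦ conflict? C D ⟧ * violates D S₂ v)
                  ≡⟨ trans (*-comm T _) (cong (_* T) (E-*ˡ n w ⟦ conflict? C D ⟧ (violates D S₂))) ⟩
                ⟦ conflict? C D ⟧ * E n w (violates D S₂) * T
                  ≡⟨ alg₂ ⟦ conflict? C D ⟧ _ T ⟩
                ⟦ conflict? C D ⟧ * (E n w (violates D S₂) * T)
                  ≤⟨ *-monoʳ-≤ ⟦ conflict? C D ⟧
                       (violates≤ m S₂ S₂≤m (Sub-filter (¬? ∘ conflict? C) sub) (proj₁ sub D∈)) ⟩
                ⟦ conflict? C D ⟧ * (2 * p D * e₂)
                  ≡⟨ alg₃ ⟦ conflict? C D ⟧ (p D) e₂ ⟩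
                2 * e₂ * (⟦ conflict? C D ⟧ * p D) ∎) ⟩
          T * E n w (satisfies S) + ∑ (λ D → 2 * e₂ * (⟦ conflict? C D ⟧ * p D)) S
            ≡⟨ cong (T * E n w (satisfies S) +_) (∑-*ˡ (2 * e₂) _ S) ⟩
          T * E n w (satisfies S) + 2 * e₂ * ∑ (λ D → ⟦ conflict? C D ⟧ * p D) S ∎

      -- By `violates≤`, adding C to S multiplies the probability by at least 1 - 2 p C / T, which
      -- `p<` keeps positive.
      satisfies-positive : ∀ S → Sub S → 0 < E n w (satisfies S)
      satisfies-positive []      sub = Total-positive n w positive
      satisfies-positive (C ∷ S) sub@(S⊆F , small) with E n w (satisfies (C ∷ S)) in eq
      ... | suc _ = z<s
      ... | zero  = contradiction step (<⇒≱ (begin-strict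
        T * E n w (satisfies (C ∷ S)) + 2 * E n w (satisfies S) * p C
          ≡⟨ cong (λ z → T * z + 2 * E n w (satisfies S) * p C) eq ⟩
        T * 0 + 2 * E n w (satisfies S) * p C
          ≡⟨ alg₂ T (E n w (satisfies S)) (p C) ⟩
        2 * p C * E n w (satisfies S)
          <⟨ *-monoˡ-< (E n w (satisfies S)) {{>-nonZero (satisfies-positive S sub′)}} (p< (S⊆F (here refl))) ⟩
        T * E n w (satisfies S) ∎))
        where
        open ≤-Reasoning
        sub′ : Sub S
        sub′ = (λ D∈ → S⊆F (there D∈)) , λ {D} D∈F →
          ≤-trans (*-monoʳ-≤ 4 (m≤n+m (∑ (λ D′ → ⟦ conflict? D D′ ⟧ * p D′) S) (⟦ conflict? D C ⟧ * p C))) (small D∈F)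
        split : ∀ v → satisfies S v ≤ satisfies (C ∷ S) v + violates C S v
        split v with all? (satClause? (get v)) S
        ... | no _ = z≤n
        ... | yes sats with satClause? (get v) C
        ...   | no ¬sat rewrite inside-unsat C v ¬sat = s≤s z≤n
        ...   | yes sat = s≤s z≤n
        alg₂ : ∀ T e p → T * 0 + 2 * e * p ≡ 2 * p * e
        alg₂ = solve-∀
        alg : ∀ p e → 2 * p * e ≡ 2 * e * p
        alg = solve-∀
        step : T * E n w (satisfies S) ≤ T * E n w (satisfies (C ∷ S)) + 2 * E n w (satisfies S) * p C
        step = begin
          T * E n w (satisfies S)
            ≤⟨ *-monoʳ-≤ T (E-mono n w split) ⟩
          T * E n w (λ v → satisfies (C ∷ S) v + violates C S v)
            ≡⟨ trans (cong (T *_) (E-+ n w _ _)) (*-distribˡ-+ T (E n w (satisfies (C ∷ S))) (E n w (violates C S))) ⟩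
          T * E n w (satisfies (C ∷ S)) + T * E n w (violates C S)
            ≡⟨ cong (T * E n w (satisfies (C ∷ S)) +_) (*-comm T (E n w (violates C S))) ⟩
          T * E n w (satisfies (C ∷ S)) + E n w (violates C S) * T
            ≤⟨ +-monoʳ-≤ (T * E n w (satisfies (C ∷ S))) (violates≤ (length S) S ≤-refl sub′ (S⊆F (here refl))) ⟩
          T * E n w (satisfies (C ∷ S)) + 2 * p C * E n w (satisfies S)
            ≡⟨ cong (T * E n w (satisfies (C ∷ S)) +_) (alg (p C) (E n w (satisfies S))) ⟩
          T * E n w (satisfies (C ∷ S)) + 2 * E n w (satisfies S) * p C ∎

      local-lemma : Satisfiable F
      local-lemma with v , pos ← E-positive n w (satisfies F) (satisfies-positive F ((λ C∈ → C∈) , neighbours≤))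
        with all? (satClause? (get v)) F
      ... | yes sats = get v , sats
      ... | no _     = contradiction pos (<-irrefl refl)

  -- Degrees in the conflict graph

  degree : CNF → Clause → ℕ
  degree F C = ∑ (λ D → ⟦ conflict? C D ⟧) F

  occ : CNF → Literal → ℕ
  occ F l = ∑ (λ D → ⟦ _∈?_ _≟L_ l D ⟧) F

  neg-involutive : ∀ l → neg (neg l) ≡ l
  neg-involutive (x , b) = cong (x ,_) (not-involutive b)

  conflict-sym : ∀ {C D} → Conflict C D → Conflict D C
  conflict-sym {C} conf with l , l∈C , nl∈D ← find conf =
    conflict-∈ nl∈D (subst (_∈ C) (sym (neg-involutive l)) l∈C)

  IsClause⇒¬Conflict : ∀ {C} → IsClause C → ¬ Conflict C C
  IsClause⇒¬Conflict (_ , consistent) conf with l , l∈ , nl∈ ← find conf = All.lookup consistent l∈ nl∈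

  -- Each conflicting pair is counted from both ends; the diagonal contributes nothing because a
  -- clause does not conflict with itself.
  handshake : ∀ F → All IsClause F → ∑ (degree F) F ≡ 2 * e F
  handshake []      []        = refl
  handshake (C ∷ F) (cC ∷ cF) = begin
    ⟦ conflict? C C ⟧ + degree F C + ∑ (λ D → ⟦ conflict? D C ⟧ + degree F D) F
      ≡⟨ cong₂ (λ x y → x + degree F C + y) (⟦⟧-no (conflict? C C) (IsClause⇒¬Conflict cC)) (∑-+ _ (degree F) F) ⟩
    degree F C + (∑ (λ D → ⟦ conflict? D C ⟧) F + ∑ (degree F) F)
      ≡⟨ cong₂ (λ x y → degree F C + (x + y)) (∑-cong F λ D → symmetric D) (handshake F cF) ⟩
    degree F C + (degree F C + 2 * e F)
      ≡⟨ alg (degree F C) (e F) ⟩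
    2 * (degree F C + e F)
      ≡⟨ cong (λ x → 2 * (x + e F)) (length-filter≡∑ (conflict? C) F) ⟨
    2 * e (C ∷ F) ∎
    where
    open ≡-Reasoning
    alg : ∀ d x → d + (d + 2 * x) ≡ 2 * (d + x)
    alg = solve-∀
    symmetric : ∀ D → ⟦ conflict? D C ⟧ ≡ ⟦ conflict? C D ⟧
    symmetric D = ≤-antisym (⟦⟧-mono (conflict? D C) (conflict? C D) conflict-sym)
                            (⟦⟧-mono (conflict? C D) (conflict? D C) conflict-sym)

  occ≤degree : ∀ F {C l} → l ∈ C → occ F (neg l) ≤ degree F C
  occ≤degree F {C} {l} l∈C = ∑-mono F λ {D} _ → ⟦⟧-mono (_∈?_ _≟L_ (neg l) D) (conflict? C D) (conflict-∈ l∈C)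

  occ-positive : ∀ F {C l} → C ∈ F → l ∈ C → 1 ≤ occ F l
  occ-positive F {C} {l} C∈F l∈C =
    ≤-trans (≤-reflexive (sym (⟦⟧-yes (_∈?_ _≟L_ l C) l∈C))) (∑-member (λ D → ⟦ _∈?_ _≟L_ l D ⟧) C∈F)

  -- Summation by parts

  partialSum : (ℕ → ℕ) → ℕ → ℕ
  partialSum v zero    = 0
  partialSum v (suc t) = partialSum v t + v t

  -- `ε i` is the exponent that a literal of level i contributes to the bound b^-ε on the violation
  -- probability, and `v i` plays the role of Q / `ε i`.
  module Threshold {X : Set} (lev : X → ℕ) (ε v : ℕ → ℕ) (Q : ℕ)
                   (decreasing : ∀ i → v (suc i) ≤ v i) (large : ∀ i → Q ≤ ε i * v i) where

    low : ℕ → List X → List X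
    low t = filter (λ x → lev x <? t)

    V : ℕ → ℕ
    V = partialSum v

    module _ (xs : List X) where

      S : ℕ → ℕ
      S t = ∑ (λ x → ⟦ lev x <? t ⟧ * ε (lev x)) xs

      M : ℕ → ℕ
      M t = ∑ (λ x → ⟦ lev x <? t ⟧ * (ε (lev x) * v (lev x))) xs

      layer : ℕ → ℕ
      layer t = ∑ (λ x → ⟦ lev x ≟ t ⟧ * ε (lev x)) xs

      split : ∀ i t → ⟦ i <? suc t ⟧ ≡ ⟦ i <? t ⟧ + ⟦ i ≟ t ⟧
      split i t with i <? t | i ≟ t
      ... | yes i<t | yes refl = contradiction i<t (<-irrefl refl)
      ... | yes i<t | no _     = ⟦⟧-yes (i <? suc t) (m<n⇒m<1+n i<t)
      ... | no _    | yes refl = ⟦⟧-yes (i <? suc t) ≤-refl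
      ... | no i≮t  | no i≢t   = ⟦⟧-no (i <? suc t) (λ i<1+t → i≮t (≤∧≢⇒< (s≤s⁻¹ i<1+t) i≢t))

      S-suc : ∀ t → S (suc t) ≡ S t + layer t
      S-suc t = trans (∑-cong xs λ x → trans (cong (_* ε (lev x)) (split (lev x) t)) (*-distribʳ-+ _ ⟦ lev x <? t ⟧ _))
                      (∑-+ _ _ xs)

      M-suc : ∀ t → M (suc t) ≡ M t + v t * layer t
      M-suc t = begin
        M (suc t)
          ≡⟨ ∑-cong xs (λ x → trans (cong (_* (ε (lev x) * v (lev x))) (split (lev x) t))
                                    (*-distribʳ-+ (ε (lev x) * v (lev x)) ⟦ lev x <? t ⟧ ⟦ lev x ≟ t ⟧)) ⟩
        ∑ (λ x → ⟦ lev x <? t ⟧ * (ε (lev x) * v (lev x)) + ⟦ lev x ≟ t ⟧ * (ε (lev x) * v (lev x))) xs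
          ≡⟨ ∑-+ _ _ xs ⟩
        M t + ∑ (λ x → ⟦ lev x ≟ t ⟧ * (ε (lev x) * v (lev x))) xs
          ≡⟨ cong (M t +_) (∑-cong xs λ x → at-layer (lev x)) ⟩
        M t + ∑ (λ x → v t * (⟦ lev x ≟ t ⟧ * ε (lev x))) xs
          ≡⟨ cong (M t +_) (∑-*ˡ (v t) _ xs) ⟩
        M t + v t * layer t ∎
        where
        open ≡-Reasoning
        alg : ∀ a b → 1 * (a * b) ≡ b * (1 * a)
        alg = solve-∀
        at-layer : ∀ i → ⟦ i ≟ t ⟧ * (ε i * v i) ≡ v t * (⟦ i ≟ t ⟧ * ε i)
        at-layer i with i ≟ t
        ... | yes refl = alg (ε i) (v i)
        ... | no _     = sym (*-zeroʳ (v t))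

      S-zero : S 0 ≡ 0
      S-zero = trans (∑-cong xs λ x → refl) (trans (∑-const 0 xs) (*-zeroʳ (length xs)))

      module _ (k A : ℕ) (below : ∀ {t} → t < A → S (suc t) ≤ suc t * k) where

        -- When the weight falls from v to v′ = v - d, the left side loses d * B and the right side
        -- only d * s.
        shift : ∀ X Y s B v v′ → v′ ≤ v → s ≤ B → X + v * B ≤ Y + v * s → X + v′ * B ≤ Y + v′ * s
        shift X Y s B v v′ v′≤v s≤B le with d , refl ← m≤n⇒∃[o]m+o≡n v′≤v = +-cancelʳ-≤ (d * B) _ _ (begin
          X + v′ * B + d * B      ≡⟨ alg X v′ d B ⟩
          X + (v′ + d) * B        ≤⟨ le ⟩
          Y + (v′ + d) * s        ≡⟨ alg Y v′ d s ⟨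
          Y + v′ * s + d * s      ≤⟨ +-monoʳ-≤ (Y + v′ * s) (*-monoʳ-≤ d s≤B) ⟩
          Y + v′ * s + d * B      ∎)
          where
          open ≤-Reasoning
          alg : ∀ X v d B → X + v * B + d * B ≡ X + (v + d) * B
          alg = solve-∀

        -- Abel summation without subtraction. The invariant says that `M (suc t)` plus `v t` times
        -- the deficit `suc t * k` - `S (suc t)` is at most `k * V (suc t)`. The deficit is
        -- nonnegative by `below`, so lowering the weight preserves it.
        parts : ∀ t → t < A → M (suc t) + v t * (suc t * k) ≤ k * V (suc t) + v t * S (suc t)
        parts zero t<A rewrite S-suc 0 | M-suc 0 | S-zero = ≤-reflexive (alg (v 0) (layer 0) k)
          where
          alg : ∀ v x k → v * x + v * (k + 0) ≡ k * v + v * x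
          alg = solve-∀
        parts (suc t) t<A = begin
          M (2 + t) + v′ * (k + suc t * k)
            ≡⟨ cong (_+ v′ * (k + suc t * k)) (M-suc (suc t)) ⟩
          M (suc t) + v′ * x + v′ * (k + suc t * k)
            ≡⟨ alg₁ (M (suc t)) v′ x k (suc t * k) ⟩
          M (suc t) + v′ * (suc t * k) + v′ * (x + k)
            ≤⟨ +-monoˡ-≤ (v′ * (x + k)) (shift _ _ _ _ (v t) v′ (decreasing t) (below t<A′) (parts t t<A′)) ⟩
          k * V (suc t) + v′ * S (suc t) + v′ * (x + k)
            ≡⟨ alg₂ k (V (suc t)) v′ (S (suc t)) x ⟩
          k * (V (suc t) + v′) + v′ * (S (suc t) + x)
            ≡⟨ cong (λ s → k * (V (suc t) + v′) + v′ * s) (S-suc (suc t)) ⟨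
          k * V (2 + t) + v′ * S (2 + t) ∎
          where
          open ≤-Reasoning
          t<A′ = <-trans (n<1+n t) t<A
          v′ = v (suc t)
          x = layer (suc t)
          alg₁ : ∀ m v x k c → m + v * x + v * (k + c) ≡ m + v * c + v * (x + k)
          alg₁ = solve-∀
          alg₂ : ∀ k w v s x → k * w + v * s + v * (x + k) ≡ k * (w + v) + v * (s + x)
          alg₂ = solve-∀

    -- If every t failed, `parts` would bound the weighted exponent `M (suc a)` by `k * V (suc a)`.
    -- By `large` each of the k literals contributes at least Q to it, which contradicts
    -- `V (suc a) < Q`.
    threshold-exists : ∀ a → V (suc a) < Q → (xs : List X) → 1 ≤ length xs → (∀ x → lev x < suc a) →
                       ∃ λ t → t < suc a × suc t * length xs ≤ ∑ (ε ∘ lev) (low (suc t) xs)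
    threshold-exists a V<Q xs 0<k bounded
      with anyUpTo? (λ t → suc t * length xs ≤? ∑ (ε ∘ lev) (low (suc t) xs)) (suc a)
    ... | yes found = found
    ... | no ¬found = contradiction V<Q (≤⇒≯ bound)
      where
      k = length xs
      below : ∀ {t} → t < suc a → S xs (suc t) ≤ suc t * k
      below {t} t<A = ≤-trans (≤-reflexive (sym (∑-filter (λ x → lev x <? suc t) (ε ∘ lev) xs)))
                              (<⇒≤ (≰⇒> λ le → ¬found (t , t<A , le)))
      bound : Q ≤ V (suc a)
      bound = *-cancelˡ-≤ k {{>-nonZero 0<k}} (begin
        k * Q
          ≡⟨ ∑-const Q xs ⟨
        ∑ (const Q) xs
          ≤⟨ ∑-mono xs (λ {x} _ → ≤-trans (large (lev x)) (≤-reflexive (sym (trans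
               (cong (_* _) (⟦⟧-yes (lev x <? suc a) (bounded x))) (*-identityˡ _))))) ⟩
        M xs (suc a)
          ≤⟨ +-cancelʳ-≤ (v a * (suc a * k)) _ _ (≤-trans (parts xs k (suc a) below a ≤-refl)
               (+-monoʳ-≤ (k * V (suc a)) (*-monoʳ-≤ (v a) (below ≤-refl)))) ⟩
        k * V (suc a) ∎)
        where open ≤-Reasoning

  -- Violation probabilities, levels and biased variables

  DistinctVars : Clause → Set
  DistinctVars = AllPairs (λ l m → proj₁ l ≢ proj₁ m)

  sameVar : ∀ l m → proj₁ l ≡ proj₁ m → m ≡ l ⊎ m ≡ neg l
  sameVar (x , true)  (_ , true)  refl = inj₁ refl
  sameVar (x , true)  (_ , false) refl = inj₂ refl
  sameVar (x , false) (_ , true)  refl = inj₂ refl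
  sameVar (x , false) (_ , false) refl = inj₁ refl

  IsClause⇒DistinctVars : ∀ {C} → IsClause C → DistinctVars C
  IsClause⇒DistinctVars {[]}    _ = []
  IsClause⇒DistinctVars {l ∷ C} (l∉C ∷ unique , ¬nl ∷ consistent) =
    All.tabulate (λ {m} m∈ → distinct m∈) ∷
    IsClause⇒DistinctVars (unique , All.map (λ nm∉ nm∈ → nm∉ (there nm∈)) consistent)
    where
    distinct : ∀ {m} → m ∈ C → proj₁ l ≢ proj₁ m
    distinct {m} m∈ eq with sameVar l m eq
    ... | inj₁ refl = All.lookup l∉C m∈ refl
    ... | inj₂ refl = ¬nl (there m∈)

  -- A crude number above every variable of F, so that the measure lives on finitely many
  -- coordinates.
  varBound : CNF → ℕ
  varBound F = ∑ (∑ (suc ∘ proj₁)) F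

  varBound-< : ∀ {F C l} → C ∈ F → l ∈ C → proj₁ l < varBound F
  varBound-< C∈ l∈ = ≤-trans (∑-member (suc ∘ proj₁) l∈) (∑-member (∑ (suc ∘ proj₁)) C∈)

  module Powers (N P : ℕ) (0<N : 0 < N) (N<P : N < P) where

    instance
      N-nonZero : NonZero N
      N-nonZero = >-nonZero 0<N
      P-nonZero : NonZero P
      P-nonZero = >-nonZero (<-trans 0<N N<P)

    -- x ≤ (N/P)ᵃ y
    Below : ℕ → ℕ → ℕ → Set
    Below x a y = x * P ^ a ≤ y * N ^ a

    below-weaken : ∀ {x a b y} → a ≤ b → Below x b y → Below x a y
    below-weaken {x} {a} {b} {y} a≤b le with d , refl ← m≤n⇒∃[o]m+o≡n a≤b =
      *-cancelʳ-≤ _ _ (P ^ d) {{m^n≢0 P d}} (begin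
        x * P ^ a * P ^ d    ≡⟨ trans (*-assoc x _ _) (cong (x *_) (sym (^-distribˡ-+-* P a d))) ⟩
        x * P ^ (a + d)      ≤⟨ le ⟩
        y * N ^ (a + d)      ≡⟨ trans (cong (y *_) (^-distribˡ-+-* N a d)) (sym (*-assoc y _ _)) ⟩
        y * N ^ a * N ^ d    ≤⟨ *-monoʳ-≤ (y * N ^ a) (^-monoˡ-≤ d (<⇒≤ N<P)) ⟩
        y * N ^ a * P ^ d    ∎)
      where open ≤-Reasoning

    below-* : ∀ {x a y x′ a′ y′} → Below x a y → Below x′ a′ y′ → Below (x * x′) (a + a′) (y * y′)
    below-* {x} {a} {y} {x′} {a′} {y′} le le′ = begin
      x * x′ * P ^ (a + a′)        ≡⟨ cong (x * x′ *_) (^-distribˡ-+-* P a a′) ⟩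
      x * x′ * (P ^ a * P ^ a′)    ≡⟨ alg x x′ (P ^ a) (P ^ a′) ⟩
      x * P ^ a * (x′ * P ^ a′)    ≤⟨ *-mono-≤ le le′ ⟩
      y * N ^ a * (y′ * N ^ a′)    ≡⟨ alg y y′ (N ^ a) (N ^ a′) ⟨
      y * y′ * (N ^ a * N ^ a′)    ≡⟨ cong (y * y′ *_) (^-distribˡ-+-* N a a′) ⟨
      y * y′ * N ^ (a + a′)        ∎
      where
      open ≤-Reasoning
      alg : ∀ a b c d → a * b * (c * d) ≡ a * c * (b * d)
      alg = solve-∀

    module ClauseBound (n : ℕ) (w : Weight) (positive : ∀ x → 0 < w x true + w x false) where
      open LocalLemma n w positive

      false-weight mass : Literal → ℕ
      false-weight (x , b) = w x (not b)
      mass (x , _) = w x true + w x false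

      -- Literals on distinct variables are independent, so their bounds multiply and the exponents
      -- add up.
      p-below : ∀ (ε : Literal → ℕ) C → DistinctVars C → (∀ {l} → l ∈ C → proj₁ l < n) →
                (∀ {l} → l ∈ C → Below (false-weight l) (ε l) (mass l)) → Below (p C) (∑ ε C) T
      p-below ε [] _ _ _ = ≤-reflexive (cong (_* 1) (E-cong n w λ v → inside-agree (const nothing) v λ x ()))
      p-below ε ((x , b) ∷ C) (x∉C ∷ distinct) vars<n bound = *-cancelˡ-≤ z {{>-nonZero (positive x)}} (begin
        z * (p (l ∷ C) * P ^ (ε l + ∑ ε C))
          ≡⟨ alg z (p (l ∷ C)) _ ⟩
        p (l ∷ C) * z * P ^ (ε l + ∑ ε C)
          ≡⟨ cong (_* P ^ (ε l + ∑ ε C)) (E-inside-set n w x (not b) (falsifier C) (vars<n (here refl)) fresh) ⟩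
        w x (not b) * p C * P ^ (ε l + ∑ ε C)
          ≤⟨ below-* {w x (not b)} {ε l} {z} {p C} {∑ ε C} {T} (bound (here refl))
               (p-below ε C distinct (vars<n ∘ there) (bound ∘ there)) ⟩
        z * T * N ^ (ε l + ∑ ε C)
          ≡⟨ *-assoc z T _ ⟩
        z * (T * N ^ (ε l + ∑ ε C)) ∎)
        where
        open ≤-Reasoning
        l = (x , b)
        z = mass l
        alg : ∀ a b c → a * (b * c) ≡ b * a * c
        alg = solve-∀
        fresh : falsifier C x ≡ nothing
        fresh = falsifier-nothing C x (λ d xd∈ → All.lookup x∉C xd∈ refl)

    module Levels (k κ : ℕ) where

      -- With b = P/N this says b^(ik) ≤ κo. The factor κ is built into the levels so that the later
      -- union bound over the literals of a clause comes out exactly.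
      Reach : ℕ → ℕ → Set
      Reach o i = P ^ (i * k) ≤ κ * o * N ^ (i * k)

      -- The largest reached i up to the given cap. Level 0 is a default: it says that no positive
      -- level is reached, without claiming that 0 is.
      level′ : ℕ → ℕ → ℕ
      level′ o zero    = 0
      level′ o (suc m) with P ^ (suc m * k) ≤? κ * o * N ^ (suc m * k)
      ... | yes _ = suc m
      ... | no _  = level′ o m

      level′≤ : ∀ o m → level′ o m ≤ m
      level′≤ o zero    = z≤n
      level′≤ o (suc m) with P ^ (suc m * k) ≤? κ * o * N ^ (suc m * k)
      ... | yes _ = ≤-refl
      ... | no _  = m≤n⇒m≤1+n (level′≤ o m)

      level′-reach : ∀ o m → 0 < level′ o m → Reach o (level′ o m)
      level′-reach o (suc m) 0<l with P ^ (suc m * k) ≤? κ * o * N ^ (suc m * k)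
      ... | yes reach = reach
      ... | no _      = level′-reach o m 0<l

      level′-¬reach : ∀ o m → level′ o m < m → ¬ Reach o (suc (level′ o m))
      level′-¬reach o (suc m) l<m with P ^ (suc m * k) ≤? κ * o * N ^ (suc m * k)
      ... | yes _ = contradiction l<m (<-irrefl refl)
      ... | no ¬reach with m≤n⇒m<n∨m≡n (level′≤ o m)
      ...   | inj₁ l<m′ = level′-¬reach o m l<m′
      ...   | inj₂ eq   = subst (λ i → ¬ Reach o (suc i)) (sym eq) ¬reach

    module Biased (a R : ℕ) (R≤a : R ≤ a) (half : P ^ R ≤ 2 * N ^ R) (μ : ℕ → ℕ)
                  (μ-far : ∀ r → R < r → μ r ≤ R)
                  (μ-near : ∀ r → r ≤ R → P ^ r * P ^ μ r ≤ N ^ r * P ^ μ r + P ^ r * N ^ μ r) where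

      -- Levels i ≥ `h` are those with `A ∸ i` ≤ R, for which b^-(A ∸ i) is at least 1/2 by `half`;
      -- only they cause a bias.
      A h : ℕ
      A = suc a
      h = A ∸ R

      biased : ℕ → Bool → ℕ
      biased r true  = N ^ r
      biased r false = P ^ r ∸ N ^ r

      biased-sum : ∀ r → biased r true + biased r false ≡ P ^ r
      biased-sum r = m+[n∸m]≡n (^-monoˡ-≤ r (<⇒≤ N<P))

      -- The weights of a variable whose positive and negative literals have levels i and j.
      weights : ℕ → ℕ → Bool → ℕ
      weights i j with h ≤? i ⊔ j | j ≤? i
      ... | no _  | _     = const 1
      ... | yes _ | yes _ = biased (A ∸ i)
      ... | yes _ | no _  = biased (A ∸ j) ∘ not

      half-below : ∀ r → r ≤ R → Below 1 r 2
      half-below r r≤R = below-weaken {1} {y = 2} r≤R (subst (_≤ 2 * N ^ R) (sym (*-identityˡ _)) half)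

      below-half : ∀ {x y} r → r ≤ R → 2 * x ≤ y → Below x r y
      below-half {x} {y} r r≤R 2x≤y = begin
        x * P ^ r          ≤⟨ *-monoʳ-≤ x (subst (_≤ 2 * N ^ r) (*-identityˡ _) (half-below r r≤R)) ⟩
        x * (2 * N ^ r)    ≡⟨ alg x (N ^ r) ⟩
        2 * x * N ^ r      ≤⟨ *-monoˡ-≤ (N ^ r) 2x≤y ⟩
        y * N ^ r          ∎
        where
        open ≤-Reasoning
        alg : ∀ a b → a * (2 * b) ≡ 2 * a * b
        alg = solve-∀

      biased-minor : ∀ r → r ≤ R → 2 * biased r false ≤ P ^ r
      biased-minor r r≤R = +-cancelˡ-≤ (2 * N ^ r) _ _ (begin
        2 * N ^ r + 2 * biased r false      ≡⟨ *-distribˡ-+ 2 (N ^ r) _ ⟨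
        2 * (N ^ r + biased r false)        ≡⟨ cong (2 *_) (biased-sum r) ⟩
        2 * P ^ r                           ≡⟨ alg (P ^ r) ⟩
        P ^ r + P ^ r                       ≤⟨ +-monoˡ-≤ (P ^ r) (subst (_≤ 2 * N ^ r) (*-identityˡ _) (half-below r r≤R)) ⟩
        2 * N ^ r + P ^ r                   ∎)
        where
        open ≤-Reasoning
        alg : ∀ a → 2 * a ≡ a + a
        alg = solve-∀

      weights-sum : ∀ i j → 0 < weights i j true + weights i j false
      weights-sum i j with h ≤? i ⊔ j | j ≤? i
      ... | no _  | _     = z<s
      ... | yes _ | yes _ = subst (0 <_) (sym (biased-sum (A ∸ i))) (m^n>0 P (A ∸ i))
      ... | yes _ | no _  = subst (0 <_) (sym (trans (+-comm _ (biased (A ∸ j) true)) (biased-sum (A ∸ j)))) (m^n>0 P (A ∸ j))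

      co-level : ∀ {i} → h ≤ i → A ∸ i ≤ R
      co-level h≤i = ≤-trans (∸-monoʳ-≤ A h≤i) (≤-reflexive (m∸[m∸n]≡n (m≤n⇒m≤1+n R≤a)))

      major-below : ∀ {j t} → j ≤ t → Below (N ^ (A ∸ j)) (A ∸ t) (P ^ (A ∸ j))
      major-below {j} {t} j≤t =
        below-weaken {N ^ (A ∸ j)} {y = P ^ (A ∸ j)} (∸-monoʳ-≤ A j≤t) (≤-reflexive (*-comm (N ^ (A ∸ j)) (P ^ (A ∸ j))))

      -- An unbiased variable fails with probability 1/2, which is at most b^-(A ∸ t) because t ≥ h.
      -- A favoured literal fails at most half the time. A disfavoured one fails with probability
      -- exactly b^-(A ∸ j), and j ≤ t.
      high-true : ∀ i j t → h ≤ t → j ≤ t → Below (weights i j false) (A ∸ t) (weights i j true + weights i j false)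
      high-true i j t h≤t j≤t with h ≤? i ⊔ j | j ≤? i
      ... | no _     | _       = half-below (A ∸ t) (co-level h≤t)
      ... | yes h≤ij | yes j≤i rewrite biased-sum (A ∸ i) =
            below-half {biased (A ∸ i) false} (A ∸ t) (co-level h≤t) (biased-minor (A ∸ i) (co-level (subst (h ≤_) (m≥n⇒m⊔n≡m j≤i) h≤ij)))
      ... | yes h≤ij | no j≰i rewrite +-comm (biased (A ∸ j) false) (N ^ (A ∸ j)) | biased-sum (A ∸ j) = major-below j≤t

      high-false : ∀ i j t → h ≤ t → i ≤ t → Below (weights i j true) (A ∸ t) (weights i j true + weights i j false)
      high-false i j t h≤t i≤t with h ≤? i ⊔ j | j ≤? i
      ... | no _     | _       = half-below (A ∸ t) (co-level h≤t)
      ... | yes h≤ij | yes j≤i rewrite biased-sum (A ∸ i) = major-below i≤t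
      ... | yes h≤ij | no j≰i rewrite +-comm (biased (A ∸ j) false) (N ^ (A ∸ j)) | biased-sum (A ∸ j) =
            below-half {biased (A ∸ j) false} (A ∸ t) (co-level h≤t)
              (biased-minor (A ∸ j) (co-level (subst (h ≤_) (m≤n⇒m⊔n≡n (<⇒≤ (≰⇒> j≰i))) h≤ij)))

      minor-below : ∀ {i} → h ≤ i → Below (biased (A ∸ i) false) (μ (A ∸ i)) (P ^ (A ∸ i))
      minor-below {i} h≤i = +-cancelˡ-≤ (N ^ r * P ^ μ r) _ _ (begin
        N ^ r * P ^ μ r + biased r false * P ^ μ r   ≡⟨ *-distribʳ-+ (P ^ μ r) (N ^ r) _ ⟨
        (N ^ r + biased r false) * P ^ μ r           ≡⟨ cong (_* P ^ μ r) (biased-sum r) ⟩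
        P ^ r * P ^ μ r                              ≤⟨ μ-near r (co-level h≤i) ⟩
        N ^ r * P ^ μ r + P ^ r * N ^ μ r            ∎)
        where
        open ≤-Reasoning
        r = A ∸ i

      unbiased-below : ∀ {i} → i < h → Below 1 (μ (A ∸ i)) 2
      unbiased-below {i} i<h = half-below _ (μ-far (A ∸ i) (m+n≤o⇒m≤o∸n (suc R) (subst (_≤ A)
        (trans (+-suc R i) refl) (subst (R + suc i ≤_) (m+[n∸m]≡n (m≤n⇒m≤1+n R≤a)) (+-monoʳ-≤ R i<h)))))

      -- A negation of level below `h` is never favoured. Hence, with r = `A ∸ i`, the literal is
      -- either favoured and fails with probability 1 - b^-r, at most b^-(μ r) by `μ-near`, or
      -- unbiased with r > R, where `μ-far` and `half` suffice.
      low-true : ∀ i j → j < h → Below (weights i j false) (μ (A ∸ i)) (weights i j true + weights i j false)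
      low-true i j j<h with h ≤? i ⊔ j | j ≤? i
      ... | no h≰ij  | _       = unbiased-below (≤-trans (s≤s (m≤m⊔n i j)) (≰⇒> h≰ij))
      ... | yes h≤ij | yes j≤i rewrite biased-sum (A ∸ i) = minor-below (subst (h ≤_) (m≥n⇒m⊔n≡m j≤i) h≤ij)
      ... | yes h≤ij | no j≰i  = contradiction (subst (h ≤_) (m≤n⇒m⊔n≡n (<⇒≤ (≰⇒> j≰i))) h≤ij) (<⇒≱ j<h)

      low-false : ∀ i j → i < h → Below (weights i j true) (μ (A ∸ j)) (weights i j true + weights i j false)
      low-false i j i<h with h ≤? i ⊔ j | j ≤? i
      ... | no h≰ij  | _       = unbiased-below (≤-trans (s≤s (m≤n⊔m i j)) (≰⇒> h≰ij))
      ... | yes h≤ij | yes j≤i = contradiction (subst (h ≤_) (m≥n⇒m⊔n≡m j≤i) h≤ij) (<⇒≱ i<h)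
      ... | yes h≤ij | no j≰i rewrite +-comm (biased (A ∸ j) false) (N ^ (A ∸ j)) | biased-sum (A ∸ j) =
            minor-below (subst (h ≤_) (m≤n⇒m⊔n≡n (<⇒≤ (≰⇒> j≰i))) h≤ij)

  -- The lower bound

  argmax : ∀ {X : Set} (f : X → ℕ) {xs : List X} {y} → y ∈ xs → ∃ λ x → x ∈ xs × (∀ {z} → z ∈ xs → f z ≤ f x)
  argmax f {x ∷ []}     _ = x , here refl , λ { (here refl) → ≤-refl }
  argmax f {x ∷ y ∷ xs} _ with argmax f {y ∷ xs} (here refl)
  ... | m , m∈ , max with ≤-total (f m) (f x)
  ...   | inj₁ fm≤fx = x , here refl , λ { (here refl) → ≤-refl ; (there z∈) → ≤-trans (max z∈) fm≤fx }
  ...   | inj₂ fx≤fm = m , there m∈ , λ { (here refl) → fx≤fm ; (there z∈) → max z∈ }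

  -- The hypothesis `small` says 128 k e(F) < b^(Ak). Here 128 = 8 · 8 · 2: the clauses with a
  -- frequent negated literal get a share 1/8 of the probability, `κ` is 8k, and the degrees sum to
  -- 2 e(F).
  module FewConflicts
    (N P a R Q : ℕ) (μ ω : ℕ → ℕ)
    (0<N : 0 < N) (N<P : N < P) (R≤a : R ≤ a)
    (half : P ^ R ≤ 2 * N ^ R)
    (twice : 2 * N ^ suc a < P ^ suc a)
    (μ-far : ∀ r → R < r → μ r ≤ R)
    (μ-near : ∀ r → r ≤ R → P ^ r * P ^ μ r ≤ N ^ r * P ^ μ r + P ^ r * N ^ μ r)
    (ω-mono : ∀ r → ω r ≤ ω (suc r))
    (ω-large : ∀ r → Q ≤ μ r * ω r)
    (ω-sum : partialSum (λ i → ω (suc a ∸ i)) (suc a) < Q)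
    (k : ℕ) (1≤k : 1 ≤ k) (F : CNF) (kCNF : Is-k-CNF k F)
    (small : 128 * k * e F * N ^ (suc a * k) < P ^ (suc a * k)) where

    open Powers N P 0<N N<P
    open Biased a R R≤a half μ μ-far μ-near

    -- Each of the k literals of a clause may meet neighbours of total probability 1/(8k), together
    -- 1/8, which is half of the allowance 1/4.
    κ : ℕ
    κ = 8 * k

    open Levels k κ

    instance
      k-nonZero : NonZero k
      k-nonZero = >-nonZero 1≤k

    clauses : All IsClause F
    clauses = proj₁ (proj₁ kCNF)

    length≡k : ∀ {C} → C ∈ F → length C ≡ k
    length≡k = All.lookup (proj₂ kCNF)

    level : Literal → ℕ
    level l = level′ (occ F l) a

    level<A : ∀ l → level l < A
    level<A l = s≤s (level′≤ (occ F l) a)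

    wt : Weight
    wt x = weights (level (x , true)) (level (x , false))

    wt-positive : ∀ x → 0 < wt x true + wt x false
    wt-positive x = weights-sum (level (x , true)) (level (x , false))

    n : ℕ
    n = varBound F

    open LocalLemma n wt wt-positive
    open ClauseBound n wt wt-positive

    high-literal : ∀ l t → h ≤ t → level (neg l) ≤ t → Below (false-weight l) (A ∸ t) (mass l)
    high-literal (x , true)  = high-true (level (x , true)) (level (x , false))
    high-literal (x , false) = high-false (level (x , true)) (level (x , false))

    low-literal : ∀ l → level (neg l) < h → Below (false-weight l) (μ (A ∸ level l)) (mass l)
    low-literal (x , true)  = low-true (level (x , true)) (level (x , false))
    low-literal (x , false) = low-false (level (x , true)) (level (x , false))

    High : Clause → Set
    High = Any (λ l → h ≤ level (neg l))

    high? : ∀ C → Dec (High C)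
    high? = any? (λ l → h ≤? level (neg l))

    0<h : 0 < h
    0<h = m<n⇒0<n∸m (s≤s R≤a)

    -- Let t be the largest level of a negated literal of C. Every literal fails with probability at
    -- most b^-(A ∸ t), so C fails with probability at most b^(tk - Ak). As t ≥ h > 0, level t is
    -- really reached, so b^(tk) is at most κ times the occurrences of that negated literal, all of
    -- which conflict with C.
    high-bound : ∀ {C} → C ∈ F → High C → Below (p C) (A * k) (T * (κ * degree F C))
    high-bound {C} C∈F high with l₀ , l₀∈ , h≤l₀ ← find high with l , l∈ , max ← argmax (level ∘ neg) l₀∈ = begin
      p C * P ^ (A * k)
        ≡⟨ cong₂ (λ x i → x * P ^ i) (sym (*-identityʳ (p C))) (sym exponent) ⟩
      p C * 1 * P ^ (∑ (const (A ∸ t)) C + t * k)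
        ≤⟨ below-* {p C} {∑ (const (A ∸ t)) C} {T} {1} {t * k} {κ * occ F (neg l)}
             (p-below (const (A ∸ t)) C (IsClause⇒DistinctVars (All.lookup clauses C∈F)) (varBound-< C∈F)
               (λ {m} m∈ → high-literal m t h≤t (max m∈)))
             (subst (_≤ κ * occ F (neg l) * N ^ (t * k)) (sym (*-identityˡ _))
               (level′-reach (occ F (neg l)) a (≤-trans 0<h h≤t))) ⟩
      T * (κ * occ F (neg l)) * N ^ (∑ (const (A ∸ t)) C + t * k)
        ≡⟨ cong (λ i → T * (κ * occ F (neg l)) * N ^ i) exponent ⟩
      T * (κ * occ F (neg l)) * N ^ (A * k)
        ≤⟨ *-monoˡ-≤ (N ^ (A * k)) (*-monoʳ-≤ T (*-monoʳ-≤ κ (occ≤degree F l∈))) ⟩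
      T * (κ * degree F C) * N ^ (A * k) ∎
      where
      open ≤-Reasoning
      t = level (neg l)
      h≤t : h ≤ t
      h≤t = ≤-trans h≤l₀ (max l₀∈)
      exponent : ∑ (const (A ∸ t)) C + t * k ≡ A * k
      exponent = ≡.begin
        ∑ (const (A ∸ t)) C + t * k   ≡.≡⟨ cong (_+ t * k) (∑-const (A ∸ t) C) ⟩
        length C * (A ∸ t) + t * k    ≡.≡⟨ cong (λ i → i * (A ∸ t) + t * k) (length≡k C∈F) ⟩
        k * (A ∸ t) + t * k           ≡.≡⟨ cong (_+ t * k) (*-comm k (A ∸ t)) ⟩
        (A ∸ t) * k + t * k           ≡.≡⟨ *-distribʳ-+ k (A ∸ t) t ⟨
        (A ∸ t + t) * k               ≡.≡⟨ cong (_* k) (m∸n+n≡m (<⇒≤ (level<A (neg l)))) ⟩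
        A * k                         ≡.∎
        where module ≡ = ≡-Reasoning

    ε v : ℕ → ℕ
    ε i = μ (A ∸ i)
    v i = ω (A ∸ i)

    v-decreasing : ∀ i → v (suc i) ≤ v i
    v-decreasing i with i <? A
    ... | yes i<A = subst (λ r → ω (A ∸ suc i) ≤ ω r) (sym (+-∸-assoc 1 {A} {suc i} i<A)) (ω-mono (A ∸ suc i))
    ... | no  i≮A = ≤-reflexive (cong ω (trans (m≤n⇒m∸n≡0 (m≤n⇒m≤1+n (≮⇒≥ i≮A))) (sym (m≤n⇒m∸n≡0 (≮⇒≥ i≮A)))))

    open Threshold level ε v Q v-decreasing (λ i → ω-large (A ∸ i))

    threshold : ∀ C → 1 ≤ length C → ∃ λ t → t < A × suc t * length C ≤ ∑ (ε ∘ level) (low (suc t) C)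
    threshold C pos = threshold-exists a ω-sum C pos level<A

    -- A clause satisfying `High` stays whole, since `high-bound` needs all its k literals. The
    -- default for the empty clause makes the map total, so that it can be applied to all of F.
    trunc : Clause → Clause
    trunc C with high? C | 1 ≤? length C
    ... | no _ | yes pos = low (suc (proj₁ (threshold C pos))) C
    ... | _    | _       = C

    trunc-⊆ : ∀ C {l} → l ∈ trunc C → l ∈ C
    trunc-⊆ C l∈ with high? C | 1 ≤? length C
    ... | yes _ | _       = l∈
    ... | no _  | no _    = l∈
    ... | no _  | yes pos = proj₁ (∈-filter⁻ (λ x → level x <? suc (proj₁ (threshold C pos))) l∈)

    trunc-length : ∀ C → length (trunc C) ≤ length C
    trunc-length C with high? C | 1 ≤? length C
    ... | yes _ | _       = ≤-refl
    ... | no _  | no _    = ≤-refl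
    ... | no _  | yes pos = length-filter (λ x → level x <? suc (proj₁ (threshold C pos))) C

    trunc-high : ∀ C → High C → trunc C ≡ C
    trunc-high C high with high? C | 1 ≤? length C
    ... | yes _   | _     = refl
    ... | no ¬high | _    = contradiction high ¬high

    trunc-low : ∀ {C} → C ∈ F → ¬ High C →
                ∃ λ t → trunc C ≡ low (suc t) C × suc t * k ≤ ∑ (ε ∘ level) (low (suc t) C)
    trunc-low {C} C∈F ¬high with high? C | 1 ≤? length C
    ... | yes high | _     = contradiction high ¬high
    ... | no _ | no ¬pos   = contradiction (subst (1 ≤_) (sym (length≡k C∈F)) 1≤k) ¬pos
    ... | no _ | yes pos   = proj₁ (threshold C pos) , refl ,
      ≤-trans (≤-reflexive (cong (suc (proj₁ (threshold C pos)) *_) (sym (length≡k C∈F)))) (proj₂ (proj₂ (threshold C pos)))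

    record LowClause (C : Clause) : Set where
      field
        t       : ℕ
        bounded : ∀ {l} → l ∈ trunc C → level l ≤ t
        witness : ∃ λ l → l ∈ trunc C
        p-small : Below (p (trunc C)) (suc t * k) T

    low-clause : ∀ {C} → C ∈ F → ¬ High C → LowClause C
    low-clause {C} C∈F ¬high with t , eq , sum≥ ← trunc-low C∈F ¬high = record
      { t       = t
      ; bounded = λ l∈ → s≤s⁻¹ (proj₂ (∈-filter⁻ (λ x → level x <? suc t) {xs = C} (subst (_ ∈_) eq l∈)))
      ; witness = subst (λ D → ∃ λ l → l ∈ D) (sym eq) (nonempty (low (suc t) C) sum≥)
      ; p-small = subst (λ D → Below (p D) (suc t * k) T) (sym eq) (below-weaken {p (low (suc t) C)} {y = T} sum≥
          (p-below (ε ∘ level) (low (suc t) C)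
            (AllPairs.filter⁺ (λ x → level x <? suc t) (IsClause⇒DistinctVars (All.lookup clauses C∈F)))
            (λ l∈ → varBound-< C∈F (low-⊆ l∈))
            (λ {l} l∈ → low-literal l (≰⇒> λ h≤ → ¬high (lose (low-⊆ l∈) h≤)))))
      }
      where
      low-⊆ : ∀ {l} → l ∈ low (suc t) C → l ∈ C
      low-⊆ l∈ = proj₁ (∈-filter⁻ (λ x → level x <? suc t) l∈)
      nonempty : ∀ D → suc t * k ≤ ∑ (ε ∘ level) D → ∃ λ l → l ∈ D
      nonempty []      le = contradiction (≤-trans 1≤k (m≤m+n k (t * k))) (<⇒≱ (s≤s le))
      nonempty (l ∷ D) _  = l , here refl

    degree≤2e : ∀ {C} → C ∈ F → degree F C ≤ 2 * e F
    degree≤2e C∈F = ≤-trans (∑-member (degree F) C∈F) (≤-reflexive (handshake F clauses))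

    -- Below the cap the next level is not reached. At the cap a there is no next level to fail;
    -- instead a clause containing the negation conflicts with every clause containing l, and
    -- `small` bounds its degree.
    occ-bound : ∀ l → level l < a ⊎ (∃ λ C → C ∈ F × neg l ∈ C) →
                κ * occ F l * N ^ (suc (level l) * k) ≤ P ^ (suc (level l) * k)
    occ-bound l cond with level l <? a | cond
    ... | yes l<a | _ = <⇒≤ (≰⇒> (level′-¬reach (occ F l) a l<a))
    ... | no l≮a  | inj₁ l<a = contradiction l<a l≮a
    ... | no l≮a  | inj₂ (C , C∈F , nl∈C) = begin
      κ * occ F l * N ^ (suc (level l) * k)
        ≡⟨ cong (λ i → κ * occ F l * N ^ (suc i * k)) top ⟩
      κ * occ F l * N ^ (A * k)
        ≤⟨ *-monoˡ-≤ (N ^ (A * k)) (*-monoʳ-≤ κ (≤-trans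
             (subst (λ m → occ F m ≤ degree F C) (neg-involutive l) (occ≤degree F nl∈C)) (degree≤2e C∈F))) ⟩
      κ * (2 * e F) * N ^ (A * k)
        ≤⟨ *-monoˡ-≤ (N ^ (A * k)) (≤-trans (m≤n*m (κ * (2 * e F)) 8) (≤-reflexive (alg 8 2 k (e F)))) ⟩
      128 * k * e F * N ^ (A * k)
        ≤⟨ <⇒≤ small ⟩
      P ^ (A * k)
        ≡⟨ cong (λ i → P ^ (suc i * k)) top ⟨
      P ^ (suc (level l) * k) ∎
      where
      open ≤-Reasoning
      top : level l ≡ a
      top = ≤-antisym (level′≤ (occ F l) a) (≮⇒≥ l≮a)
      alg : ∀ x y k e → x * (x * k * (y * e)) ≡ x * x * y * k * e
      alg = solve-∀

    -- The truncated clause fails with probability at most b^-((t+1)k), and its literals have level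
    -- at most t, so `occ-bound` compensates exactly.
    low-bound : ∀ {C l} → C ∈ F → ¬ High C → l ∈ trunc C → level l < a ⊎ (∃ λ D → D ∈ F × neg l ∈ D) →
                κ * occ F l * p (trunc C) ≤ T
    low-bound {C} {l} C∈F ¬high l∈ cond = *-cancelʳ-≤ _ _ (P ^ s) {{m^n≢0 P s}} (begin
      κ * occ F l * p (trunc C) * P ^ s    ≡⟨ *-assoc (κ * occ F l) (p (trunc C)) (P ^ s) ⟩
      κ * occ F l * (p (trunc C) * P ^ s)
        ≤⟨ *-monoʳ-≤ (κ * occ F l) (below-weaken {p (trunc C)} {y = T} (*-monoˡ-≤ k (s≤s (bounded l∈))) p-small) ⟩
      κ * occ F l * (T * N ^ s)            ≡⟨ alg (κ * occ F l) T (N ^ s) ⟩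
      T * (κ * occ F l * N ^ s)            ≤⟨ *-monoʳ-≤ T (occ-bound l cond) ⟩
      T * P ^ s                            ∎)
      where
      open ≤-Reasoning
      open LowClause (low-clause C∈F ¬high)
      s = suc (level l) * k
      alg : ∀ x y z → x * (y * z) ≡ y * (x * z)
      alg = solve-∀

    T>0 : 0 < T
    T>0 = Total-positive n wt wt-positive

    -- Each summand is at most 8k deg(D) b^-(Ak) T by `high-bound`; summing the degrees gives 8 · 8k
    -- · 2 e(F) b^-(Ak) < 1.
    8∑high≤T : 8 * ∑ (λ D → ⟦ high? D ⟧ * p (trunc D)) F ≤ T
    8∑high≤T = *-cancelʳ-≤ _ _ (P ^ (A * k)) {{m^n≢0 P (A * k)}} (begin
      8 * ∑ (λ D → ⟦ high? D ⟧ * p (trunc D)) F * P ^ (A * k)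
        ≡⟨ alg₁ (∑ (λ D → ⟦ high? D ⟧ * p (trunc D)) F) (P ^ (A * k)) ⟩
      8 * (P ^ (A * k) * ∑ (λ D → ⟦ high? D ⟧ * p (trunc D)) F)
        ≡⟨ cong (8 *_) (∑-*ˡ (P ^ (A * k)) _ F) ⟨
      8 * ∑ (λ D → P ^ (A * k) * (⟦ high? D ⟧ * p (trunc D))) F
        ≤⟨ *-monoʳ-≤ 8 (∑-mono F bound) ⟩
      8 * ∑ (λ D → T * κ * N ^ (A * k) * degree F D) F
        ≡⟨ cong (8 *_) (trans (∑-*ˡ (T * κ * N ^ (A * k)) _ F) (cong (T * κ * N ^ (A * k) *_) (handshake F clauses))) ⟩
      8 * (T * κ * N ^ (A * k) * (2 * e F))
        ≡⟨ alg₂ 8 2 T k (N ^ (A * k)) (e F) ⟩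
      T * (128 * k * e F * N ^ (A * k))
        ≤⟨ *-monoʳ-≤ T (<⇒≤ small) ⟩
      T * P ^ (A * k) ∎)
      where
      open ≤-Reasoning
      alg₁ : ∀ x y → 8 * x * y ≡ 8 * (y * x)
      alg₁ = solve-∀
      alg₂ : ∀ x y t k n e → x * (t * (x * k) * n * (y * e)) ≡ t * (x * x * y * k * e * n)
      alg₂ = solve-∀
      alg₃ : ∀ x y z → x * (y * z) ≡ y * (z * x)
      alg₃ = solve-∀
      alg₄ : ∀ t κ d n → t * (κ * d) * n ≡ t * κ * n * d
      alg₄ = solve-∀
      bound : ∀ {D} → D ∈ F → P ^ (A * k) * (⟦ high? D ⟧ * p (trunc D)) ≤ T * κ * N ^ (A * k) * degree F D
      bound {D} D∈F = begin
        P ^ (A * k) * (⟦ high? D ⟧ * p (trunc D))   ≡⟨ alg₃ (P ^ (A * k)) ⟦ high? D ⟧ (p (trunc D)) ⟩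
        ⟦ high? D ⟧ * (p (trunc D) * P ^ (A * k))   ≤⟨ ⟦⟧*-≤ (high? D) (λ high →
            subst (λ C → Below (p C) (A * k) (T * (κ * degree F D))) (sym (trunc-high D high)) (high-bound D∈F high)) ⟩
        T * (κ * degree F D) * N ^ (A * k)          ≡⟨ alg₄ T κ (degree F D) (N ^ (A * k)) ⟩
        T * κ * N ^ (A * k) * degree F D            ∎

    lowTerm : Literal → Clause → ℕ
    lowTerm l D = ⟦ ¬? (high? D) ⟧ * (⟦ _∈?_ _≟L_ l (trunc D) ⟧ * p (trunc D))

    -- At most `occ F l` clauses contribute, each at most T / (κ · occ F l). The clause C containing
    -- the negation serves the case of top level in `low-bound`.
    κ∑low≤T : ∀ {C} → C ∈ F → ∀ {l} → neg l ∈ C → κ * ∑ (lowTerm l) F ≤ T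
    κ∑low≤T {C} C∈F {l} nl∈C with occ F l in eq
    ... | zero = ≤-trans (*-monoʳ-≤ κ (≤-trans (∑-mono F absent) (≤-reflexive (trans (∑-const 0 F) (*-zeroʳ (length F))))))
                         (≤-trans (≤-reflexive (*-zeroʳ κ)) z≤n)
      where
      absent : ∀ {D} → D ∈ F → lowTerm l D ≤ 0
      absent {D} D∈F = ⟦⟧*-≤ (¬? (high? D)) λ _ → ⟦⟧*-≤ (_∈?_ _≟L_ l (trunc D)) λ l∈ →
        contradiction (occ-positive F D∈F (trunc-⊆ D l∈)) (<⇒≱ (s≤s (≤-reflexive eq)))
    ... | suc o = *-cancelˡ-≤ (suc o) (begin
      suc o * (κ * ∑ (lowTerm l) F)
        ≡⟨ cong (_* (κ * ∑ (lowTerm l) F)) eq ⟨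
      occ F l * (κ * ∑ (lowTerm l) F)
        ≡⟨ alg₁ (occ F l) κ _ ⟩
      κ * occ F l * ∑ (lowTerm l) F
        ≡⟨ ∑-*ˡ (κ * occ F l) (lowTerm l) F ⟨
      ∑ (λ D → κ * occ F l * lowTerm l D) F
        ≤⟨ ∑-mono F bound ⟩
      ∑ (λ D → T * ⟦ _∈?_ _≟L_ l D ⟧) F
        ≡⟨ ∑-*ˡ T _ F ⟩
      T * occ F l
        ≡⟨ trans (*-comm T _) (cong (_* T) eq) ⟩
      suc o * T ∎)
      where
      open ≤-Reasoning
      alg₁ : ∀ o κ s → o * (κ * s) ≡ κ * o * s
      alg₁ = solve-∀
      alg₂ : ∀ o x y p → o * (x * (y * p)) ≡ x * (y * (o * p))
      alg₂ = solve-∀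
      bound : ∀ {D} → D ∈ F → κ * occ F l * lowTerm l D ≤ T * ⟦ _∈?_ _≟L_ l D ⟧
      bound {D} D∈F = begin
        κ * occ F l * lowTerm l D
          ≡⟨ alg₂ (κ * occ F l) ⟦ ¬? (high? D) ⟧ ⟦ _∈?_ _≟L_ l (trunc D) ⟧ (p (trunc D)) ⟩
        ⟦ ¬? (high? D) ⟧ * (⟦ _∈?_ _≟L_ l (trunc D) ⟧ * (κ * occ F l * p (trunc D)))
          ≤⟨ ⟦⟧*-≤ (¬? (high? D)) (λ ¬high → ⟦⟧*-≤ (_∈?_ _≟L_ l (trunc D)) λ l∈ → begin
               κ * occ F l * p (trunc D)     ≤⟨ low-bound D∈F ¬high l∈ (inj₂ (C , C∈F , nl∈C)) ⟩
               T                             ≡⟨ *-identityʳ T ⟨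
               T * 1                         ≡⟨ cong (T *_) (⟦⟧-yes (_∈?_ _≟L_ l D) (trunc-⊆ D l∈)) ⟨
               T * ⟦ _∈?_ _≟L_ l D ⟧         ∎) ⟩
        T * ⟦ _∈?_ _≟L_ l D ⟧ ∎

    8≤κ : 8 ≤ κ
    8≤κ = *-monoʳ-≤ 8 1≤k

    8x≤T⇒2x<T : ∀ x → 8 * x ≤ T → 2 * x < T
    8x≤T⇒2x<T zero    _  = T>0
    8x≤T⇒2x<T (suc x) le = <-≤-trans (*-monoˡ-< (suc x) {2} {8} (s≤s (s≤s (s≤s z≤n)))) le

    2p<T : ∀ {C} → C ∈ F → 2 * p (trunc C) < T
    2p<T {C} C∈F = by-height (high? C)
      where
      open ≤-Reasoning
      by-level : (¬high : ¬ High C) → ∀ {l} → l ∈ trunc C → Dec (level l < a) → 2 * p (trunc C) < T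
      by-level ¬high {l} l∈ (yes l<a) = 8x≤T⇒2x<T (p (trunc C)) (≤-trans
        (*-monoˡ-≤ (p (trunc C)) (*-mono-≤ 8≤κ (occ-positive F C∈F (trunc-⊆ C l∈))))
        (low-bound C∈F ¬high l∈ (inj₁ l<a)))
      -- The negation of a literal of top level may occur nowhere, and then conflicts do not bound
      -- its occurrences. But t ≥ a, so the probability is at most b^-A, which is below 1/2 by
      -- `twice`.
      by-level ¬high {l} l∈ (no l≮a) = *-cancelʳ-< _ _ _ (begin-strict
        2 * p (trunc C) * P ^ A      ≡⟨ *-assoc 2 (p (trunc C)) (P ^ A) ⟩
        2 * (p (trunc C) * P ^ A)    ≤⟨ *-monoʳ-≤ 2 (below-weaken {p (trunc C)} {y = T} A≤ p-small) ⟩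
        2 * (T * N ^ A)              ≡⟨ alg T (N ^ A) ⟩
        T * (2 * N ^ A)              <⟨ *-monoʳ-< T twice ⟩
        T * P ^ A                    ∎)
        where
        open LowClause (low-clause C∈F ¬high)
        A≤ : A ≤ suc t * k
        A≤ = ≤-trans (s≤s (≤-trans (≮⇒≥ l≮a) (bounded l∈))) (m≤m*n (suc t) k)
        alg : ∀ x y → 2 * (x * y) ≡ x * (2 * y)
        alg = solve-∀
      by-height : Dec (High C) → 2 * p (trunc C) < T
      by-height (yes high) = 8x≤T⇒2x<T (p (trunc C)) (≤-trans (*-monoʳ-≤ 8 (begin
        p (trunc C)                                    ≡⟨ *-identityˡ _ ⟨
        1 * p (trunc C)                                ≡⟨ cong (_* p (trunc C)) (⟦⟧-yes (high? C) high) ⟨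
        ⟦ high? C ⟧ * p (trunc C)                      ≤⟨ ∑-member (λ D → ⟦ high? D ⟧ * p (trunc D)) C∈F ⟩
        ∑ (λ D → ⟦ high? D ⟧ * p (trunc D)) F          ∎)) 8∑high≤T)
      by-height (no ¬high) with l , l∈ ← LowClause.witness (low-clause C∈F ¬high) = by-level ¬high l∈ (level l <? a)

    -- Neighbours satisfying `High` take at most 1/8 in total. Any other neighbour contains the
    -- negation of one of the at most k literals of `trunc C`, each accounting for at most 1/(8k).
    neighbours≤T : ∀ {C} → C ∈ F → 4 * ∑ (λ D → ⟦ conflict? (trunc C) (trunc D) ⟧ * p (trunc D)) F ≤ T
    neighbours≤T {C} C∈F = *-cancelˡ-≤ 2 (begin
      2 * (4 * ∑ (λ D → ⟦ conflict? (trunc C) (trunc D) ⟧ * p (trunc D)) F)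
        ≤⟨ *-monoʳ-≤ 2 (*-monoʳ-≤ 4 (∑-mono F λ {D} _ → bound D)) ⟩
      2 * (4 * ∑ (λ D → highTerm D + ∑ (λ l → lowTerm (neg l) D) (trunc C)) F)
        ≡⟨ cong (λ s → 2 * (4 * s)) (∑-+ highTerm _ F) ⟩
      2 * (4 * (∑ highTerm F + ∑ (λ D → ∑ (λ l → lowTerm (neg l) D) (trunc C)) F))
        ≡⟨ cong (λ s → 2 * (4 * (∑ highTerm F + s))) (∑-swap (λ D l → lowTerm (neg l) D) F (trunc C)) ⟩
      2 * (4 * (∑ highTerm F + lowSum))
        ≡⟨ alg₁ (∑ highTerm F) lowSum ⟩
      8 * ∑ highTerm F + 8 * lowSum
        ≤⟨ +-mono-≤ 8∑high≤T (*-cancelˡ-≤ k lowSum≤) ⟩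
      T + T
        ≡⟨ alg₂ T ⟩
      2 * T ∎)
      where
      open ≤-Reasoning
      highTerm : Clause → ℕ
      highTerm D = ⟦ high? D ⟧ * p (trunc D)
      lowSum : ℕ
      lowSum = ∑ (λ l → ∑ (lowTerm (neg l)) F) (trunc C)
      alg₁ : ∀ x y → 2 * (4 * (x + y)) ≡ 8 * x + 8 * y
      alg₁ = solve-∀
      alg₂ : ∀ x → x + x ≡ 2 * x
      alg₂ = solve-∀
      alg₃ : ∀ k x → k * (8 * x) ≡ 8 * k * x
      alg₃ = solve-∀
      lowSum≤ : k * (8 * lowSum) ≤ k * T
      lowSum≤ = begin
        k * (8 * lowSum)                                       ≡⟨ alg₃ k lowSum ⟩
        κ * lowSum                                             ≡⟨ ∑-*ˡ κ _ (trunc C) ⟨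
        ∑ (λ l → κ * ∑ (lowTerm (neg l)) F) (trunc C)          ≤⟨ ∑-mono (trunc C) (λ {l} l∈ → κ∑low≤T C∈F
                                                                    (subst (_∈ C) (sym (neg-involutive l)) (trunc-⊆ C l∈))) ⟩
        ∑ (const T) (trunc C)                                  ≡⟨ ∑-const T (trunc C) ⟩
        length (trunc C) * T                                   ≤⟨ *-monoˡ-≤ T (≤-trans (trunc-length C)
                                                                    (≤-reflexive (length≡k C∈F))) ⟩
        k * T                                                  ∎
      bound : ∀ D → ⟦ conflict? (trunc C) (trunc D) ⟧ * p (trunc D) ≤
                    highTerm D + ∑ (λ l → lowTerm (neg l) D) (trunc C)
      bound D = ⟦⟧*-≤ (conflict? (trunc C) (trunc D)) λ conf → by-height conf (high? D)
        where
        by-height : Conflict (trunc C) (trunc D) → Dec (High D) →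
                    p (trunc D) ≤ highTerm D + ∑ (λ l → lowTerm (neg l) D) (trunc C)
        by-height conf (yes high) = ≤-trans (≤-reflexive (sym (trans
          (cong (_* p (trunc D)) (⟦⟧-yes (high? D) high)) (*-identityˡ _)))) (m≤m+n (highTerm D) _)
        by-height conf (no ¬high) with l , l∈ , nl∈ ← find conf = begin
          p (trunc D)                                        ≡⟨ trans (*-identityˡ _) (*-identityˡ _) ⟨
          1 * (1 * p (trunc D))
            ≡⟨ cong₂ (λ x y → x * (y * p (trunc D))) (⟦⟧-yes (¬? (high? D)) ¬high) (⟦⟧-yes (_∈?_ _≟L_ (neg l) (trunc D)) nl∈) ⟨
          lowTerm (neg l) D                                  ≤⟨ ∑-member (λ l → lowTerm (neg l) D) l∈ ⟩
          ∑ (λ l → lowTerm (neg l) D) (trunc C)              ≤⟨ m≤n+m _ (highTerm D) ⟩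
          highTerm D + ∑ (λ l → lowTerm (neg l) D) (trunc C) ∎

    truncated-p< : ∀ {C} → C ∈ map trunc F → 2 * p C < T
    truncated-p< C∈ with C₀ , C₀∈F , refl ← ∈-map⁻ trunc C∈ = 2p<T C₀∈F

    truncated-neighbours : ∀ {C} → C ∈ map trunc F → 4 * ∑ (λ D → ⟦ conflict? C D ⟧ * p D) (map trunc F) ≤ T
    truncated-neighbours C∈ with C₀ , C₀∈F , refl ← ∈-map⁻ trunc C∈ =
      ≤-trans (≤-reflexive (cong (4 *_) (∑-map _ trunc F))) (neighbours≤T C₀∈F)

    satisfiable : Satisfiable F
    satisfiable with α , sats ← local-lemma (map trunc F) truncated-p< truncated-neighbours = α , All.tabulate λ {C} C∈F →
      let l , l∈ , eq = SatClause-witness (All.lookup sats (∈-map⁺ trunc C∈F)) in SatClause-∈ (trunc-⊆ C l∈) eq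

  -- b = P/N is the base of the levels 0, …, a, with b^(1+a) slightly above 2.69 and
  -- b^R slightly below 2.  An event of probability 1 − b⁻ʳ (or 1/2, when r > R) has
  -- probability at most b^(−μ r), and ω r = ⌈Q/μ r⌉ turns ∑ 1/μ r < 1 into ω-sum.
  record Parameters : Set where
    field
      N P a R Q M : ℕ
      μ ω         : ℕ → ℕ
      0<N         : 0 < N
      N<P         : N < P
      0<M         : 0 < M
      R≤a         : R ≤ a
      half        : P ^ R ≤ 2 * N ^ R
      twice       : 2 * N ^ suc a < P ^ suc a
      gain        : 269 * suc M * N ^ suc a ≤ 100 * M * P ^ suc a
      μ-far       : ∀ r → R < r → μ r ≤ R
      μ-near      : ∀ r → r ≤ R → P ^ r * P ^ μ r ≤ N ^ r * P ^ μ r + P ^ r * N ^ μ r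
      ω-mono      : ∀ r → ω r ≤ ω (suc r)
      ω-large     : ∀ r → Q ≤ μ r * ω r
      ω-sum       : partialSum (λ i → ω (suc a ∸ i)) (suc a) < Q

  ^-distrib-*³ : ∀ x y z n → (x * y * z) ^ n ≡ x ^ n * y ^ n * z ^ n
  ^-distrib-*³ x y z n = trans (^-distrib-* (x * y) z n) (cong (_* z ^ n) (^-distrib-* x y n))

  -- If `small` held, F would be satisfiable, so b^(Ak) ≤ 128 k e(F). By Bernoulli k ≤ M (1 +
  -- 1/M)^k, and `gain` makes b^A exceed 2.69 by the factor 1 + 1/M that this costs.
  many-conflicts : Parameters → ∃ λ K → 0 < K ×
    (∀ k → 1 ≤ k → ∀ F → Is-k-CNF k F → Unsatisfiable F → 269 ^ k ≤ K * e F * 100 ^ k)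
  many-conflicts prm = 128 * M , *-mono-< {0} {128} z<s 0<M , bound
    where
    open Parameters prm
    open ≤-Reasoning
    A = suc a
    alg₁ : ∀ c x m n b → x * m * (c * b * n) ≡ n * (x * (c * b) * m)
    alg₁ = solve-∀
    alg₂ : ∀ c k e h m → h * (c * (k * e)) * m ≡ c * e * h * (k * m)
    alg₂ = solve-∀
    alg₃ : ∀ c M e h s → c * e * h * (M * s) ≡ s * (c * M * e * h)
    alg₃ = solve-∀
    alg₄ : ∀ c k e n → c * k * e * n ≡ c * (k * e) * n
    alg₄ = solve-∀
    alg₅ : ∀ x s n → n * (s * x) ≡ x * s * n
    alg₅ = solve-∀
    bound : ∀ k → 1 ≤ k → ∀ F → Is-k-CNF k F → Unsatisfiable F → 269 ^ k ≤ 128 * M * e F * 100 ^ k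
    bound k 1≤k F kCNF unsat = *-cancelˡ-≤ (suc M ^ k) {{m^n≢0 (suc M) k}} (≤-trans
        (*-cancelˡ-≤ (N ^ (A * k)) {{m^n≢0 N (A * k) {{>-nonZero 0<N}}}} (begin
      N ^ (A * k) * (suc M ^ k * 269 ^ k)                ≡⟨ alg₅ (269 ^ k) (suc M ^ k) (N ^ (A * k)) ⟩
      269 ^ k * suc M ^ k * N ^ (A * k)                  ≡⟨ cong (269 ^ k * suc M ^ k *_) (^-*-assoc N A k) ⟨
      269 ^ k * suc M ^ k * (N ^ A) ^ k                  ≡⟨ ^-distrib-*³ 269 (suc M) (N ^ A) k ⟨
      (269 * suc M * N ^ A) ^ k                          ≤⟨ ^-monoˡ-≤ k gain ⟩
      (100 * M * P ^ A) ^ k                              ≡⟨ ^-distrib-*³ 100 M (P ^ A) k ⟩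
      100 ^ k * M ^ k * (P ^ A) ^ k                      ≡⟨ cong (100 ^ k * M ^ k *_) (^-*-assoc P A k) ⟩
      100 ^ k * M ^ k * P ^ (A * k)                      ≤⟨ *-monoʳ-≤ (100 ^ k * M ^ k) conflicts ⟩
      100 ^ k * M ^ k * (128 * k * e F * N ^ (A * k))    ≡⟨ cong (100 ^ k * M ^ k *_) (alg₄ 128 k (e F) (N ^ (A * k))) ⟩
      100 ^ k * M ^ k * (128 * (k * e F) * N ^ (A * k))  ≡⟨ alg₁ 128 (100 ^ k) (M ^ k) (N ^ (A * k)) (k * e F) ⟩
      N ^ (A * k) * (100 ^ k * (128 * (k * e F)) * M ^ k) ∎)) (begin
      100 ^ k * (128 * (k * e F)) * M ^ k                ≡⟨ alg₂ 128 k (e F) (100 ^ k) (M ^ k) ⟩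
      128 * e F * 100 ^ k * (k * M ^ k)                  ≤⟨ *-monoʳ-≤ (128 * e F * 100 ^ k) (≤-trans
                                                              (*-monoˡ-≤ (M ^ k) (≤-trans (≤-reflexive (sym (*-identityʳ k))) (m≤n+m (k * 1) M)))
                                                              (bernoulli M 1 k)) ⟩
      128 * e F * 100 ^ k * (M * (M + 1) ^ k)            ≡⟨ cong (λ s → 128 * e F * 100 ^ k * (M * s ^ k)) (+-comm M 1) ⟩
      128 * e F * 100 ^ k * (M * suc M ^ k)              ≡⟨ alg₃ 128 M (e F) (100 ^ k) (suc M ^ k) ⟩
      suc M ^ k * (128 * M * e F * 100 ^ k)              ∎))
      where
      conflicts : P ^ (A * k) ≤ 128 * k * e F * N ^ (A * k)
      conflicts = ≮⇒≥ λ small → unsat (FewConflicts.satisfiable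
        N P a R Q μ ω 0<N N<P R≤a half twice μ-far μ-near ω-mono ω-large ω-sum k 1≤k F kCNF small)

  -- Numerical data

  -- The default d continues the finite table; with d = R this is what `μ-far` asks for.
  entry : ℕ → List ℕ → ℕ → ℕ
  entry d []       _       = d
  entry d (m ∷ ms) zero    = m
  entry d (m ∷ ms) (suc r) = entry d ms r

  entry-beyond : ∀ d ms r → length ms ≤ r → entry d ms r ≡ d
  entry-beyond d []       r       _        = refl
  entry-beyond d (m ∷ ms) (suc r) (s≤s le) = entry-beyond d ms r le

  iterate : (ℕ → ℕ) → ℕ → ℕ → ℕ
  iterate f x zero    = x
  iterate f x (suc i) = f (iterate f x i)

  split-∧ : ∀ x {y} → True (x ∧ y) → True x × True y
  split-∧ x = Equivalence.to (T-∧ {x})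

  module FixedPoint (N P S d : ℕ) .{{_ : NonZero N}} .{{_ : NonZero P}} .{{_ : NonZero S}} (0<d : 0 < d) where

    -- y / S is a lower bound of (N / P)ⁱ.
    Lower : ℕ → ℕ → Set
    Lower i y = y * P ^ i ≤ S * N ^ i

    -- Multiplication by N/P, and in `ascend` by the j-th power of P/N, always rounded down, so that
    -- lower bounds stay lower bounds. This avoids evaluating large powers for every entry.
    descend : ℕ → ℕ
    descend y = N * y / P

    ascend : ℕ → ℕ → ℕ
    ascend zero    x = x
    ascend (suc j) x = ascend j (P * x / N)

    descend-lower : ∀ i y → Lower i y → Lower (suc i) (descend y)
    descend-lower i y low = begin
      N * y / P * (P * P ^ i)    ≡⟨ *-assoc (N * y / P) P (P ^ i) ⟨
      N * y / P * P * P ^ i      ≤⟨ *-monoˡ-≤ (P ^ i) (m/n*n≤m (N * y) P) ⟩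
      N * y * P ^ i              ≡⟨ *-assoc N y (P ^ i) ⟩
      N * (y * P ^ i)            ≤⟨ *-monoʳ-≤ N low ⟩
      N * (S * N ^ i)            ≡⟨ alg N S (N ^ i) ⟩
      S * (N * N ^ i)            ∎
      where
      open ≤-Reasoning
      alg : ∀ x y z → x * (y * z) ≡ y * (x * z)
      alg = solve-∀

    ascend-lower : ∀ j i x → Lower (j + i) x → Lower i (ascend j x)
    ascend-lower zero    i x low = low
    ascend-lower (suc j) i x low = ascend-lower j i (P * x / N) (*-cancelˡ-≤ N (begin
      N * (P * x / N * P ^ (j + i))    ≡⟨ alg₁ N (P * x / N) (P ^ (j + i)) ⟩
      P * x / N * N * P ^ (j + i)      ≤⟨ *-monoˡ-≤ (P ^ (j + i)) (m/n*n≤m (P * x) N) ⟩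
      P * x * P ^ (j + i)              ≡⟨ alg₂ P x (P ^ (j + i)) ⟩
      x * (P * P ^ (j + i))            ≤⟨ low ⟩
      S * (N * N ^ (j + i))            ≡⟨ alg₃ S N (N ^ (j + i)) ⟩
      N * (S * N ^ (j + i))            ∎))
      where
      open ≤-Reasoning
      alg₁ : ∀ x y z → x * (y * z) ≡ y * x * z
      alg₁ = solve-∀
      alg₂ : ∀ x y z → x * y * z ≡ y * (x * z)
      alg₂ = solve-∀
      alg₃ : ∀ x y z → x * (y * z) ≡ y * (x * z)
      alg₃ = solve-∀

    Near : ℕ → ℕ → Set
    Near r m = P ^ r * P ^ m ≤ N ^ r * P ^ m + P ^ r * N ^ m

    -- `Near r m` means 1 ≤ b^-r + b^-m, so it suffices that lower bounds of the two terms add up to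
    -- the scale.
    lower⇒near : ∀ r m {y x} → Lower r y → Lower m x → S ≤ y + x → Near r m
    lower⇒near r m {y} {x} low-r low-m S≤ = *-cancelˡ-≤ S (begin
      S * (P ^ r * P ^ m)                           ≤⟨ *-monoˡ-≤ (P ^ r * P ^ m) S≤ ⟩
      (y + x) * (P ^ r * P ^ m)                     ≡⟨ alg₁ y x (P ^ r) (P ^ m) ⟩
      y * P ^ r * P ^ m + x * P ^ m * P ^ r         ≤⟨ +-mono-≤ (*-monoˡ-≤ (P ^ m) low-r) (*-monoˡ-≤ (P ^ r) low-m) ⟩
      S * N ^ r * P ^ m + S * N ^ m * P ^ r         ≡⟨ alg₂ S (N ^ r) (P ^ m) (N ^ m) (P ^ r) ⟩
      S * (N ^ r * P ^ m + P ^ r * N ^ m)           ∎)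
      where
      open ≤-Reasoning
      alg₁ : ∀ x y p q → (x + y) * (p * q) ≡ x * p * q + y * q * p
      alg₁ = solve-∀
      alg₂ : ∀ s n p q m → s * n * p + s * q * m ≡ s * (n * p + m * q)
      alg₂ = solve-∀

    -- y and x are lower bounds of (N / P)ʳ, where r is the index of the first entry of the
    -- list, and of (N / P)ᵐ, where m is the entry preceding it.  Carrying them along makes
    -- the check linear in the size of the entries.
    valid  : (y m x : ℕ) → List ℕ → Bool
    valid′ : (y m x : ℕ) → List ℕ → Bool
    valid y m x []        = d ≤ᵇ m
    valid y m x (m′ ∷ ms) = (m′ ≤ᵇ m) ∧ valid′ y m′ (ascend (m ∸ m′) x) ms
    valid′ y m x ms = (S ≤ᵇ y + x) ∧ valid (descend y) m x ms

    valid-∷ : ∀ r y m x m′ ms → Lower r y → Lower m x → True (valid y m x (m′ ∷ ms)) →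
              m′ ≤ m × Near r m′ × Lower (suc r) (descend y) × Lower m′ (ascend (m ∸ m′) x) ×
              True (valid (descend y) m′ (ascend (m ∸ m′) x) ms)
    valid-∷ r y m x m′ ms low-y low-x ok =
      let ok₁ , rest₁ = split-∧ (m′ ≤ᵇ m) ok
          ok₂ , rest₂ = split-∧ (S ≤ᵇ y + ascend (m ∸ m′) x) rest₁
          m′≤m        = ≤ᵇ⇒≤ m′ m ok₁
          low-x′      = ascend-lower (m ∸ m′) m′ x (subst (λ i → Lower i x) (sym (m∸n+n≡m m′≤m)) low-x)
      in m′≤m , lower⇒near r m′ {y} {ascend (m ∸ m′) x} low-y low-x′ (≤ᵇ⇒≤ S (y + ascend (m ∸ m′) x) ok₂) , descend-lower r y low-y , low-x′ , rest₂

    entry-near : ∀ r₀ y m x ms → Lower r₀ y → Lower m x → True (valid y m x ms) →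
                 ∀ r → r < length ms → Near (r + r₀) (entry d ms r)
    entry-near r₀ y m x (m′ ∷ ms) low-y low-x ok r r< with valid-∷ r₀ y m x m′ ms low-y low-x ok | r | r<
    ... | _ , nr , _ | zero | _ = nr
    ... | _ , _ , low-y′ , low-x′ , rest | suc r′ | s≤s r′< =
      subst (λ i → Near i (entry d ms r′)) (+-suc r′ r₀) (entry-near (suc r₀) _ m′ _ ms low-y′ low-x′ rest r′ r′<)

    valid-tail : ∀ y m x m′ ms → True (valid y m x (m′ ∷ ms)) →
                 m′ ≤ m × True (valid (descend y) m′ (ascend (m ∸ m′) x) ms)
    valid-tail y m x m′ ms ok =
      let ok₁ , rest₁ = split-∧ (m′ ≤ᵇ m) ok
      in ≤ᵇ⇒≤ m′ m ok₁ , proj₂ (split-∧ (S ≤ᵇ y + ascend (m ∸ m′) x) rest₁)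

    entry-≤ : ∀ y m x ms → True (valid y m x ms) → entry d ms 0 ≤ m
    entry-≤ y m x []        ok = ≤ᵇ⇒≤ d m ok
    entry-≤ y m x (m′ ∷ ms) ok = proj₁ (valid-tail y m x m′ ms ok)

    entry-antitone : ∀ y m x ms → True (valid y m x ms) → ∀ r → entry d ms (suc r) ≤ entry d ms r
    entry-antitone y m x []        ok r       = ≤-refl
    entry-antitone y m x (m′ ∷ ms) ok zero    = entry-≤ _ m′ _ ms (proj₂ (valid-tail y m x m′ ms ok))
    entry-antitone y m x (m′ ∷ ms) ok (suc r) = entry-antitone _ m′ _ ms (proj₂ (valid-tail y m x m′ ms ok)) r

    entry-positive : ∀ y m x ms → True (valid y m x ms) → ∀ r → 0 < entry d ms r
    entry-positive y m x ms ok r = ≤-trans 0<d (≤-trans (≤-reflexive (sym (entry-beyond d ms (r + length ms) (m≤n+m _ r))))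
      (down (length ms)))
      where
      down : ∀ j → entry d ms (r + j) ≤ entry d ms r
      down zero    = ≤-reflexive (cong (entry d ms) (+-identityʳ r))
      down (suc j) = ≤-trans (≤-reflexive (cong (entry d ms) (+-suc r j)))
                             (≤-trans (entry-antitone y m x ms ok (r + j)) (down j))

    iterate-lower : ∀ i → Lower i (iterate descend S i)
    iterate-lower zero    = ≤-refl
    iterate-lower (suc i) = descend-lower i (iterate descend S i) (iterate-lower i)

  -- Floor plus one as an upper bound for Q/m; `suc (pred m)` is m for positive m. The rounding adds
  -- at most 1185 to the final sum, negligible against Q = 10^9.
  weight : ℕ → ℕ → ℕ
  weight Q m = suc (Q / suc (pred m))

  weight-large : ∀ Q m → 0 < m → Q ≤ m * weight Q m
  weight-large Q (suc m) _ = begin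
    Q                               ≡⟨ m≡m%n+[m/n]*n Q (suc m) ⟩
    Q % suc m + Q / suc m * suc m   ≤⟨ +-monoˡ-≤ (Q / suc m * suc m) (<⇒≤ (m%n<n Q (suc m))) ⟩
    suc m + Q / suc m * suc m       ≡⟨ *-comm (suc (Q / suc m)) (suc m) ⟩
    suc m * suc (Q / suc m)         ∎
    where open ≤-Reasoning

  weight-antitone : ∀ Q {m m′} → m ≤ m′ → weight Q m′ ≤ weight Q m
  weight-antitone Q m≤m′ = s≤s (/-monoʳ-≤ Q (s≤s (pred-mono-≤ m≤m′)))

  -- Entry r is the largest m with 1 − (1197/1198)ʳ ≤ (1197/1198)ᵐ (entry 0, where every
  -- m would do, repeats entry 1).
  table : List ℕ
  table =
    8488 ∷
    8488 ∷ 7658 ∷ 7173 ∷ 6829 ∷ 6563 ∷ 6345 ∷ 6161 ∷ 6001 ∷ 5861 ∷ 5735 ∷ 5621 ∷ 5518 ∷ 5422 ∷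
    5334 ∷ 5252 ∷ 5175 ∷ 5103 ∷ 5035 ∷ 4971 ∷ 4910 ∷ 4852 ∷ 4797 ∷ 4744 ∷ 4694 ∷ 4645 ∷ 4599 ∷
    4554 ∷ 4511 ∷ 4470 ∷ 4429 ∷ 4391 ∷ 4353 ∷ 4317 ∷ 4282 ∷ 4247 ∷ 4214 ∷ 4182 ∷ 4150 ∷ 4120 ∷
    4090 ∷ 4061 ∷ 4032 ∷ 4005 ∷ 3978 ∷ 3951 ∷ 3925 ∷ 3900 ∷ 3876 ∷ 3851 ∷ 3828 ∷ 3804 ∷ 3782 ∷
    3759 ∷ 3737 ∷ 3716 ∷ 3695 ∷ 3674 ∷ 3654 ∷ 3634 ∷ 3614 ∷ 3595 ∷ 3576 ∷ 3557 ∷ 3539 ∷ 3521 ∷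
    3503 ∷ 3486 ∷ 3468 ∷ 3451 ∷ 3435 ∷ 3418 ∷ 3402 ∷ 3386 ∷ 3370 ∷ 3354 ∷ 3339 ∷ 3324 ∷ 3309 ∷
    3294 ∷ 3280 ∷ 3265 ∷ 3251 ∷ 3237 ∷ 3223 ∷ 3210 ∷ 3196 ∷ 3183 ∷ 3169 ∷ 3156 ∷ 3144 ∷ 3131 ∷
    3118 ∷ 3106 ∷ 3093 ∷ 3081 ∷ 3069 ∷ 3057 ∷ 3046 ∷ 3034 ∷ 3022 ∷ 3011 ∷ 3000 ∷ 2988 ∷ 2977 ∷
    2966 ∷ 2956 ∷ 2945 ∷ 2934 ∷ 2924 ∷ 2913 ∷ 2903 ∷ 2893 ∷ 2882 ∷ 2872 ∷ 2862 ∷ 2852 ∷ 2843 ∷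
    2833 ∷ 2823 ∷ 2814 ∷ 2804 ∷ 2795 ∷ 2786 ∷ 2777 ∷ 2767 ∷ 2758 ∷ 2749 ∷ 2740 ∷ 2732 ∷ 2723 ∷
    2714 ∷ 2706 ∷ 2697 ∷ 2689 ∷ 2680 ∷ 2672 ∷ 2664 ∷ 2655 ∷ 2647 ∷ 2639 ∷ 2631 ∷ 2623 ∷ 2615 ∷
    2607 ∷ 2599 ∷ 2592 ∷ 2584 ∷ 2576 ∷ 2569 ∷ 2561 ∷ 2554 ∷ 2546 ∷ 2539 ∷ 2532 ∷ 2525 ∷ 2517 ∷
    2510 ∷ 2503 ∷ 2496 ∷ 2489 ∷ 2482 ∷ 2475 ∷ 2468 ∷ 2461 ∷ 2455 ∷ 2448 ∷ 2441 ∷ 2434 ∷ 2428 ∷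
    2421 ∷ 2415 ∷ 2408 ∷ 2402 ∷ 2395 ∷ 2389 ∷ 2383 ∷ 2376 ∷ 2370 ∷ 2364 ∷ 2358 ∷ 2352 ∷ 2345 ∷
    2339 ∷ 2333 ∷ 2327 ∷ 2321 ∷ 2315 ∷ 2310 ∷ 2304 ∷ 2298 ∷ 2292 ∷ 2286 ∷ 2281 ∷ 2275 ∷ 2269 ∷
    2263 ∷ 2258 ∷ 2252 ∷ 2247 ∷ 2241 ∷ 2236 ∷ 2230 ∷ 2225 ∷ 2219 ∷ 2214 ∷ 2209 ∷ 2203 ∷ 2198 ∷
    2193 ∷ 2188 ∷ 2182 ∷ 2177 ∷ 2172 ∷ 2167 ∷ 2162 ∷ 2157 ∷ 2152 ∷ 2147 ∷ 2142 ∷ 2137 ∷ 2132 ∷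
    2127 ∷ 2122 ∷ 2117 ∷ 2112 ∷ 2108 ∷ 2103 ∷ 2098 ∷ 2093 ∷ 2088 ∷ 2084 ∷ 2079 ∷ 2074 ∷ 2070 ∷
    2065 ∷ 2060 ∷ 2056 ∷ 2051 ∷ 2047 ∷ 2042 ∷ 2038 ∷ 2033 ∷ 2029 ∷ 2024 ∷ 2020 ∷ 2016 ∷ 2011 ∷
    2007 ∷ 2003 ∷ 1998 ∷ 1994 ∷ 1990 ∷ 1985 ∷ 1981 ∷ 1977 ∷ 1973 ∷ 1969 ∷ 1964 ∷ 1960 ∷ 1956 ∷
    1952 ∷ 1948 ∷ 1944 ∷ 1940 ∷ 1936 ∷ 1932 ∷ 1928 ∷ 1924 ∷ 1920 ∷ 1916 ∷ 1912 ∷ 1908 ∷ 1904 ∷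
    1900 ∷ 1896 ∷ 1892 ∷ 1888 ∷ 1885 ∷ 1881 ∷ 1877 ∷ 1873 ∷ 1869 ∷ 1866 ∷ 1862 ∷ 1858 ∷ 1854 ∷
    1851 ∷ 1847 ∷ 1843 ∷ 1840 ∷ 1836 ∷ 1832 ∷ 1829 ∷ 1825 ∷ 1822 ∷ 1818 ∷ 1815 ∷ 1811 ∷ 1807 ∷
    1804 ∷ 1800 ∷ 1797 ∷ 1793 ∷ 1790 ∷ 1787 ∷ 1783 ∷ 1780 ∷ 1776 ∷ 1773 ∷ 1769 ∷ 1766 ∷ 1763 ∷
    1759 ∷ 1756 ∷ 1753 ∷ 1749 ∷ 1746 ∷ 1743 ∷ 1740 ∷ 1736 ∷ 1733 ∷ 1730 ∷ 1727 ∷ 1723 ∷ 1720 ∷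
    1717 ∷ 1714 ∷ 1710 ∷ 1707 ∷ 1704 ∷ 1701 ∷ 1698 ∷ 1695 ∷ 1692 ∷ 1689 ∷ 1685 ∷ 1682 ∷ 1679 ∷
    1676 ∷ 1673 ∷ 1670 ∷ 1667 ∷ 1664 ∷ 1661 ∷ 1658 ∷ 1655 ∷ 1652 ∷ 1649 ∷ 1646 ∷ 1643 ∷ 1640 ∷
    1637 ∷ 1634 ∷ 1632 ∷ 1629 ∷ 1626 ∷ 1623 ∷ 1620 ∷ 1617 ∷ 1614 ∷ 1611 ∷ 1609 ∷ 1606 ∷ 1603 ∷
    1600 ∷ 1597 ∷ 1595 ∷ 1592 ∷ 1589 ∷ 1586 ∷ 1583 ∷ 1581 ∷ 1578 ∷ 1575 ∷ 1572 ∷ 1570 ∷ 1567 ∷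
    1564 ∷ 1562 ∷ 1559 ∷ 1556 ∷ 1554 ∷ 1551 ∷ 1548 ∷ 1546 ∷ 1543 ∷ 1540 ∷ 1538 ∷ 1535 ∷ 1533 ∷
    1530 ∷ 1527 ∷ 1525 ∷ 1522 ∷ 1520 ∷ 1517 ∷ 1515 ∷ 1512 ∷ 1510 ∷ 1507 ∷ 1505 ∷ 1502 ∷ 1499 ∷
    1497 ∷ 1495 ∷ 1492 ∷ 1490 ∷ 1487 ∷ 1485 ∷ 1482 ∷ 1480 ∷ 1477 ∷ 1475 ∷ 1472 ∷ 1470 ∷ 1468 ∷
    1465 ∷ 1463 ∷ 1460 ∷ 1458 ∷ 1456 ∷ 1453 ∷ 1451 ∷ 1449 ∷ 1446 ∷ 1444 ∷ 1442 ∷ 1439 ∷ 1437 ∷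
    1435 ∷ 1432 ∷ 1430 ∷ 1428 ∷ 1425 ∷ 1423 ∷ 1421 ∷ 1419 ∷ 1416 ∷ 1414 ∷ 1412 ∷ 1409 ∷ 1407 ∷
    1405 ∷ 1403 ∷ 1401 ∷ 1398 ∷ 1396 ∷ 1394 ∷ 1392 ∷ 1390 ∷ 1387 ∷ 1385 ∷ 1383 ∷ 1381 ∷ 1379 ∷
    1376 ∷ 1374 ∷ 1372 ∷ 1370 ∷ 1368 ∷ 1366 ∷ 1364 ∷ 1361 ∷ 1359 ∷ 1357 ∷ 1355 ∷ 1353 ∷ 1351 ∷
    1349 ∷ 1347 ∷ 1345 ∷ 1343 ∷ 1341 ∷ 1339 ∷ 1336 ∷ 1334 ∷ 1332 ∷ 1330 ∷ 1328 ∷ 1326 ∷ 1324 ∷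
    1322 ∷ 1320 ∷ 1318 ∷ 1316 ∷ 1314 ∷ 1312 ∷ 1310 ∷ 1308 ∷ 1306 ∷ 1304 ∷ 1302 ∷ 1300 ∷ 1298 ∷
    1296 ∷ 1294 ∷ 1293 ∷ 1291 ∷ 1289 ∷ 1287 ∷ 1285 ∷ 1283 ∷ 1281 ∷ 1279 ∷ 1277 ∷ 1275 ∷ 1273 ∷
    1271 ∷ 1270 ∷ 1268 ∷ 1266 ∷ 1264 ∷ 1262 ∷ 1260 ∷ 1258 ∷ 1256 ∷ 1255 ∷ 1253 ∷ 1251 ∷ 1249 ∷
    1247 ∷ 1245 ∷ 1244 ∷ 1242 ∷ 1240 ∷ 1238 ∷ 1236 ∷ 1234 ∷ 1233 ∷ 1231 ∷ 1229 ∷ 1227 ∷ 1225 ∷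
    1224 ∷ 1222 ∷ 1220 ∷ 1218 ∷ 1217 ∷ 1215 ∷ 1213 ∷ 1211 ∷ 1210 ∷ 1208 ∷ 1206 ∷ 1204 ∷ 1203 ∷
    1201 ∷ 1199 ∷ 1197 ∷ 1196 ∷ 1194 ∷ 1192 ∷ 1191 ∷ 1189 ∷ 1187 ∷ 1186 ∷ 1184 ∷ 1182 ∷ 1180 ∷
    1179 ∷ 1177 ∷ 1175 ∷ 1174 ∷ 1172 ∷ 1170 ∷ 1169 ∷ 1167 ∷ 1165 ∷ 1164 ∷ 1162 ∷ 1161 ∷ 1159 ∷
    1157 ∷ 1156 ∷ 1154 ∷ 1152 ∷ 1151 ∷ 1149 ∷ 1148 ∷ 1146 ∷ 1144 ∷ 1143 ∷ 1141 ∷ 1140 ∷ 1138 ∷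
    1136 ∷ 1135 ∷ 1133 ∷ 1132 ∷ 1130 ∷ 1129 ∷ 1127 ∷ 1125 ∷ 1124 ∷ 1122 ∷ 1121 ∷ 1119 ∷ 1118 ∷
    1116 ∷ 1115 ∷ 1113 ∷ 1111 ∷ 1110 ∷ 1108 ∷ 1107 ∷ 1105 ∷ 1104 ∷ 1102 ∷ 1101 ∷ 1099 ∷ 1098 ∷
    1096 ∷ 1095 ∷ 1093 ∷ 1092 ∷ 1090 ∷ 1089 ∷ 1087 ∷ 1086 ∷ 1084 ∷ 1083 ∷ 1081 ∷ 1080 ∷ 1079 ∷
    1077 ∷ 1076 ∷ 1074 ∷ 1073 ∷ 1071 ∷ 1070 ∷ 1068 ∷ 1067 ∷ 1066 ∷ 1064 ∷ 1063 ∷ 1061 ∷ 1060 ∷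
    1058 ∷ 1057 ∷ 1056 ∷ 1054 ∷ 1053 ∷ 1051 ∷ 1050 ∷ 1049 ∷ 1047 ∷ 1046 ∷ 1044 ∷ 1043 ∷ 1042 ∷
    1040 ∷ 1039 ∷ 1037 ∷ 1036 ∷ 1035 ∷ 1033 ∷ 1032 ∷ 1031 ∷ 1029 ∷ 1028 ∷ 1026 ∷ 1025 ∷ 1024 ∷
    1022 ∷ 1021 ∷ 1020 ∷ 1018 ∷ 1017 ∷ 1016 ∷ 1014 ∷ 1013 ∷ 1012 ∷ 1010 ∷ 1009 ∷ 1008 ∷ 1006 ∷
    1005 ∷ 1004 ∷ 1002 ∷ 1001 ∷ 1000 ∷ 999 ∷ 997 ∷ 996 ∷ 995 ∷ 993 ∷ 992 ∷ 991 ∷ 989 ∷ 988 ∷ 987 ∷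
    986 ∷ 984 ∷ 983 ∷ 982 ∷ 981 ∷ 979 ∷ 978 ∷ 977 ∷ 975 ∷ 974 ∷ 973 ∷ 972 ∷ 970 ∷ 969 ∷ 968 ∷ 967 ∷
    965 ∷ 964 ∷ 963 ∷ 962 ∷ 961 ∷ 959 ∷ 958 ∷ 957 ∷ 956 ∷ 954 ∷ 953 ∷ 952 ∷ 951 ∷ 950 ∷ 948 ∷ 947 ∷
    946 ∷ 945 ∷ 943 ∷ 942 ∷ 941 ∷ 940 ∷ 939 ∷ 938 ∷ 936 ∷ 935 ∷ 934 ∷ 933 ∷ 932 ∷ 930 ∷ 929 ∷ 928 ∷
    927 ∷ 926 ∷ 925 ∷ 923 ∷ 922 ∷ 921 ∷ 920 ∷ 919 ∷ 918 ∷ 916 ∷ 915 ∷ 914 ∷ 913 ∷ 912 ∷ 911 ∷ 910 ∷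
    908 ∷ 907 ∷ 906 ∷ 905 ∷ 904 ∷ 903 ∷ 902 ∷ 901 ∷ 899 ∷ 898 ∷ 897 ∷ 896 ∷ 895 ∷ 894 ∷ 893 ∷ 892 ∷
    891 ∷ 889 ∷ 888 ∷ 887 ∷ 886 ∷ 885 ∷ 884 ∷ 883 ∷ 882 ∷ 881 ∷ 880 ∷ 879 ∷ 877 ∷ 876 ∷ 875 ∷ 874 ∷
    873 ∷ 872 ∷ 871 ∷ 870 ∷ 869 ∷ 868 ∷ 867 ∷ 866 ∷ 865 ∷ 864 ∷ 862 ∷ 861 ∷ 860 ∷ 859 ∷ 858 ∷ 857 ∷
    856 ∷ 855 ∷ 854 ∷ 853 ∷ 852 ∷ 851 ∷ 850 ∷ 849 ∷ 848 ∷ 847 ∷ 846 ∷ 845 ∷ 844 ∷ 843 ∷ 842 ∷ 841 ∷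
    840 ∷ 839 ∷ 838 ∷ 837 ∷ 836 ∷ 835 ∷ 834 ∷ 833 ∷ 832 ∷ 831 ∷ 830 ∷ []

  module Numerics where

    scale Q : ℕ
    scale = 100000000000000000000
    Q     = 1000000000

    open FixedPoint 1197 1198 scale 830 z<s

    -- The lower bound of (1197/1198)^8488 from which the check starts, 8488 being the top entry of
    -- the table.
    first : ℕ
    first = iterate descend scale 8488

    private abstract
      table-valid : True (valid scale 8488 first table)
      table-valid = tt

      half-check : True (1198 ^ 830 ≤ᵇ 2 * 1197 ^ 830)
      half-check = tt

      twice-check : True (2 * 1197 ^ 1185 <ᵇ 1198 ^ 1185)
      twice-check = tt

      gain-check : True (269 * 50001 * 1197 ^ 1185 ≤ᵇ 100 * 50000 * 1198 ^ 1185)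
      gain-check = tt

      sum-check : True (partialSum (λ i → weight Q (entry 830 table (1185 ∸ i))) 1185 <ᵇ Q)
      sum-check = tt

    parameters : Parameters
    parameters = record
      -- For this base log_b 2 = 830.04... and log_b 2.69 = 1184.97..., so rounding to R = 830 and
      -- suc a = 1185 loses little. The power b^1185 exceeds 2.69 by a factor just above 1 +
      -- 1/50000, hence M.
      { N = 1197 ; P = 1198 ; a = 1184 ; R = 830 ; Q = Q ; M = 50000
      ; μ = entry 830 table
      ; ω = λ r → weight Q (entry 830 table r)
      ; 0<N = z<s
      ; N<P = ≤-refl
      ; 0<M = z<s
      ; R≤a = ≤ᵇ⇒≤ 830 1184 tt
      ; half = ≤ᵇ⇒≤ (1198 ^ 830) (2 * 1197 ^ 830) half-check
      ; twice = <ᵇ⇒< (2 * 1197 ^ 1185) (1198 ^ 1185) twice-check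
      ; gain = ≤ᵇ⇒≤ (269 * 50001 * 1197 ^ 1185) (100 * 50000 * 1198 ^ 1185) gain-check
      ; μ-far = λ r R<r → ≤-reflexive (entry-beyond 830 table r R<r)
      ; μ-near = λ r r≤R → subst (λ i → Near i (entry 830 table r)) (+-identityʳ r) (entry-near 0 scale 8488 first table ≤-refl (iterate-lower 8488) table-valid r (s≤s r≤R))
      ; ω-mono = λ r → weight-antitone 1000000000 (entry-antitone scale 8488 first table table-valid r)
      ; ω-large = λ r → weight-large 1000000000 (entry 830 table r) (entry-positive scale 8488 first table table-valid r)
      ; ω-sum = <ᵇ⇒< (partialSum (λ i → weight Q (entry 830 table (1185 ∸ i))) 1185) Q sum-check
      }

  -- Greedy coverings

  -- Averaging; the member x₀ excludes the empty list.
  ∑-≥⇒∃ : ∀ {X : Set} (f g : X → ℕ) {x₀} xs → x₀ ∈ xs → ∑ g xs ≤ ∑ f xs → ∃ λ x → x ∈ xs × g x ≤ f x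
  ∑-≥⇒∃ f g {x₀} (x ∷ xs) x₀∈ le with g x ≤? f x
  ... | yes gx≤fx = x , here refl , gx≤fx
  ... | no gx≰fx with xs
  ...   | []     = contradiction (subst₂ _≤_ (+-identityʳ (g x)) (+-identityʳ (f x)) le) gx≰fx
  ...   | y ∷ ys with z , z∈ , ok ← ∑-≥⇒∃ f g (y ∷ ys) (here refl)
                       (+-cancelˡ-≤ (g x) _ _ (≤-trans le (+-monoˡ-≤ _ (<⇒≤ (≰⇒> gx≰fx))))) = z , there z∈ , ok

  module Greedy {X Y : Set} (Hit : X → Y → Set) (hit? : ∀ x y → Dec (Hit x y))
                (a b : ℕ) (Ys : List Y) {y₀ : Y} (y₀∈ : y₀ ∈ Ys) where

    -- With density b/(a+b), some y hits that fraction of the remaining Xs by double counting, and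
    -- a/(a+b) is the factor by which a round shrinks them.
    Dense : List X → Set
    Dense Xs = ∀ {x} → x ∈ Xs → b * length Ys ≤ (a + b) * ∑ (λ y → ⟦ hit? x y ⟧) Ys

    missed : Y → List X → List X
    missed y = filter (λ x → ¬? (hit? x y))

    hit+missed : ∀ y Xs → ∑ (λ x → ⟦ hit? x y ⟧) Xs + length (missed y Xs) ≡ length Xs
    hit+missed y []       = refl
    hit+missed y (x ∷ Xs) with hit? x y
    ... | yes _ = cong suc (hit+missed y Xs)
    ... | no _  = trans (+-suc _ _) (cong suc (hit+missed y Xs))

    average : ∀ Xs → Dense Xs → ∑ (const (b * length Xs)) Ys ≤ ∑ (λ y → (a + b) * ∑ (λ x → ⟦ hit? x y ⟧) Xs) Ys
    average Xs dense = begin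
      ∑ (const (b * length Xs)) Ys                              ≡⟨ ∑-const (b * length Xs) Ys ⟩
      length Ys * (b * length Xs)                               ≡⟨ alg (length Ys) b (length Xs) ⟩
      length Xs * (b * length Ys)                               ≡⟨ ∑-const (b * length Ys) Xs ⟨
      ∑ (const (b * length Ys)) Xs                              ≤⟨ ∑-mono Xs dense ⟩
      ∑ (λ x → (a + b) * ∑ (λ y → ⟦ hit? x y ⟧) Ys) Xs          ≡⟨ ∑-*ˡ (a + b) _ Xs ⟩
      (a + b) * ∑ (λ x → ∑ (λ y → ⟦ hit? x y ⟧) Ys) Xs          ≡⟨ cong ((a + b) *_) (∑-swap (λ x y → ⟦ hit? x y ⟧) Xs Ys) ⟩
      (a + b) * ∑ (λ y → ∑ (λ x → ⟦ hit? x y ⟧) Xs) Ys          ≡⟨ ∑-*ˡ (a + b) _ Ys ⟨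
      ∑ (λ y → (a + b) * ∑ (λ x → ⟦ hit? x y ⟧) Xs) Ys          ∎
      where
      open ≤-Reasoning
      alg : ∀ m b n → m * (b * n) ≡ n * (b * m)
      alg = solve-∀

    step : ∀ Xs → Dense Xs → ∃ λ y → y ∈ Ys × (a + b) * length (missed y Xs) ≤ a * length Xs
    step Xs dense with y , y∈ , le ← ∑-≥⇒∃ (λ y → (a + b) * ∑ (λ x → ⟦ hit? x y ⟧) Xs) (const (b * length Xs)) Ys y₀∈ (average Xs dense)
      = y , y∈ , +-cancelˡ-≤ (b * length Xs) _ _ (begin
        b * length Xs + (a + b) * length (missed y Xs)
          ≤⟨ +-monoˡ-≤ _ le ⟩
        (a + b) * ∑ (λ x → ⟦ hit? x y ⟧) Xs + (a + b) * length (missed y Xs)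
          ≡⟨ *-distribˡ-+ (a + b) _ _ ⟨
        (a + b) * (∑ (λ x → ⟦ hit? x y ⟧) Xs + length (missed y Xs))
          ≡⟨ cong ((a + b) *_) (hit+missed y Xs) ⟩
        (a + b) * length Xs
          ≡⟨ trans (cong (_* length Xs) (+-comm a b)) (*-distribʳ-+ (length Xs) b a) ⟩
        b * length Xs + a * length Xs ∎)
      where
      open ≤-Reasoning

    record Partial (t : ℕ) (Xs : List X) : Set where
      field
        chosen  : List Y
        len     : length chosen ≡ t
        chosen⊆ : ∀ {y} → y ∈ chosen → y ∈ Ys
        rest    : List X
        small   : (a + b) ^ t * length rest ≤ a ^ t * length Xs
        covered : ∀ {x} → x ∈ Xs → x ∈ rest ⊎ Any (Hit x) chosen

    extend : ∀ {t Xs y} → y ∈ Ys → (a + b) * length (missed y Xs) ≤ a * length Xs →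
             Partial t (missed y Xs) → Partial (suc t) Xs
    extend {t} {Xs} {y} y∈ shrink partial = record
      { chosen  = y ∷ chosen
      ; len     = cong suc len
      ; chosen⊆ = λ { (here refl) → y∈ ; (there y′∈) → chosen⊆ y′∈ }
      ; rest    = rest
      ; small   = small′
      ; covered = covered′
      }
      where
      open Partial partial
      open ≤-Reasoning
      alg : ∀ x y z → x * (y * z) ≡ y * (x * z)
      alg = solve-∀
      small′ : (a + b) ^ suc t * length rest ≤ a ^ suc t * length Xs
      small′ = begin
        (a + b) * (a + b) ^ t * length rest         ≡⟨ *-assoc (a + b) ((a + b) ^ t) (length rest) ⟩
        (a + b) * ((a + b) ^ t * length rest)       ≤⟨ *-monoʳ-≤ (a + b) small ⟩
        (a + b) * (a ^ t * length (missed y Xs))    ≡⟨ alg (a + b) (a ^ t) (length (missed y Xs)) ⟩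
        a ^ t * ((a + b) * length (missed y Xs))    ≤⟨ *-monoʳ-≤ (a ^ t) shrink ⟩
        a ^ t * (a * length Xs)                     ≡⟨ alg (a ^ t) a (length Xs) ⟩
        a * (a ^ t * length Xs)                     ≡⟨ *-assoc a (a ^ t) (length Xs) ⟨
        a * a ^ t * length Xs                       ∎
      covered′ : ∀ {x} → x ∈ Xs → x ∈ rest ⊎ Any (Hit x) (y ∷ chosen)
      covered′ {x} x∈ with hit? x y
      ... | yes hit = inj₂ (here hit)
      ... | no ¬hit with covered (∈-filter⁺ (λ x → ¬? (hit? x y)) x∈ ¬hit)
      ...   | inj₁ x∈rest = inj₁ x∈rest
      ...   | inj₂ found  = inj₂ (there found)

    greedy : ∀ t Xs → Dense Xs → Partial t Xs
    greedy zero    Xs dense = record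
      { chosen = [] ; len = refl ; chosen⊆ = λ () ; rest = Xs ; small = ≤-refl ; covered = inj₁ }
    greedy (suc t) Xs dense =
      let y , y∈ , shrink = step Xs dense
      in extend y∈ shrink (greedy t (missed y Xs) (λ x∈ → dense (proj₁ (∈-filter⁻ (λ x → ¬? (hit? x y)) x∈))))

    -- By Bernoulli, τ rounds shrink the missed part by (1 + b/a)^τ ≥ 1 + τb/a ≥ 2. After `suc m`
    -- such batches, fewer than one of at most 2^m elements is left.
    cover : ∀ τ m Xs → Dense Xs → 0 < b → a + b ≤ τ * b → length Xs ≤ 2 ^ m →
            ∃ λ ys → length ys ≡ τ * suc m × (∀ {y} → y ∈ ys → y ∈ Ys) × (∀ {x} → x ∈ Xs → Any (Hit x) ys)
    cover τ m Xs dense 0<b τ-large Xs≤ = chosen , len , chosen⊆ , covers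
      where
      open Partial (greedy (τ * suc m) Xs dense)
      open ≤-Reasoning
      a+b>0 : 0 < a + b
      a+b>0 = ≤-trans 0<b (m≤n+m b a)
      half : 2 * a ^ τ ≤ (a + b) ^ τ
      half with a ≟ 0
      half | no a≢0 = *-cancelˡ-≤ a {{≢-nonZero a≢0}} (begin
        a * (2 * a ^ τ)             ≡⟨ alg a (a ^ τ) ⟩
        (a + a) * a ^ τ             ≤⟨ *-monoˡ-≤ (a ^ τ) (+-monoʳ-≤ a (≤-trans (m≤m+n a b) τ-large)) ⟩
        (a + τ * b) * a ^ τ         ≤⟨ bernoulli a b τ ⟩
        a * (a + b) ^ τ             ∎)
        where
        alg : ∀ a x → a * (2 * x) ≡ (a + a) * x
        alg = solve-∀
      -- Here a cannot be cancelled, but τ is positive and the left side vanishes.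
      half | yes a≡0 rewrite a≡0 = zero-case τ τ-large
        where
        zero-case : ∀ τ → b ≤ τ * b → 2 * 0 ^ τ ≤ b ^ τ
        zero-case zero    b≤0 = contradiction (≤-trans 0<b b≤0) λ ()
        zero-case (suc τ) _   = z≤n
      doubled : 2 ^ suc m * a ^ (τ * suc m) ≤ (a + b) ^ (τ * suc m)
      doubled = begin
        2 ^ suc m * a ^ (τ * suc m)     ≡⟨ cong (2 ^ suc m *_) (^-*-assoc a τ (suc m)) ⟨
        2 ^ suc m * (a ^ τ) ^ suc m     ≡⟨ ^-distrib-* 2 (a ^ τ) (suc m) ⟨
        (2 * a ^ τ) ^ suc m             ≤⟨ ^-monoˡ-≤ (suc m) half ⟩
        ((a + b) ^ τ) ^ suc m           ≡⟨ ^-*-assoc (a + b) τ (suc m) ⟩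
        (a + b) ^ (τ * suc m)           ∎
      alg₁ : ∀ x r → x * (2 * r) ≡ 2 * (x * r)
      alg₁ = solve-∀
      alg₂ : ∀ x p → 2 * (x * p) ≡ 2 * p * x
      alg₂ = solve-∀
      2*rest≤1 : 2 * length rest ≤ 1
      2*rest≤1 = *-cancelˡ-≤ ((a + b) ^ (τ * suc m)) {{m^n≢0 (a + b) (τ * suc m) {{>-nonZero a+b>0}}}} (begin
        (a + b) ^ (τ * suc m) * (2 * length rest)   ≡⟨ alg₁ ((a + b) ^ (τ * suc m)) (length rest) ⟩
        2 * ((a + b) ^ (τ * suc m) * length rest)   ≤⟨ *-monoʳ-≤ 2 (≤-trans small (*-monoʳ-≤ (a ^ (τ * suc m)) Xs≤)) ⟩
        2 * (a ^ (τ * suc m) * 2 ^ m)               ≡⟨ alg₂ (a ^ (τ * suc m)) (2 ^ m) ⟩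
        2 ^ suc m * a ^ (τ * suc m)                 ≤⟨ doubled ⟩
        (a + b) ^ (τ * suc m)                       ≡⟨ *-identityʳ _ ⟨
        (a + b) ^ (τ * suc m) * 1                   ∎)
      empty : length rest ≡ 0
      empty = n<1⇒n≡0 (*-cancelˡ-< 2 (length rest) 1 (s≤s 2*rest≤1))
      covers : ∀ {x} → x ∈ Xs → Any (Hit x) chosen
      covers x∈ with covered x∈
      ... | inj₂ found  = found
      ... | inj₁ x∈rest = contradiction (∑-member (const 1) x∈rest)
                            (<⇒≱ (s≤s (≤-reflexive (trans (sym (length≡∑ rest)) empty))))

  -- Tuples of distinct elements of {0, …, n − 1}

  _∈ℕ?_ : (v : ℕ) (y : List ℕ) → Dec (v ∈ y)
  _∈ℕ?_ = _∈?_ _≟_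

  𝟙 : Bool → ℕ
  𝟙 true  = 1
  𝟙 false = 0

  count : (ℕ → Bool) → ℕ → ℕ
  count p n = ∑ (𝟙 ∘ p) (downFrom n)

  extensions : ℕ → List ℕ → List (List ℕ)
  extensions n y = map (_∷ y) (filter (λ v → ¬? (v ∈ℕ? y)) (downFrom n))

  -- Ordered tuples can be counted one coordinate at a time. Tuples with the same elements give the
  -- same clause, which `dedupe` takes care of.
  tuples : ℕ → ℕ → List (List ℕ)
  tuples n zero    = [] ∷ []
  tuples n (suc L) = concatMap (extensions n) (tuples n L)

  record IsTuple (n L : ℕ) (y : List ℕ) : Set where
    field
      length≡ : length y ≡ L
      unique  : Unique y
      bounded : ∀ {v} → v ∈ y → v < n

  tuples-sound : ∀ n L {y} → y ∈ tuples n L → IsTuple n L y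
  tuples-sound n zero    (here refl) = record { length≡ = refl ; unique = [] ; bounded = λ () }
  tuples-sound n (suc L) y∈ with y₀ , y₀∈ , y∈ext ← find (∈-concatMap⁻ (extensions n) {xs = tuples n L} y∈)
    with v , v∈ , refl ← ∈-map⁻ (_∷ y₀) y∈ext
    with v∈range , v∉y₀ ← ∈-filter⁻ (λ v → ¬? (v ∈ℕ? y₀)) {xs = downFrom n} v∈ = record
    { length≡ = cong suc (IsTuple.length≡ tup)
    ; unique  = All.tabulate (λ { u∈ refl → v∉y₀ u∈ }) ∷ IsTuple.unique tup
    ; bounded = λ { (here refl) → ∈-downFrom⁻ v∈range ; (there u∈) → IsTuple.bounded tup u∈ }
    }
    where tup = tuples-sound n L y₀∈

  length-tuples : ∀ n L → length (tuples n L) ≤ n ^ L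
  length-tuples n zero    = ≤-refl
  length-tuples n (suc L) = begin
    length (tuples n (suc L))                            ≡⟨ length≡∑ (tuples n (suc L)) ⟩
    ∑ (const 1) (tuples n (suc L))                       ≡⟨ ∑-concatMap (const 1) (extensions n) (tuples n L) ⟩
    ∑ (λ y → ∑ (const 1) (extensions n y)) (tuples n L)  ≤⟨ ∑-mono (tuples n L) (λ {y} _ → bound y) ⟩
    ∑ (const n) (tuples n L)                             ≡⟨ ∑-const n (tuples n L) ⟩
    length (tuples n L) * n                              ≤⟨ *-monoˡ-≤ n (length-tuples n L) ⟩
    n ^ L * n                                            ≡⟨ *-comm (n ^ L) n ⟩
    n * n ^ L                                            ∎
    where
    open ≤-Reasoning
    bound : ∀ y → ∑ (const 1) (extensions n y) ≤ n
    bound y = begin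
      ∑ (const 1) (extensions n y)                                       ≡⟨ length≡∑ (extensions n y) ⟨
      length (extensions n y)                                            ≡⟨ length-map (_∷ y) (filter (λ v → ¬? (v ∈ℕ? y)) (downFrom n)) ⟩
      length (filter (λ v → ¬? (v ∈ℕ? y)) (downFrom n))                  ≤⟨ length-filter (λ v → ¬? (v ∈ℕ? y)) (downFrom n) ⟩
      length (downFrom n)                                                ≡⟨ length-downFrom n ⟩
      n                                                                  ∎

  AllTrue : (ℕ → Bool) → List ℕ → Set
  AllTrue p = All (λ v → p v ≡ true)

  allTrue? : ∀ p y → Dec (AllTrue p y)
  allTrue? p = all? (λ v → p v ≟B true)

  hits : (ℕ → Bool) → List ℕ → ℕ
  hits p y = ⟦ allTrue? p y ⟧

  hits-∷ : ∀ p v y → hits p (v ∷ y) ≡ hits p y * 𝟙 (p v)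
  hits-∷ p v y = by-cases (p v) refl (allTrue? p y)
    where
    by-cases : ∀ b → p v ≡ b → (d : Dec (AllTrue p y)) → hits p (v ∷ y) ≡ ⟦ d ⟧ * 𝟙 b
    by-cases true  eq (yes all) = ⟦⟧-yes (allTrue? p (v ∷ y)) (eq ∷ all)
    by-cases true  eq (no ¬all) = ⟦⟧-no (allTrue? p (v ∷ y)) (λ { (_ ∷ all) → ¬all all })
    by-cases false eq d         = trans (⟦⟧-no (allTrue? p (v ∷ y)) (λ { (eq′ ∷ _) → contradiction (trans (sym eq) eq′) λ () }))
                                        (sym (*-zeroʳ ⟦ d ⟧))

  ∑-δ≤1 : ∀ u n → ∑ (λ v → ⟦ u ≟ v ⟧) (downFrom n) ≤ 1
  ∑-δ≤1 u zero    = z≤n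
  ∑-δ≤1 u (suc n) with u ≟ n
  ... | no _     = ∑-δ≤1 u n
  ... | yes refl = s≤s (≤-trans (∑-mono (downFrom n) (λ v∈ → ≤-reflexive (⟦⟧-no (n ≟ _) λ { refl → <-irrefl refl (∈-downFrom⁻ v∈) })))
                                (≤-reflexive (trans (∑-const 0 (downFrom n)) (*-zeroʳ (length (downFrom n))))))

  ∑-∈≤length : ∀ n y → ∑ (λ v → ⟦ v ∈ℕ? y ⟧) (downFrom n) ≤ length y
  ∑-∈≤length n y = begin
    ∑ (λ v → ⟦ v ∈ℕ? y ⟧) (downFrom n)                    ≤⟨ ∑-mono (downFrom n) (λ {v} _ → bound v) ⟩
    ∑ (λ v → ∑ (λ u → ⟦ u ≟ v ⟧) y) (downFrom n)          ≡⟨ ∑-swap (λ v u → ⟦ u ≟ v ⟧) (downFrom n) y ⟩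
    ∑ (λ u → ∑ (λ v → ⟦ u ≟ v ⟧) (downFrom n)) y          ≤⟨ ∑-mono y (λ {u} _ → ∑-δ≤1 u n) ⟩
    ∑ (const 1) y                                         ≡⟨ length≡∑ y ⟨
    length y                                              ∎
    where
    open ≤-Reasoning
    bound : ∀ v → ⟦ v ∈ℕ? y ⟧ ≤ ∑ (λ u → ⟦ u ≟ v ⟧) y
    bound v with v ∈ℕ? y
    ... | no _   = z≤n
    ... | yes v∈ = ≤-trans (≤-reflexive (sym (⟦⟧-yes (v ≟ v) refl))) (∑-member (λ u → ⟦ u ≟ v ⟧) v∈)

  count-outside : ∀ p n y → count p n ≤ ∑ (𝟙 ∘ p) (filter (λ v → ¬? (v ∈ℕ? y)) (downFrom n)) + length y
  count-outside p n y = begin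
    count p n
      ≤⟨ ∑-mono (downFrom n) (λ {v} _ → bound v) ⟩
    ∑ (λ v → ⟦ ¬? (v ∈ℕ? y) ⟧ * 𝟙 (p v) + ⟦ v ∈ℕ? y ⟧) (downFrom n)
      ≡⟨ ∑-+ _ _ (downFrom n) ⟩
    ∑ (λ v → ⟦ ¬? (v ∈ℕ? y) ⟧ * 𝟙 (p v)) (downFrom n) + ∑ (λ v → ⟦ v ∈ℕ? y ⟧) (downFrom n)
      ≡⟨ cong (_+ ∑ (λ v → ⟦ v ∈ℕ? y ⟧) (downFrom n)) (∑-filter (λ v → ¬? (v ∈ℕ? y)) (𝟙 ∘ p) (downFrom n)) ⟨
    ∑ (𝟙 ∘ p) (filter (λ v → ¬? (v ∈ℕ? y)) (downFrom n)) + ∑ (λ v → ⟦ v ∈ℕ? y ⟧) (downFrom n)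
      ≤⟨ +-monoʳ-≤ _ (∑-∈≤length n y) ⟩
    ∑ (𝟙 ∘ p) (filter (λ v → ¬? (v ∈ℕ? y)) (downFrom n)) + length y ∎
    where
    open ≤-Reasoning
    𝟙≤1 : ∀ b → 𝟙 b ≤ 1
    𝟙≤1 true  = ≤-refl
    𝟙≤1 false = z≤n
    bound : ∀ v → 𝟙 (p v) ≤ ⟦ ¬? (v ∈ℕ? y) ⟧ * 𝟙 (p v) + ⟦ v ∈ℕ? y ⟧
    bound v with v ∈ℕ? y
    ... | yes _ = 𝟙≤1 (p v)
    ... | no _  = ≤-trans (m≤m+n (𝟙 (p v)) 0) (m≤m+n _ 0)

  -- The entries already chosen exclude at most L values, so the slack L in the hypothesis leaves at
  -- least g true values for every coordinate.
  tuples-hits : ∀ p n g L → g + L ≤ count p n → g ^ L ≤ ∑ (hits p) (tuples n L)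
  tuples-hits p n g zero    _  = ≤-refl
  tuples-hits p n g (suc L) le = begin
    g * g ^ L
      ≤⟨ *-monoʳ-≤ g (tuples-hits p n g L (≤-trans (+-monoʳ-≤ g (n≤1+n L)) le)) ⟩
    g * ∑ (hits p) (tuples n L)
      ≡⟨ ∑-*ˡ g (hits p) (tuples n L) ⟨
    ∑ (λ y → g * hits p y) (tuples n L)
      ≤⟨ ∑-mono (tuples n L) bound ⟩
    ∑ (λ y → ∑ (hits p) (extensions n y)) (tuples n L)
      ≡⟨ ∑-concatMap (hits p) (extensions n) (tuples n L) ⟨
    ∑ (hits p) (tuples n (suc L)) ∎
    where
    open ≤-Reasoning
    bound : ∀ {y} → y ∈ tuples n L → g * hits p y ≤ ∑ (hits p) (extensions n y)
    bound {y} y∈ = begin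
      g * hits p y                                             ≡⟨ *-comm g (hits p y) ⟩
      hits p y * g                                             ≤⟨ *-monoʳ-≤ (hits p y) (+-cancelʳ-≤ (length y) _ _ (≤-trans
                                                                    (≤-trans (+-monoʳ-≤ g (≤-trans (≤-reflexive (IsTuple.length≡ (tuples-sound n L y∈))) (n≤1+n L))) le)
                                                                    (count-outside p n y))) ⟩
      hits p y * ∑ (𝟙 ∘ p) outside                             ≡⟨ ∑-*ˡ (hits p y) (𝟙 ∘ p) outside ⟨
      ∑ (λ v → hits p y * 𝟙 (p v)) outside                     ≡⟨ ∑-cong outside (λ v → hits-∷ p v y) ⟨
      ∑ (hits p ∘ (_∷ y)) outside                              ≡⟨ ∑-map (hits p) (_∷ y) outside ⟨
      ∑ (hits p) (extensions n y)                              ∎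
      where outside = filter (λ v → ¬? (v ∈ℕ? y)) (downFrom n)

  allVecs : ∀ n → List (Vec Bool n)
  allVecs zero    = [] ∷ []
  allVecs (suc n) = map (true ∷_) (allVecs n) ++ map (false ∷_) (allVecs n)

  length-allVecs : ∀ n → length (allVecs n) ≡ 2 ^ n
  length-allVecs zero    = refl
  length-allVecs (suc n) = trans (length-++ (map (true ∷_) (allVecs n)))
    (cong₂ _+_ (trans (length-map (true ∷_) (allVecs n)) (length-allVecs n))
               (trans (length-map (false ∷_) (allVecs n)) (trans (length-allVecs n) (sym (+-identityʳ _)))))

  ∈-allVecs : ∀ {n} (v : Vec Bool n) → v ∈ allVecs n
  ∈-allVecs []          = here refl
  ∈-allVecs (true ∷ v)  = ∈-++⁺ˡ (∈-map⁺ (true ∷_) (∈-allVecs v))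
  ∈-allVecs (false ∷ v) = ∈-++⁺ʳ _ (∈-map⁺ (false ∷_) (∈-allVecs v))

  restrict : ∀ n → (ℕ → Bool) → Vec Bool n
  restrict zero    p = []
  restrict (suc n) p = p 0 ∷ restrict n (p ∘ suc)

  get-restrict : ∀ {n} p {x} → x < n → get (restrict n p) x ≡ p x
  get-restrict {suc n} p {zero}  _         = refl
  get-restrict {suc n} p {suc x} (s≤s x<n) = get-restrict (p ∘ suc) x<n

  ∑-positive : ∀ {X : Set} (f : X → ℕ) xs → 0 < ∑ f xs → ∃ λ x → x ∈ xs
  ∑-positive f (x ∷ xs) _ = x , here refl

  module Covering (n L g : ℕ) (0<g : 0 < g) (g≤n : g ≤ n) where

    instance
      gᴸ-nonZero : NonZero (g ^ L)
      gᴸ-nonZero = m^n≢0 g L {{>-nonZero 0<g}}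

    -- About (n/g)^L, the inverse of the density g^L / n^L with which the tuples hit an assignment
    -- in `large`.
    τ : ℕ
    τ = suc (n ^ L / g ^ L)

    τ-small : τ * g ^ L ≤ 2 * n ^ L
    τ-small = +-mono-≤ (^-monoˡ-≤ L g≤n) (≤-trans (m/n*n≤m (n ^ L) (g ^ L)) (m≤m+n (n ^ L) 0))

    τ-large : n ^ L ≤ τ * g ^ L
    τ-large = begin
      n ^ L                                           ≡⟨ m≡m%n+[m/n]*n (n ^ L) (g ^ L) ⟩
      n ^ L % g ^ L + n ^ L / g ^ L * g ^ L           ≤⟨ +-monoˡ-≤ _ (<⇒≤ (m%n<n (n ^ L) (g ^ L))) ⟩
      g ^ L + n ^ L / g ^ L * g ^ L                   ∎
      where open ≤-Reasoning

    large : List (Vec Bool n)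
    large = filter (λ v → g + L ≤? count (get v) n) (allVecs n)

    large-hits : ∀ {v} → v ∈ large → g ^ L ≤ ∑ (hits (get v)) (tuples n L)
    large-hits {v} v∈ = tuples-hits (get v) n g L (proj₂ (∈-filter⁻ (λ v → g + L ≤? count (get v) n) {xs = allVecs n} v∈))

    a+b≡ : n ^ L ∸ g ^ L + g ^ L ≡ n ^ L
    a+b≡ = m∸n+n≡m (^-monoˡ-≤ L g≤n)

    module Hitting {y₀} (y₀∈ : y₀ ∈ tuples n L) = Greedy {Vec Bool n} (AllTrue ∘ get) (allTrue? ∘ get)
      (n ^ L ∸ g ^ L) (g ^ L) (tuples n L) y₀∈

    dense : ∀ {v} → v ∈ large →
            g ^ L * length (tuples n L) ≤ (n ^ L ∸ g ^ L + g ^ L) * ∑ (hits (get v)) (tuples n L)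
    dense {v} v∈ = begin
      g ^ L * length (tuples n L)                                   ≤⟨ *-monoʳ-≤ (g ^ L) (length-tuples n L) ⟩
      g ^ L * n ^ L                                                 ≤⟨ *-monoˡ-≤ (n ^ L) (large-hits v∈) ⟩
      ∑ (hits (get v)) (tuples n L) * n ^ L                         ≡⟨ *-comm _ (n ^ L) ⟩
      n ^ L * ∑ (hits (get v)) (tuples n L)                         ≡⟨ cong (_* ∑ (hits (get v)) (tuples n L)) a+b≡ ⟨
      (n ^ L ∸ g ^ L + g ^ L) * ∑ (hits (get v)) (tuples n L)       ∎
      where open ≤-Reasoning

    Family : List (List ℕ) → Set
    Family ys = length ys ≤ τ * suc n × (∀ {y} → y ∈ ys → y ∈ tuples n L) × (∀ {v} → v ∈ large → Any (AllTrue (get v)) ys)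

    family : ∃ Family
    family = by-cases large refl
      where
      by-cases : ∀ vs → large ≡ vs → ∃ Family
      by-cases []      eq = [] , z≤n , (λ ()) , λ v∈ → contradiction (subst (_ ∈_) eq v∈) λ ()
      by-cases (v ∷ _) eq =
        let y₀ , y₀∈ = ∑-positive (hits (get v)) (tuples n L)
                         (≤-trans (m^n>0 g {{>-nonZero 0<g}} L) (large-hits (subst (v ∈_) (sym eq) (here refl))))
            ys , len , ys⊆ , covers = Hitting.cover y₀∈ τ n large dense (m^n>0 g {{>-nonZero 0<g}} L)
                         (≤-trans (≤-reflexive a+b≡) τ-large)
                         (≤-trans (length-filter (λ v → g + L ≤? count (get v) n) (allVecs n))
                                  (≤-reflexive (length-allVecs n)))
        in ys , ≤-reflexive len , ys⊆ , covers

  -- The targets are restrictions to n variables, at most 2^n in number. Greedy choice pays only for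
  -- the logarithm of this number, whence the factor `suc n`.
  covering : ∀ n L g → 0 < g → g ≤ n → ∃ λ (ys : List (List ℕ)) →
             length ys * g ^ L ≤ 2 * suc n * n ^ L ×
             (∀ {y} → y ∈ ys → IsTuple n L y) ×
             (∀ p → g + L ≤ count p n → Any (AllTrue p) ys)
  covering n L g 0<g g≤n = ys , size , (λ y∈ → tuples-sound n L (ys⊆ y∈)) , covered
    where
    open ≤-Reasoning
    open Covering n L g 0<g g≤n using (τ; τ-small; family)
    ys = proj₁ family
    len = proj₁ (proj₂ family)
    ys⊆ = proj₁ (proj₂ (proj₂ family))
    covers = proj₂ (proj₂ (proj₂ family))
    alg₁ : ∀ t m x → t * m * x ≡ m * (t * x)
    alg₁ = solve-∀
    alg₂ : ∀ m x → m * (2 * x) ≡ 2 * m * x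
    alg₂ = solve-∀
    size : length ys * g ^ L ≤ 2 * suc n * n ^ L
    size = begin
      length ys * g ^ L       ≤⟨ *-monoˡ-≤ (g ^ L) len ⟩
      τ * suc n * g ^ L       ≡⟨ alg₁ τ (suc n) (g ^ L) ⟩
      suc n * (τ * g ^ L)     ≤⟨ *-monoʳ-≤ (suc n) τ-small ⟩
      suc n * (2 * n ^ L)     ≡⟨ alg₂ (suc n) (n ^ L) ⟩
      2 * suc n * n ^ L       ∎
    covered : ∀ p → g + L ≤ count p n → Any (AllTrue p) ys
    covered p le =
      let y , y∈ , all = find (covers (∈-filter⁺ (λ v → g + L ≤? count (get v) n) (∈-allVecs (restrict n p))
            (≤-trans le (∑-mono (downFrom n) λ v∈ → ≤-reflexive (cong 𝟙 (sym (get-restrict p (∈-downFrom⁻ v∈))))))))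
      in lose y∈ (All.tabulate λ v∈ →
           trans (sym (get-restrict p (IsTuple.bounded (tuples-sound n L (ys⊆ y∈)) v∈))) (All.lookup all v∈))

  DistinctVars⇒IsClause : ∀ {C} → DistinctVars C → IsClause C
  DistinctVars⇒IsClause {C} distinct = unique distinct , All.tabulate (consistent distinct)
    where
    unique : ∀ {C} → DistinctVars C → Unique C
    unique []                = []
    unique (l∉C ∷ distinct′) = All.map (λ l≢m l≡m → l≢m (cong proj₁ l≡m)) l∉C ∷ unique distinct′
    neg-≢ : ∀ l → neg l ≢ l
    neg-≢ (x , true)  ()
    neg-≢ (x , false) ()
    consistent : ∀ {C} → DistinctVars C → ∀ {l} → l ∈ C → ¬ neg l ∈ C
    consistent (m∉C ∷ distinct′) (here refl) (here eq)   = neg-≢ _ eq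
    consistent (m∉C ∷ distinct′) (here refl) (there nl∈) = All.lookup m∉C nl∈ refl
    consistent (m∉C ∷ distinct′) (there l∈)  (here refl) = All.lookup m∉C l∈ refl
    consistent (m∉C ∷ distinct′) (there l∈)  (there nl∈) = consistent distinct′ l∈ nl∈

  -- Conflicts in concatenations

  degree≤length : ∀ F C → degree F C ≤ length F
  degree≤length F C = ≤-trans (∑-mono F (λ {D} _ → ⟦⟧≤1 (conflict? C D))) (≤-reflexive (sym (length≡∑ F)))

  degree-zero : ∀ F C → (∀ {D} → D ∈ F → ¬ Conflict C D) → degree F C ≤ 0
  degree-zero F C ¬conf = ≤-trans (∑-mono F (λ {D} D∈ → ≤-reflexive (⟦⟧-no (conflict? C D) (¬conf D∈))))
                                  (≤-reflexive (trans (∑-const 0 F) (*-zeroʳ (length F))))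

  e-∷ : ∀ C F → e (C ∷ F) ≡ degree F C + e F
  e-∷ C F = cong (_+ e F) (length-filter≡∑ (conflict? C) F)

  e-++ : ∀ F G → e (F ++ G) ≡ e F + e G + ∑ (degree G) F
  e-++ []      G = sym (+-identityʳ (e G))
  e-++ (C ∷ F) G = begin
    e (C ∷ F ++ G)                                        ≡⟨ e-∷ C (F ++ G) ⟩
    degree (F ++ G) C + e (F ++ G)                        ≡⟨ cong₂ _+_ (∑-++ _ F G) (e-++ F G) ⟩
    degree F C + degree G C + (e F + e G + ∑ (degree G) F) ≡⟨ alg (degree F C) (degree G C) (e F) (e G) _ ⟩
    degree F C + e F + e G + (degree G C + ∑ (degree G) F) ≡⟨ cong (λ x → x + e G + ∑ (degree G) (C ∷ F)) (e-∷ C F) ⟨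
    e (C ∷ F) + e G + ∑ (degree G) (C ∷ F)                ∎
    where
    open ≡-Reasoning
    alg : ∀ a b c d s → a + b + (c + d + s) ≡ a + c + d + (b + s)
    alg = solve-∀

  e-++≤ : ∀ F G → e (F ++ G) ≤ e F + e G + length F * length G
  e-++≤ F G = ≤-trans (≤-reflexive (e-++ F G)) (+-monoʳ-≤ (e F + e G)
    (≤-trans (∑-mono F (λ {C} _ → degree≤length G C)) (≤-reflexive (∑-const (length G) F))))

  e-++-separate : ∀ F G → (∀ {C D} → C ∈ F → D ∈ G → ¬ Conflict C D) → e (F ++ G) ≤ e F + e G
  e-++-separate F G separate = ≤-trans (≤-reflexive (e-++ F G)) (≤-trans (+-monoʳ-≤ (e F + e G)
    (≤-trans (∑-mono F (λ {C} C∈ → degree-zero G C (separate C∈)))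
             (≤-reflexive (trans (∑-const 0 F) (*-zeroʳ (length F)))))) (≤-reflexive (+-identityʳ _)))

  e≤length² : ∀ F → e F ≤ length F * length F
  e≤length² []      = z≤n
  e≤length² (C ∷ F) = begin
    e (C ∷ F)                                   ≡⟨ e-∷ C F ⟩
    degree F C + e F                            ≤⟨ +-mono-≤ (degree≤length F C) (e≤length² F) ⟩
    length F + length F * length F              ≤⟨ m≤n+m _ (suc (length F)) ⟩
    suc (length F) + (length F + length F * length F)      ≡⟨ cong (suc (length F) +_) (*-suc (length F) (length F)) ⟨
    suc (length F) + length F * suc (length F)  ∎
    where open ≤-Reasoning

  e-conflictFree : ∀ F → (∀ {C D} → C ∈ F → D ∈ F → ¬ Conflict C D) → e F ≤ 0
  e-conflictFree []      free = z≤n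
  e-conflictFree (C ∷ F) free = ≤-trans (≤-reflexive (e-∷ C F))
    (+-mono-≤ (degree-zero F C (λ D∈ → free (here refl) (there D∈))) (e-conflictFree F (λ C∈ D∈ → free (there C∈) (there D∈))))

  -- Removing repeated clauses

  -- Implied by being permutations of each other, so a list without two such clauses contains no two
  -- permutations either.
  SameSet : Clause → Clause → Set
  SameSet C D = All (_∈ D) C × All (_∈ C) D

  sameSet? : ∀ C D → Dec (SameSet C D)
  sameSet? C D = all? (λ l → _∈?_ _≟L_ l D) C ×-dec all? (λ l → _∈?_ _≟L_ l C) D

  dedupe : CNF → CNF
  dedupe []      = []
  dedupe (C ∷ F) with any? (sameSet? C) F
  ... | yes _ = dedupe F
  ... | no _  = C ∷ dedupe F

  dedupe-⊆ : ∀ F {C} → C ∈ dedupe F → C ∈ F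
  dedupe-⊆ (D ∷ F) C∈ with any? (sameSet? D) F
  dedupe-⊆ (D ∷ F) C∈          | yes _ = there (dedupe-⊆ F C∈)
  dedupe-⊆ (D ∷ F) (here refl) | no _  = here refl
  dedupe-⊆ (D ∷ F) (there C∈)  | no _  = there (dedupe-⊆ F C∈)

  ∑-dedupe : ∀ (f : Clause → ℕ) F → ∑ f (dedupe F) ≤ ∑ f F
  ∑-dedupe f []      = z≤n
  ∑-dedupe f (C ∷ F) with any? (sameSet? C) F
  ... | yes _ = ≤-trans (∑-dedupe f F) (m≤n+m _ (f C))
  ... | no _  = +-monoʳ-≤ (f C) (∑-dedupe f F)

  e-dedupe : ∀ F → e (dedupe F) ≤ e F
  e-dedupe []      = z≤n
  e-dedupe (C ∷ F) with any? (sameSet? C) F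
  ... | yes _ = ≤-trans (e-dedupe F) (m≤n+m _ (length (filter (conflict? C) F)))
  ... | no _  = ≤-trans (≤-reflexive (e-∷ C (dedupe F)))
      (≤-trans (+-mono-≤ (∑-dedupe (λ D → ⟦ conflict? C D ⟧) F) (e-dedupe F)) (≤-reflexive (sym (e-∷ C F))))

  dedupe-distinct : ∀ F → AllPairs (λ C D → ¬ (C ↭ D)) (dedupe F)
  dedupe-distinct []      = []
  dedupe-distinct (C ∷ F) with any? (sameSet? C) F
  ... | yes _ = dedupe-distinct F
  ... | no ¬any = All.tabulate (λ D∈ C↭D → ¬any (lose (dedupe-⊆ F D∈)
                    (All.tabulate (∈-resp-↭ C↭D) , All.tabulate (∈-resp-↭ (↭-sym C↭D))))) ∷ dedupe-distinct F

  dedupe-sat : ∀ {α} F → All (SatClause α) (dedupe F) → All (SatClause α) F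
  dedupe-sat []      sats = []
  dedupe-sat (C ∷ F) sats with any? (sameSet? C) F
  dedupe-sat (C ∷ F) (sat ∷ sats) | no _ = sat ∷ dedupe-sat F sats
  dedupe-sat {α} (C ∷ F) sats | yes any with D , D∈ , (_ , D⊆C) ← find any =
    let l , l∈ , eq = SatClause-witness (All.lookup (dedupe-sat F sats) D∈)
    in SatClause-∈ (All.lookup D⊆C l∈) eq ∷ dedupe-sat F sats

  -- The construction

  positive negative : List ℕ → Clause
  positive = map (_, true)
  negative = map (_, false)

  fresh : ∀ {d} → ℕ → Vec Bool d → Clause
  fresh base []      = []
  fresh base (b ∷ v) = (base , b) ∷ fresh (suc base) v

  -- Whatever the values of the d private variables, one sign pattern is false throughout, so the
  -- block forces `positive S` to hold.
  block : ℕ → ℕ → List ℕ → CNF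
  block d base S = map (λ v → positive S ++ fresh base v) (allVecs d)

  blocks : ℕ → ℕ → List (List ℕ) → CNF
  blocks d base []      = []
  blocks d base (S ∷ G) = block d base S ++ blocks d (base + d) G

  fresh-vars : ∀ {d} base (v : Vec Bool d) {l} → l ∈ fresh base v → base ≤ proj₁ l × proj₁ l < base + d
  fresh-vars {suc d} base (b ∷ v) (here refl) = ≤-refl , m<m+n base z<s
  fresh-vars {suc d} base (b ∷ v) {l} (there l∈) =
    let lo , hi = fresh-vars (suc base) v l∈ in <⇒≤ lo , subst (proj₁ l <_) (sym (+-suc base d)) hi

  fresh-distinct : ∀ {d} base (v : Vec Bool d) → DistinctVars (fresh base v)
  fresh-distinct base []      = []
  fresh-distinct base (b ∷ v) =
    All.tabulate (λ l∈ eq → <-irrefl eq (proj₁ (fresh-vars (suc base) v l∈))) ∷ fresh-distinct (suc base) v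

  fresh-length : ∀ {d} base (v : Vec Bool d) → length (fresh base v) ≡ d
  fresh-length base []      = refl
  fresh-length base (b ∷ v) = cong suc (fresh-length (suc base) v)

  signed-distinct : ∀ b {S} → Unique S → DistinctVars (map (_, b) S)
  signed-distinct b = AllPairs.map⁺

  InBlock : ℕ → ℕ → ℕ → Literal → Set
  InBlock n base top (x , b) = (x < n × b ≡ true) ⊎ (base ≤ x × x < top)

  block-literals : ∀ {n d base S C} → (∀ {v} → v ∈ S → v < n) → C ∈ block d base S →
                   ∀ {l} → l ∈ C → InBlock n base (base + d) l
  block-literals {d = d} {base} {S} S<n C∈ l∈ with v , _ , refl ← ∈-map⁻ (λ v → positive S ++ fresh base v) C∈
    with ∈-++⁻ (positive S) l∈
  ... | inj₂ l∈fresh = inj₂ (fresh-vars base v l∈fresh)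
  ... | inj₁ l∈pos with x , x∈ , refl ← ∈-map⁻ (_, true) l∈pos = inj₁ (S<n x∈ , refl)

  blocks-literals : ∀ {n d} base G → n ≤ base → (∀ {S} → S ∈ G → ∀ {v} → v ∈ S → v < n) → ∀ {C} → C ∈ blocks d base G →
                    ∀ {x b} → (x , b) ∈ C → (x < n × b ≡ true) ⊎ base ≤ x
  blocks-literals {n} {d} base (S ∷ G) n≤base G<n C∈ l∈ with ∈-++⁻ (block d base S) C∈
  ... | inj₁ C∈block with block-literals (G<n (here refl)) C∈block l∈
  ...   | inj₁ low         = inj₁ low
  ...   | inj₂ (base≤x , _) = inj₂ base≤x
  blocks-literals {n} {d} base (S ∷ G) n≤base G<n C∈ l∈ | inj₂ C∈blocks
    with blocks-literals (base + d) G (≤-trans n≤base (m≤m+n base d)) (λ S∈ → G<n (there S∈)) C∈blocks l∈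
  ... | inj₁ low    = inj₁ low
  ... | inj₂ top≤x = inj₂ (≤-trans (m≤m+n base d) top≤x)

  -- On the common variables, those below n, only positive literals occur, and the private ranges of
  -- different blocks are disjoint.
  blocks-separate : ∀ {n d base S} G → n ≤ base → (∀ {S′} → S′ ∈ S ∷ G → ∀ {v} → v ∈ S′ → v < n) →
                    ∀ {C D} → C ∈ block d base S → D ∈ blocks d (base + d) G → ¬ Conflict C D
  blocks-separate {n} {d} {base} {S} G n≤base G<n {C} {D} C∈ D∈ conf with (x , b) , l∈ , nl∈ ← find conf
    with block-literals (G<n (here refl)) C∈ l∈
       | blocks-literals (base + d) G (≤-trans n≤base (m≤m+n base d)) (λ S∈ → G<n (there S∈)) D∈ nl∈
  ... | inj₁ (_ , refl)  | inj₁ (_ , ())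
  ... | inj₁ (x<n , _)   | inj₂ top≤x    = <⇒≱ x<n (≤-trans n≤base (≤-trans (m≤m+n base d) top≤x))
  ... | inj₂ (base≤x , _) | inj₁ (x<n , _) = <⇒≱ x<n (≤-trans n≤base base≤x)
  ... | inj₂ (_ , x<top) | inj₂ top≤x    = <⇒≱ x<top top≤x

  length-block : ∀ d base S → length (block d base S) ≡ 2 ^ d
  length-block d base S = trans (length-map _ (allVecs d)) (length-allVecs d)

  length-blocks : ∀ d base G → length (blocks d base G) ≡ length G * 2 ^ d
  length-blocks d base []      = refl
  length-blocks d base (S ∷ G) =
    trans (length-++ (block d base S)) (cong₂ _+_ (length-block d base S) (length-blocks d (base + d) G))

  e-blocks : ∀ {n} d base G → n ≤ base → (∀ {S} → S ∈ G → ∀ {v} → v ∈ S → v < n) →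
             e (blocks d base G) ≤ length G * (2 ^ d * 2 ^ d)
  e-blocks d base []      n≤base G<n = z≤n
  e-blocks d base (S ∷ G) n≤base G<n = ≤-trans
    (e-++-separate (block d base S) (blocks d (base + d) G) (blocks-separate G n≤base G<n))
    (+-mono-≤ (≤-trans (e≤length² (block d base S)) (≤-reflexive (cong₂ _*_ (length-block d base S) (length-block d base S))))
              (e-blocks d (base + d) G (≤-trans n≤base (m≤m+n base d)) (λ S∈ → G<n (there S∈))))

  block-clause : ∀ {n s d base S C} → n ≤ base → IsTuple n s S → C ∈ block d base S → IsClause C × length C ≡ s + d
  block-clause {n} {s} {d} {base} {S} n≤base tup C∈ with v , _ , refl ← ∈-map⁻ (λ v → positive S ++ fresh base v) C∈ =
    DistinctVars⇒IsClause (AllPairs.++⁺ (signed-distinct true unique) (fresh-distinct base v)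
      (All.map⁺ (All.tabulate λ x∈ → All.tabulate λ l∈ eq →
        <⇒≱ (bounded x∈) (≤-trans n≤base (≤-trans (proj₁ (fresh-vars base v l∈)) (≤-reflexive (sym eq))))))) ,
    trans (length-++ (positive S)) (cong₂ _+_ (trans (length-map _ S) length≡) (fresh-length base v))
    where open IsTuple tup

  blocks-clause : ∀ {n s d} base G → n ≤ base → (∀ {S} → S ∈ G → IsTuple n s S) → ∀ {C} → C ∈ blocks d base G →
                  IsClause C × length C ≡ s + d
  blocks-clause {d = d} base (S ∷ G) n≤base tup C∈ with ∈-++⁻ (block d base S) C∈
  ... | inj₁ C∈block  = block-clause n≤base (tup (here refl)) C∈block
  ... | inj₂ C∈blocks = blocks-clause (base + d) G (≤-trans n≤base (m≤m+n base d)) (λ S∈ → tup (there S∈)) C∈blocks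

  not-true : ∀ {b} → not b ≡ true → b ≡ false
  not-true {false} _ = refl

  signed-unsat : ∀ {α} b {S} → All (λ v → α v ≡ not b) S → ¬ SatClause α (map (_, b) S)
  signed-unsat b all sat with l , l∈ , eq ← SatClause-witness sat with x , x∈ , refl ← ∈-map⁻ (_, b) l∈ =
    not-¬ refl (trans (sym eq) (All.lookup all x∈))

  complement : Assignment → ℕ → ∀ d → Vec Bool d
  complement α base zero    = []
  complement α base (suc d) = not (α base) ∷ complement α (suc base) d

  fresh-unsat : ∀ α base d → ¬ SatClause α (fresh base (complement α base d))
  fresh-unsat α base (suc d) (here eq)   = not-¬ refl eq
  fresh-unsat α base (suc d) (there sat) = fresh-unsat α (suc base) d sat

  blocks-unsat : ∀ α d base G → Any (AllTrue (not ∘ α)) G → ∃ λ C → C ∈ blocks d base G × ¬ SatClause α C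
  blocks-unsat α d base (S ∷ G) (here all) =
    positive S ++ fresh base v , ∈-++⁺ˡ (∈-map⁺ (λ v → positive S ++ fresh base v) (∈-allVecs v)) , unsat
    where
    v = complement α base d
    unsat : ¬ SatClause α (positive S ++ fresh base v)
    unsat sat with Any.++⁻ (positive S) sat
    ... | inj₁ sat′ = signed-unsat true (All.map not-true all) sat′
    ... | inj₂ sat′ = fresh-unsat α base d sat′
  blocks-unsat α d base (S ∷ G) (there any) =
    let C , C∈ , unsat = blocks-unsat α d (base + d) G any in C , ∈-++⁺ʳ (block d base S) C∈ , unsat

  count-not : ∀ p n → count p n + count (not ∘ p) n ≡ n
  count-not p zero    = refl
  count-not p (suc n) with p n
  ... | true  = cong suc (count-not p n)
  ... | false = trans (+-suc (count p n) _) (cong suc (count-not p n))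

  negative-conflictFree : ∀ H {C D} → C ∈ map negative H → D ∈ map negative H → ¬ Conflict C D
  negative-conflictFree H C∈ D∈ conf with l , l∈ , nl∈ ← find conf
    with S , _ , refl ← ∈-map⁻ negative C∈ with S′ , _ , refl ← ∈-map⁻ negative D∈
    with x , _ , refl ← ∈-map⁻ (_, false) l∈ with y , _ , () ← ∈-map⁻ (_, false) nl∈

  module Construction (n s d g₁ g₂ : ℕ) (G H : List (List ℕ))
    (G-tuple : ∀ {S} → S ∈ G → IsTuple n s S) (H-tuple : ∀ {S} → S ∈ H → IsTuple n (s + d) S)
    (G-covers : ∀ p → g₁ + s ≤ count p n → Any (AllTrue p) G)
    (H-covers : ∀ p → g₂ + (s + d) ≤ count p n → Any (AllTrue p) H)
    (enough : g₁ + s + (g₂ + (s + d)) ≤ n) where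

    formula₀ formula : CNF
    formula₀ = blocks d n G ++ map negative H
    formula  = dedupe formula₀

    formula₀-clause : ∀ {C} → C ∈ formula₀ → IsClause C × length C ≡ s + d
    formula₀-clause C∈ with ∈-++⁻ (blocks d n G) C∈
    ... | inj₁ C∈blocks = blocks-clause n G ≤-refl G-tuple C∈blocks
    ... | inj₂ C∈neg with S , S∈ , refl ← ∈-map⁻ negative C∈neg =
      DistinctVars⇒IsClause (signed-distinct false (IsTuple.unique (H-tuple S∈))) ,
      trans (length-map _ S) (IsTuple.length≡ (H-tuple S∈))

    is-k-CNF : Is-k-CNF (s + d) formula
    is-k-CNF = (All.tabulate (λ C∈ → proj₁ (formula₀-clause (dedupe-⊆ formula₀ C∈))) , dedupe-distinct formula₀) ,
               All.tabulate (λ C∈ → proj₂ (formula₀-clause (dedupe-⊆ formula₀ C∈)))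

    -- With g₁ + s false variables, some member of G is false throughout and its block fails. With
    -- fewer, `enough` leaves g₂ + (s + d) true variables, and a negative clause from H fails.
    unsatisfiable : Unsatisfiable formula
    unsatisfiable (α , sats) with g₁ + s ≤? count (not ∘ α) n
    ... | yes many-false =
      let C , C∈ , unsat = blocks-unsat α d n G (G-covers (not ∘ α) many-false)
      in unsat (All.lookup (dedupe-sat formula₀ sats) (∈-++⁺ˡ C∈))
    ... | no few-false =
      let S , S∈ , all = find (H-covers α many-true)
      in signed-unsat false all (All.lookup (dedupe-sat formula₀ sats) (∈-++⁺ʳ (blocks d n G) (∈-map⁺ negative S∈)))
      where
      open ≤-Reasoning
      many-true : g₂ + (s + d) ≤ count α n
      many-true = +-cancelˡ-≤ (count (not ∘ α) n) _ _ (begin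
        count (not ∘ α) n + (g₂ + (s + d))   ≤⟨ +-monoˡ-≤ (g₂ + (s + d)) (<⇒≤ (≰⇒> few-false)) ⟩
        g₁ + s + (g₂ + (s + d))              ≤⟨ enough ⟩
        n                                    ≡⟨ count-not α n ⟨
        count α n + count (not ∘ α) n        ≡⟨ +-comm (count α n) _ ⟩
        count (not ∘ α) n + count α n        ∎)

    -- Different blocks do not conflict, nor do two negative clauses. All pairs inside a block, and
    -- all pairs of a block clause and a negative clause, are counted as if they conflicted.
    e-formula : e formula ≤ length G * (2 ^ d * 2 ^ d) + length G * 2 ^ d * length H
    e-formula = begin
      e formula
        ≤⟨ e-dedupe formula₀ ⟩
      e formula₀
        ≤⟨ e-++≤ (blocks d n G) (map negative H) ⟩
      e (blocks d n G) + e (map negative H) + length (blocks d n G) * length (map negative H)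
        ≤⟨ +-mono-≤ (+-mono-≤ (e-blocks d n G ≤-refl (λ S∈ → IsTuple.bounded (G-tuple S∈)))
                              (e-conflictFree (map negative H) (negative-conflictFree H)))
                    (≤-reflexive (cong₂ _*_ (length-blocks d n G) (length-map negative H))) ⟩
      length G * (2 ^ d * 2 ^ d) + 0 + length G * 2 ^ d * length H
        ≡⟨ cong (_+ length G * 2 ^ d * length H) (+-identityʳ _) ⟩
      length G * (2 ^ d * 2 ^ d) + length G * 2 ^ d * length H ∎
      where open ≤-Reasoning

  -- Growth of the construction

  -- Bernoulli gives suc s ≤ M (1 + 1/M)^s, applied to both factors; the slack (1 + 1/M)^2 between a
  -- and b pays for it.
  absorb : ∀ M a b s → 0 < M → a * (suc M * suc M) ≤ b * (M * M) → suc s * suc s * a ^ s ≤ M * M * b ^ s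
  absorb M a b s 0<M le = *-cancelʳ-≤ _ _ (M ^ s * M ^ s) {{m*n≢0 (M ^ s) (M ^ s) {{Mˢ}} {{Mˢ}}}} (begin
    suc s * suc s * a ^ s * (M ^ s * M ^ s)              ≡⟨ alg₁ (suc s) (a ^ s) (M ^ s) ⟩
    a ^ s * ((suc s * M ^ s) * (suc s * M ^ s))          ≤⟨ *-monoʳ-≤ (a ^ s) (*-mono-≤ linear linear) ⟩
    a ^ s * ((M * suc M ^ s) * (M * suc M ^ s))          ≡⟨ alg₂ M (a ^ s) (suc M ^ s) ⟩
    M * M * (a ^ s * (suc M ^ s * suc M ^ s))            ≡⟨ cong (λ z → M * M * z) (powers a (suc M)) ⟨
    M * M * (a * (suc M * suc M)) ^ s                    ≤⟨ *-monoʳ-≤ (M * M) (^-monoˡ-≤ s le) ⟩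
    M * M * (b * (M * M)) ^ s                            ≡⟨ cong (λ z → M * M * z) (powers b M) ⟩
    M * M * (b ^ s * (M ^ s * M ^ s))                    ≡⟨ *-assoc (M * M) (b ^ s) (M ^ s * M ^ s) ⟨
    M * M * b ^ s * (M ^ s * M ^ s)                      ∎)
    where
    open ≤-Reasoning
    Mˢ : NonZero (M ^ s)
    Mˢ = m^n≢0 M s {{>-nonZero 0<M}}
    alg₁ : ∀ s a m → s * s * a * (m * m) ≡ a * ((s * m) * (s * m))
    alg₁ = solve-∀
    alg₂ : ∀ m a n → a * ((m * n) * (m * n)) ≡ m * m * (a * (n * n))
    alg₂ = solve-∀
    powers : ∀ a m → (a * (m * m)) ^ s ≡ a ^ s * (m ^ s * m ^ s)
    powers a m = trans (^-distrib-* a (m * m) s) (cong (a ^ s *_) (^-distrib-* m m s))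
    linear : suc s * M ^ s ≤ M * suc M ^ s
    linear = begin
      suc s * M ^ s          ≤⟨ *-monoˡ-≤ (M ^ s) (+-mono-≤ 0<M (≤-reflexive (sym (*-identityʳ s)))) ⟩
      (M + s * 1) * M ^ s    ≤⟨ bernoulli M 1 s ⟩
      M * (M + 1) ^ s        ≡⟨ cong (λ z → M * z ^ s) (+-comm M 1) ⟩
      M * suc M ^ s          ∎

  pow-2s+r : ∀ z s r → z ^ (s + s + r) ≡ (z * z) ^ s * z ^ r
  pow-2s+r z s r = trans (^-distribˡ-+-* z (s + s) r)
    (cong (_* z ^ r) (trans (^-distribˡ-+-* z s s) (sym (^-distrib-* z z s))))

  pow-3s+r : ∀ z s r → z ^ (s + (s + s + r)) ≡ (z * z * z) ^ s * z ^ r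
  pow-3s+r z s r = begin
    z ^ (s + (s + s + r))          ≡⟨ ^-distribˡ-+-* z s (s + s + r) ⟩
    z ^ s * z ^ (s + s + r)        ≡⟨ cong (z ^ s *_) (pow-2s+r z s r) ⟩
    z ^ s * ((z * z) ^ s * z ^ r)  ≡⟨ *-assoc (z ^ s) ((z * z) ^ s) (z ^ r) ⟨
    z ^ s * (z * z) ^ s * z ^ r    ≡⟨ cong (_* z ^ r) (^-distrib-* z (z * z) s) ⟨
    (z * (z * z)) ^ s * z ^ r      ≡⟨ cong (λ c → c ^ s * z ^ r) (*-assoc z z z) ⟨
    (z * z * z) ^ s * z ^ r        ∎
    where open ≡-Reasoning

  pow-3s≤ : ∀ z s r → 0 < z → (z * z * z) ^ s ≤ z ^ (s + (s + s + r))
  pow-3s≤ z s r 0<z = ≤-trans (m≤m*n ((z * z * z) ^ s) (z ^ r) {{m^n≢0 z r {{>-nonZero 0<z}}}})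
                              (≤-reflexive (sym (pow-3s+r z s r)))

  pow-r≤ : ∀ z r → 0 < z → r ≤ 2 → z ^ r ≤ z * z
  pow-r≤ z r 0<z r≤2 = ≤-trans (^-monoʳ-≤ z {{>-nonZero 0<z}} r≤2) (≤-reflexive (cong (z *_) (*-identityʳ z)))

  cancel-scale : ∀ X Y γ δ c s → 0 < c → X * (γ * c) ^ s ≤ Y * (δ * c) ^ s → X * γ ^ s ≤ Y * δ ^ s
  cancel-scale X Y γ δ c s 0<c le = *-cancelʳ-≤ _ _ (c ^ s) {{m^n≢0 c s {{>-nonZero 0<c}}}} (begin
    X * γ ^ s * c ^ s        ≡⟨ trans (*-assoc X (γ ^ s) (c ^ s)) (cong (X *_) (sym (^-distrib-* γ c s))) ⟩
    X * (γ * c) ^ s          ≤⟨ le ⟩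
    Y * (δ * c) ^ s          ≡⟨ trans (cong (Y *_) (^-distrib-* δ c s)) (sym (*-assoc Y (δ ^ s) (c ^ s))) ⟩
    Y * δ ^ s * c ^ s        ∎)
    where open ≤-Reasoning

  -- γ₁/δ₁ and γ₂/δ₂ are the fractions of false and of true variables, the growth
  -- rate is x/y, and inner and outer bound the conflicts inside the blocks and
  -- between the blocks and the negative clauses; M absorbs polynomial factors.
  record Densities : Set where
    field
      γ₁ δ₁ c₁ γ₂ δ₂ c₂ x y M : ℕ
      0<γ₁ : 0 < γ₁
      0<γ₂ : 0 < γ₂
      0<δ₂ : 0 < δ₂
      0<c₁ : 0 < c₁
      0<c₂ : 0 < c₂
      0<x  : 0 < x
      0<y  : 0 < y
      0<M  : 0 < M
      same-total : δ₁ * c₁ ≡ δ₂ * c₂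
      room       : γ₁ * c₁ + γ₂ * c₂ + 2 ≤ δ₁ * c₁
      inner      : δ₁ * (4 * 4 * (y * y * y)) * (suc M * suc M) ≤ γ₁ * (x * x * x) * (M * M)
      outer      : δ₁ * (2 * 2 * (δ₂ * y * (δ₂ * y) * (δ₂ * y))) * (suc M * suc M) ≤
                   γ₁ * (x * γ₂ * (x * γ₂) * (x * γ₂)) * (M * M)

  module Estimate (D : Densities) (s r : ℕ) (r≤2 : r ≤ 2) where
    open Densities D
    open ≤-Reasoning

    d k : ℕ
    d = s + s + r
    k = s + d

    -- As k = 3s + r and z ≥ 1, the power z^k dominates (z³)^s, so one numerical inequality between
    -- bases decides all s.
    growth : ∀ c z → 0 < z → c * (suc M * suc M) ≤ γ₁ * (z * z * z) * (M * M) →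
             suc s * suc s * c ^ s ≤ γ₁ ^ s * (M * M * z ^ k)
    growth c z 0<z le = begin
      suc s * suc s * c ^ s                     ≤⟨ absorb M c (γ₁ * (z * z * z)) s 0<M le ⟩
      M * M * (γ₁ * (z * z * z)) ^ s            ≡⟨ cong (M * M *_) (^-distrib-* γ₁ (z * z * z) s) ⟩
      M * M * (γ₁ ^ s * (z * z * z) ^ s)        ≤⟨ *-monoʳ-≤ (M * M) (*-monoʳ-≤ (γ₁ ^ s) (pow-3s≤ z s r 0<z)) ⟩
      M * M * (γ₁ ^ s * z ^ k)                  ≡⟨ alg (M * M) (γ₁ ^ s) (z ^ k) ⟩
      γ₁ ^ s * (M * M * z ^ k)                  ∎
      where
      alg : ∀ a b c → a * (b * c) ≡ b * (a * c)
      alg = solve-∀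

    module _ (B Y G H : ℕ) (Y≤ : Y ≤ B * suc s) (G≤ : G * γ₁ ^ s ≤ Y * δ₁ ^ s) (H≤ : H * γ₂ ^ k ≤ Y * δ₂ ^ k) where

      -- Since 4^d = 16^s 4^r, the rate per unit of s is 16 δ₁/γ₁, compared with (x/y)^3 in `inner`.
      -- The remainder r ≤ 2 only affects the constant.
      inner-bound : G * (2 ^ d * 2 ^ d) * y ^ k ≤ B * (M * M) * (4 * y * (4 * y)) * x ^ k
      inner-bound = *-cancelˡ-≤ (γ₁ ^ s) {{m^n≢0 γ₁ s {{>-nonZero 0<γ₁}}}} (begin
        γ₁ ^ s * (G * (2 ^ d * 2 ^ d) * y ^ k)
          ≡⟨ cong₂ (λ u v → γ₁ ^ s * (G * u * v)) (trans (sym (^-distrib-* 2 2 d)) (pow-2s+r 4 s r)) (pow-3s+r y s r) ⟩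
        γ₁ ^ s * (G * ((4 * 4) ^ s * 4 ^ r) * ((y * y * y) ^ s * y ^ r))
          ≡⟨ alg₁ (γ₁ ^ s) G ((4 * 4) ^ s) (4 ^ r) ((y * y * y) ^ s) (y ^ r) ⟩
        G * γ₁ ^ s * ((4 * 4) ^ s * (y * y * y) ^ s) * (4 ^ r * y ^ r)
          ≤⟨ *-monoˡ-≤ (4 ^ r * y ^ r) (*-monoˡ-≤ ((4 * 4) ^ s * (y * y * y) ^ s) (≤-trans G≤ (*-monoˡ-≤ (δ₁ ^ s)
               (≤-trans Y≤ (*-monoʳ-≤ B (m≤m*n (suc s) (suc s))))))) ⟩
        B * (suc s * suc s) * δ₁ ^ s * ((4 * 4) ^ s * (y * y * y) ^ s) * (4 ^ r * y ^ r)
          ≡⟨ cong₂ (λ u v → B * (suc s * suc s) * δ₁ ^ s * u * v) (sym (^-distrib-* (4 * 4) (y * y * y) s))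
               (sym (^-distrib-* 4 y r)) ⟩
        B * (suc s * suc s) * δ₁ ^ s * (4 * 4 * (y * y * y)) ^ s * (4 * y) ^ r
          ≡⟨ alg₂ B (suc s * suc s) (δ₁ ^ s) ((4 * 4 * (y * y * y)) ^ s) ((4 * y) ^ r) ⟩
        B * (4 * y) ^ r * (suc s * suc s * (δ₁ ^ s * (4 * 4 * (y * y * y)) ^ s))
          ≡⟨ cong (λ u → B * (4 * y) ^ r * (suc s * suc s * u)) (sym (^-distrib-* δ₁ (4 * 4 * (y * y * y)) s)) ⟩
        B * (4 * y) ^ r * (suc s * suc s * (δ₁ * (4 * 4 * (y * y * y))) ^ s)
          ≤⟨ *-mono-≤ (*-monoʳ-≤ B (pow-r≤ (4 * y) r (*-mono-< {0} {4} z<s 0<y) r≤2)) (growth _ x 0<x inner) ⟩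
        B * (4 * y * (4 * y)) * (γ₁ ^ s * (M * M * x ^ k))
          ≡⟨ alg₃ B (4 * y * (4 * y)) (γ₁ ^ s) (M * M) (x ^ k) ⟩
        γ₁ ^ s * (B * (M * M) * (4 * y * (4 * y)) * x ^ k) ∎)
        where
        alg₁ : ∀ a g p q u v → a * (g * (p * q) * (u * v)) ≡ g * a * (p * u) * (q * v)
        alg₁ = solve-∀
        alg₂ : ∀ b s e p q → b * s * e * p * q ≡ b * q * (s * (e * p))
        alg₂ = solve-∀
        alg₃ : ∀ b f g m x → b * f * (g * (m * x)) ≡ g * (b * m * f * x)
        alg₃ = solve-∀

      -- The rate per unit of s is 4 (δ₁/γ₁)(δ₂/γ₂)^3, compared with (x/y)^3 in `outer`. Both
      -- families carry a factor of order `suc s`, hence the square in `growth`.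
      outer-bound : G * 2 ^ d * H * y ^ k ≤ B * B * (M * M) * (2 * (δ₂ * y) * (2 * (δ₂ * y))) * x ^ k
      outer-bound = *-cancelˡ-≤ (γ₁ ^ s * γ₂ ^ k)
          {{m*n≢0 (γ₁ ^ s) (γ₂ ^ k) {{m^n≢0 γ₁ s {{>-nonZero 0<γ₁}}}} {{m^n≢0 γ₂ k {{>-nonZero 0<γ₂}}}}}} (begin
        γ₁ ^ s * γ₂ ^ k * (G * 2 ^ d * H * y ^ k)
          ≡⟨ alg₁ (γ₁ ^ s) (γ₂ ^ k) G (2 ^ d) H (y ^ k) ⟩
        G * γ₁ ^ s * (H * γ₂ ^ k) * (2 ^ d * y ^ k)
          ≤⟨ *-monoˡ-≤ (2 ^ d * y ^ k) (*-mono-≤ (≤-trans G≤ (*-monoˡ-≤ (δ₁ ^ s) Y≤)) (≤-trans H≤ (*-monoˡ-≤ (δ₂ ^ k) Y≤))) ⟩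
        B * suc s * δ₁ ^ s * (B * suc s * δ₂ ^ k) * (2 ^ d * y ^ k)
          ≡⟨ alg₂ B (suc s) (δ₁ ^ s) (δ₂ ^ k) (2 ^ d) (y ^ k) ⟩
        B * B * (suc s * suc s) * δ₁ ^ s * (2 ^ d * (δ₂ ^ k * y ^ k))
          ≡⟨ cong₂ (λ u v → B * B * (suc s * suc s) * δ₁ ^ s * (u * v)) (pow-2s+r 2 s r)
               (trans (sym (^-distrib-* δ₂ y k)) (pow-3s+r (δ₂ * y) s r)) ⟩
        B * B * (suc s * suc s) * δ₁ ^ s * ((2 * 2) ^ s * 2 ^ r * ((δ₂ * y * (δ₂ * y) * (δ₂ * y)) ^ s * (δ₂ * y) ^ r))
          ≡⟨ alg₃ (B * B) (suc s * suc s) (δ₁ ^ s) ((2 * 2) ^ s) (2 ^ r) ((δ₂ * y * (δ₂ * y) * (δ₂ * y)) ^ s) ((δ₂ * y) ^ r) ⟩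
        B * B * (2 ^ r * (δ₂ * y) ^ r) * (suc s * suc s * (δ₁ ^ s * ((2 * 2) ^ s * (δ₂ * y * (δ₂ * y) * (δ₂ * y)) ^ s)))
          ≡⟨ cong₂ (λ u v → B * B * u * (suc s * suc s * v)) (sym (^-distrib-* 2 (δ₂ * y) r))
               (trans (cong (δ₁ ^ s *_) (sym (^-distrib-* (2 * 2) (δ₂ * y * (δ₂ * y) * (δ₂ * y)) s)))
                      (sym (^-distrib-* δ₁ (2 * 2 * (δ₂ * y * (δ₂ * y) * (δ₂ * y))) s))) ⟩
        B * B * (2 * (δ₂ * y)) ^ r * (suc s * suc s * (δ₁ * (2 * 2 * (δ₂ * y * (δ₂ * y) * (δ₂ * y)))) ^ s)
          ≤⟨ *-mono-≤ (*-monoʳ-≤ (B * B) (pow-r≤ (2 * (δ₂ * y)) r (*-mono-< {0} {2} z<s (*-mono-< 0<δ₂ 0<y)) r≤2))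
               (growth _ (x * γ₂) (*-mono-< 0<x 0<γ₂) outer) ⟩
        B * B * (2 * (δ₂ * y) * (2 * (δ₂ * y))) * (γ₁ ^ s * (M * M * (x * γ₂) ^ k))
          ≡⟨ cong (λ u → B * B * (2 * (δ₂ * y) * (2 * (δ₂ * y))) * (γ₁ ^ s * (M * M * u))) (^-distrib-* x γ₂ k) ⟩
        B * B * (2 * (δ₂ * y) * (2 * (δ₂ * y))) * (γ₁ ^ s * (M * M * (x ^ k * γ₂ ^ k)))
          ≡⟨ alg₄ (B * B) (2 * (δ₂ * y) * (2 * (δ₂ * y))) (γ₁ ^ s) (M * M) (x ^ k) (γ₂ ^ k) ⟩
        γ₁ ^ s * γ₂ ^ k * (B * B * (M * M) * (2 * (δ₂ * y) * (2 * (δ₂ * y))) * x ^ k) ∎)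
        where
        alg₁ : ∀ a b g p h y → a * b * (g * p * h * y) ≡ g * a * (h * b) * (p * y)
        alg₁ = solve-∀
        alg₂ : ∀ b s e f p y → b * s * e * (b * s * f) * (p * y) ≡ b * b * (s * s) * e * (p * (f * y))
        alg₂ = solve-∀
        alg₃ : ∀ b s e p q u v → b * s * e * (p * q * (u * v)) ≡ b * (q * v) * (s * (e * (p * u)))
        alg₃ = solve-∀
        alg₄ : ∀ b f g m x z → b * f * (g * (m * (x * z))) ≡ g * z * (b * m * f * x)
        alg₄ = solve-∀

  few-conflicts : (D : Densities) → let open Densities D in ∃ λ K → 0 < K × (∀ k → 1 ≤ k → ∃ λ F →
                  Is-k-CNF k F × Unsatisfiable F × e F * y ^ k ≤ K * x ^ k)
  few-conflicts D = suc (K₁ + K₂) , z<s , construct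
    where
    open Densities D
    open ≤-Reasoning
    U B K₁ K₂ : ℕ
    U  = δ₁ * c₁
    B  = 2 * suc (3 * U)
    K₁ = B * (M * M) * (4 * y * (4 * y))
    K₂ = B * B * (M * M) * (2 * (δ₂ * y) * (2 * (δ₂ * y)))

    with-remainder : ∀ s r → r ≤ 2 → 1 ≤ s + (s + s + r) → ∃ λ F →
      Is-k-CNF (s + (s + s + r)) F × Unsatisfiable F × e F * y ^ (s + (s + s + r)) ≤ suc (K₁ + K₂) * x ^ (s + (s + s + r))
    with-remainder s r r≤2 1≤k = formula , is-k-CNF , unsatisfiable , bound
      where
      open Estimate D s r r≤2
      n : ℕ
      -- Proportional to k, so that the two fractions of n are the integers g₁ and g₂. The slack 2
      -- in `room`, times k, accommodates the summands s and k of the covering conditions.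
      n = U * k
      g₁ g₂ : ℕ
      g₁ = γ₁ * (c₁ * k)
      g₂ = γ₂ * (c₂ * k)
      n≡₁ : n ≡ δ₁ * (c₁ * k)
      n≡₁ = *-assoc δ₁ c₁ k
      n≡₂ : n ≡ δ₂ * (c₂ * k)
      n≡₂ = trans (cong (_* k) same-total) (*-assoc δ₂ c₂ k)
      enough : g₁ + s + (g₂ + k) ≤ n
      enough = begin
        g₁ + s + (g₂ + k)                   ≤⟨ +-monoˡ-≤ (g₂ + k) (+-monoʳ-≤ g₁ (m≤m+n s d)) ⟩
        g₁ + k + (g₂ + k)                   ≡⟨ alg γ₁ c₁ γ₂ c₂ k ⟩
        (γ₁ * c₁ + γ₂ * c₂ + 2) * k         ≤⟨ *-monoˡ-≤ k room ⟩
        n                                   ∎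
        where
        alg : ∀ a b c d k → a * (b * k) + k + (c * (d * k) + k) ≡ (a * b + c * d + 2) * k
        alg = solve-∀
      0<c₁k : 0 < c₁ * k
      0<c₁k = *-mono-< 0<c₁ 1≤k
      0<c₂k : 0 < c₂ * k
      0<c₂k = *-mono-< 0<c₂ 1≤k
      cover₁ = covering n s g₁ (*-mono-< 0<γ₁ 0<c₁k) (≤-trans (≤-trans (m≤m+n g₁ s) (m≤m+n (g₁ + s) (g₂ + k))) enough)
      cover₂ = covering n k g₂ (*-mono-< 0<γ₂ 0<c₂k) (≤-trans (≤-trans (m≤m+n g₂ k) (m≤n+m (g₂ + k) (g₁ + s))) enough)
      G = proj₁ cover₁
      H = proj₁ cover₂
      open Construction n s d g₁ g₂ G H (proj₁ (proj₂ (proj₂ cover₁))) (proj₁ (proj₂ (proj₂ cover₂)))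
        (proj₂ (proj₂ (proj₂ cover₁))) (proj₂ (proj₂ (proj₂ cover₂))) enough
      Y : ℕ
      Y = 2 * suc n
      Y≤ : Y ≤ B * suc s
      Y≤ = begin
        2 * suc (U * k)                   ≤⟨ *-monoʳ-≤ 2 (s≤s (*-monoʳ-≤ U (+-monoʳ-≤ s (+-monoʳ-≤ (s + s) r≤2)))) ⟩
        -- Padding by s + U completes the expression to a multiple of `suc s`.
        2 * suc (U * (s + (s + s + 2)))   ≤⟨ *-monoʳ-≤ 2 (s≤s (m≤m+n _ (s + U))) ⟩
        2 * suc (U * (s + (s + s + 2)) + (s + U))   ≡⟨ alg U s ⟩
        2 * suc (3 * U) * suc s           ∎
        where
        alg : ∀ u s → 2 * (1 + (u * (s + (s + s + 2)) + (s + u))) ≡ 2 * (1 + 3 * u) * (1 + s)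
        alg = solve-∀
      G≤ : length G * γ₁ ^ s ≤ Y * δ₁ ^ s
      G≤ = cancel-scale (length G) Y γ₁ δ₁ (c₁ * k) s 0<c₁k
             (subst (λ m → length G * g₁ ^ s ≤ Y * m ^ s) n≡₁ (proj₁ (proj₂ cover₁)))
      H≤ : length H * γ₂ ^ k ≤ Y * δ₂ ^ k
      H≤ = cancel-scale (length H) Y γ₂ δ₂ (c₂ * k) k 0<c₂k
             (subst (λ m → length H * g₂ ^ k ≤ Y * m ^ k) n≡₂ (proj₁ (proj₂ cover₂)))
      bound : e formula * y ^ k ≤ suc (K₁ + K₂) * x ^ k
      bound = begin
        e formula * y ^ k
          ≤⟨ *-monoˡ-≤ (y ^ k) e-formula ⟩
        (length G * (2 ^ d * 2 ^ d) + length G * 2 ^ d * length H) * y ^ k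
          ≡⟨ *-distribʳ-+ (y ^ k) (length G * (2 ^ d * 2 ^ d)) (length G * 2 ^ d * length H) ⟩
        length G * (2 ^ d * 2 ^ d) * y ^ k + length G * 2 ^ d * length H * y ^ k
          ≤⟨ +-mono-≤ (inner-bound B Y (length G) (length H) Y≤ G≤ H≤) (outer-bound B Y (length G) (length H) Y≤ G≤ H≤) ⟩
        K₁ * x ^ k + K₂ * x ^ k
          ≡⟨ *-distribʳ-+ (x ^ k) K₁ K₂ ⟨
        (K₁ + K₂) * x ^ k
          ≤⟨ *-monoˡ-≤ (x ^ k) (n≤1+n (K₁ + K₂)) ⟩
        suc (K₁ + K₂) * x ^ k ∎

    construct : ∀ k → 1 ≤ k → ∃ λ F → Is-k-CNF k F × Unsatisfiable F × e F * y ^ k ≤ suc (K₁ + K₂) * x ^ k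
    construct k 1≤k = subst (λ k → ∃ λ F → Is-k-CNF k F × Unsatisfiable F × e F * y ^ k ≤ suc (K₁ + K₂) * x ^ k) k≡
      (with-remainder (k / 3) (k % 3) (s≤s⁻¹ (m%n<n k 3)) (subst (1 ≤_) (sym k≡) 1≤k))
      where
      alg : ∀ q r → q + (q + q + r) ≡ r + q * 3
      alg = solve-∀
      k≡ : k / 3 + (k / 3 + k / 3 + k % 3) ≡ k
      k≡ = trans (alg (k / 3) (k % 3)) (sym (m≡m%n+[m/n]*n k 3))

  densities : Densities
  densities = record
    -- The fraction 31499/50000 is 0.63 less the slack in `room`. The tight condition is `inner`:
    -- 1600/37 = 43.2432... against 3.51³ = 43.2435..., which forces the large M.
    { γ₁ = 37 ; δ₁ = 100 ; c₁ = 1000 ; γ₂ = 31499 ; δ₂ = 50000 ; c₂ = 2 ; x = 351 ; y = 100 ; M = 300000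
    ; 0<γ₁ = z<s ; 0<γ₂ = z<s ; 0<δ₂ = z<s ; 0<c₁ = z<s ; 0<c₂ = z<s ; 0<x = z<s ; 0<y = z<s ; 0<M = z<s
    ; same-total = refl
    ; room  = ≤ᵇ⇒≤ _ _ tt
    ; inner = ≤ᵇ⇒≤ _ _ tt
    ; outer = ≤ᵇ⇒≤ _ _ tt
    }

-- Transfer to rational numbers

open import Data.Nat using (zero; suc; _^_; z<s) renaming (_<_ to _<ℕ_; _*_ to _*ℕ_; _+_ to _+ℕ_)
open import Data.Integer using (+_)
open import Data.Nat.Properties using (*-identityʳ; *-identityˡ; +-identityʳ) renaming (≤-trans to ≤ℕ-trans; ≤-reflexive to ≤ℕ-reflexive; *-assoc to *ℕ-assoc; *-comm to *ℕ-comm)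
import Data.Integer as ℤ
import Data.Integer.Properties as ℤ
open import Data.Rational using (ℚ; 0ℚ; _<_; _≤_; _*_; _/_; toℚᵘ)
open import Data.Rational.Properties using (toℚᵘ-cancel-≤; toℚᵘ-cancel-<; toℚᵘ-homo-*; toℚᵘ-fromℚᵘ)
open import Data.Rational.Unnormalised using (mkℚᵘ; *≤*; *<*; *≡*) renaming (_≃_ to _≃ᵘ_)
import Data.Rational.Unnormalised.Properties as ℚᵘ
open Naturals using (many-conflicts; few-conflicts; densities; module Numerics)

-- Rationals are kept in lowest terms; relating them to unreduced fractions lets numerators and
-- denominators of powers be computed separately.
record _≐_/1+_ (q : ℚ) (n d : ℕ) : Set where
  constructor represents
  field
    equal : toℚᵘ q ≃ᵘ mkℚᵘ (+ n) d

/-≐ : ∀ n d → (+ n / suc d) ≐ n /1+ d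
/-≐ n d = represents (toℚᵘ-fromℚᵘ (mkℚᵘ (+ n) d))

*-≐ : ∀ {p q n m d c} → p ≐ n /1+ d → q ≐ m /1+ c → (p * q) ≐ (n *ℕ m) /1+ (c +ℕ d *ℕ suc c)
*-≐ {p} {q} {n} {m} {d} {c} (represents p≃) (represents q≃) = represents (ℚᵘ.≃-trans (toℚᵘ-homo-* p q)
  (ℚᵘ.≃-trans (ℚᵘ.*-cong p≃ q≃) (ℚᵘ.≃-reflexive (cong (λ i → mkℚᵘ i (c +ℕ d *ℕ suc c)) (sym (ℤ.pos-* n m))))))

^-≐ : ∀ {q n d} k → q ≐ n /1+ d → ∃ λ c → suc c ≡ suc d ^ k × (q ^ℚ k) ≐ (n ^ k) /1+ c
^-≐ zero q≐ = 0 , refl , represents (*≡* refl)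
^-≐ {d = d} (suc k) q≐ with c , eq , qᵏ≐ ← ^-≐ k q≐ = c +ℕ d *ℕ suc c , cong (suc d *ℕ_) eq , *-≐ q≐ qᵏ≐

≐-≤ : ∀ {p q n m d c} → p ≐ n /1+ d → q ≐ m /1+ c → n *ℕ suc c ≤ℕ m *ℕ suc d → p ≤ q
≐-≤ {n = n} {m} {d} {c} (represents p≃) (represents q≃) le = toℚᵘ-cancel-≤
  (ℚᵘ.≤-respˡ-≃ (ℚᵘ.≃-sym p≃) (ℚᵘ.≤-respʳ-≃ (ℚᵘ.≃-sym q≃)
    (*≤* (subst₂ ℤ._≤_ (ℤ.pos-* n (suc c)) (ℤ.pos-* m (suc d)) (ℤ.+≤+ le)))))

≐-< : ∀ {p q n m d c} → p ≐ n /1+ d → q ≐ m /1+ c → n *ℕ suc c <ℕ m *ℕ suc d → p < q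
≐-< {n = n} {m} {d} {c} (represents p≃) (represents q≃) lt = toℚᵘ-cancel-<
  (ℚᵘ.<-respˡ-≃ (ℚᵘ.≃-sym p≃) (ℚᵘ.<-respʳ-≃ (ℚᵘ.≃-sym q≃)
    (*<* (subst₂ ℤ._<_ (ℤ.pos-* n (suc c)) (ℤ.pos-* m (suc d)) (ℤ.+<+ lt)))))

lower-ℚ : ∀ K a b k m → a ^ k ≤ℕ suc K *ℕ m *ℕ suc b ^ k → (+ 1 / suc K) * ((+ a / suc b) ^ℚ k) ≤ (+ m / 1)
lower-ℚ K a b k m le with c , eq , power≐ ← ^-≐ k (/-≐ a b) = ≐-≤ (*-≐ (/-≐ 1 K) power≐) (/-≐ m 0)
  (≤ℕ-trans (≤ℕ-reflexive (trans (*-identityʳ _) (*-identityˡ (a ^ k)))) (≤ℕ-trans le (≤ℕ-reflexive (begin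
    suc K *ℕ m *ℕ suc b ^ k      ≡⟨ cong (_*ℕ suc b ^ k) (*ℕ-comm (suc K) m) ⟩
    m *ℕ suc K *ℕ suc b ^ k      ≡⟨ *ℕ-assoc m (suc K) (suc b ^ k) ⟩
    m *ℕ (suc K *ℕ suc b ^ k)    ≡⟨ cong (λ z → m *ℕ (suc K *ℕ z)) eq ⟨
    m *ℕ (suc K *ℕ suc c)        ∎))))
  where open ≡-Reasoning

upper-ℚ : ∀ K a b k m → m *ℕ suc b ^ k ≤ℕ K *ℕ a ^ k → (+ m / 1) ≤ (+ K / 1) * ((+ a / suc b) ^ℚ k)
upper-ℚ K a b k m le with c , eq , power≐ ← ^-≐ k (/-≐ a b) = ≐-≤ (/-≐ m 0) (*-≐ (/-≐ K 0) power≐)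
  (≤ℕ-trans (≤ℕ-reflexive (cong (m *ℕ_) (trans (cong suc (+-identityʳ c)) eq)))
            (≤ℕ-trans le (≤ℕ-reflexive (sym (*-identityʳ _)))))

positive-/ : ∀ n d → 0 <ℕ n → 0ℚ < (+ n / suc d)
positive-/ n d 0<n = ≐-< (/-≐ 0 0) (/-≐ n d) (≤ℕ-trans 0<n (≤ℕ-reflexive (sym (*-identityʳ n))))

theorem1 : (Σ ℚ (λ c → (0ℚ < c) × ((k : ℕ) → 1 ≤ℕ k → (F : CNF) → Is-k-CNF k F → Unsatisfiable F → c * ((+ 269 / 100) ^ℚ k) ≤ (+ e F / 1))))
    × (Σ ℚ (λ C → (0ℚ < C) × ((k : ℕ) → 1 ≤ℕ k → Σ CNF (λ F → Is-k-CNF k F × Unsatisfiable F × ((+ e F / 1) ≤ C * ((+ 351 / 100) ^ℚ k))))))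
theorem1 = part-a (many-conflicts Numerics.parameters) , part-b (few-conflicts densities)
  where
  part-a : (∃ λ K → 0 <ℕ K ×
             (∀ k → 1 ≤ℕ k → ∀ F → Is-k-CNF k F → Unsatisfiable F → 269 ^ k ≤ℕ K *ℕ e F *ℕ 100 ^ k)) → _
  -- The lower bound holds with c the reciprocal of the integer constant; 99 encodes the denominator
  -- 100.
  part-a (suc K , _ , bound) = (+ 1 / suc K) , positive-/ 1 K z<s ,
    λ k 1≤k F kCNF unsat → lower-ℚ K 269 99 k (e F) (bound k 1≤k F kCNF unsat)
  part-b : (∃ λ K → 0 <ℕ K × (∀ k → 1 ≤ℕ k → ∃ λ F →
             Is-k-CNF k F × Unsatisfiable F × e F *ℕ 100 ^ k ≤ℕ K *ℕ 351 ^ k)) → _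
  part-b (K , 0<K , construct) = (+ K / 1) , positive-/ K 0 0<K , λ k 1≤k →
    let F , kCNF , unsat , bound = construct k 1≤k in F , kCNF , unsat , upper-ℚ K 351 99 k (e F) bound
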